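{- (a) For a connected graph $G$ with at least one edge, the following three conditions are equivalent: (i) $G$ is map-rich; (ii) $G$ has an sp-embedding in a closed surface $S$ with Euler characteristic $\chi(S)=3-|V(G)|+\gamma$, where $\gamma$ is the dimension over $GF(2)$ of the bicycle space of $G$; (iii) there is an sp-embedding $(H,S)$ of $G$ such that the cycle space of $H$ over $GF(2)$ is generated by the boundaries of the faces of $(H,S)$ together with the edge sets of the smooth paths of $(H,S)$. (b) For every map $M$ with phial $P$: if $P$ is orientable, then $G_M$ is eulerian (every vertex has even degree). Conversely, if $M$ and $P$ are rich and $G_M$ is eulerian, then $P$ is orientable.
   Context: Graphs are finite and may have loops and multiple edges. A map is a triple $M=(C_M,v_M,f_M)$ where $C_M$ is a finite cubic graph and $v_M,f_M$ are disjoint perfect matchings of $C_M$ such that the subgraph formed by $v_M\cup f_M$ is a disjoint union of 4-cycles, the squares of $M$ (set $SQ(M)$). Let $a_M=E(C_M)\setminus(v_M\cup f_M)$ and let $z_M$ be the perfect matching on $V(C_M)$ (not edges of $C_M$) consisting of the two diagonals (pairs of opposite vertices) of each square; $Q_M=C_M\cup z_M$. The $v$-gons of $M$ are the cycles of the 2-regular graph formed by $v_M\cup a_M$; the $f$-gons those of $f_M\cup a_M$. $M$ is orientable if $C_M$ is bipartite. The graph $G_M$ has vertex set the $v$-gons, edge set $SQ(M)$, each square joining the (possibly equal) $v$-gons containing its two $v_M$-edges. The dual of $M$ is $D=(C_M,f_M,v_M)$ and the phial of $M$ is $P=(Q_M\setminus v_M,z_M,f_M)$; edge sets of $G_M,G_D,G_P$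 are all identified with $SQ(M)$. Subsets of $SQ(M)$ form a $GF(2)$-vector space under symmetric difference with form $\langle A,B\rangle=|A\cap B|\bmod 2$; $W^\perp$ denotes the orthogonal complement. Let $V,F,Z$ be the coboundary (edge-cut) spaces of $G_M,G_D,G_P$; thus $V^\perp$ is the cycle space of $G_M$. One has $F+Z\subseteq V^\perp$; the deficiency is $\mathrm{def}(M)=\dim V^\perp-\dim(F+Z)$, and $M$ is rich if $\mathrm{def}(M)=0$. A graph $G$ is map-rich if there is a rich map $M$ with $G_M\cong G$. The bicycle space of a graph is the intersection of its cycle space and its coboundary space. A t-map is a graph $H$ embedded in a closed surface $S$ so that every component of $S\setminus H$ (a face) is an open disc; the boundary of a face is the set of edges occurring exactly once in its facial walk. If $H$ is 4-regular, at each vertex two edge-ends are opposite if they are not consecutive in the cyclic order around the vertex; a smooth path is a closed walk that at every vertex leaves along the edge opposite to the one by which it arrived (the smooth paths partition $E(H)$). An sp-embedding of a graph $G$ in $S$ is a t-map $(H,S)$ with $H$ 4-regular whose faces can be properly 2-colored (the two sides of each edge get different colors) such that $G$ is isomorphic to the graph whose vertices are the smooth paths of $(H,S)$ and whose edges are the vertices of $H$, each vertex $x$ of $H$ joining the smooth path(s) passing through $x$. -}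

module Defs where

open import Data.Bool using (Bool; if_then_else_; _xor_)
open import Data.Fin using (Fin; _≟_; punchOut; punchIn)
open import Data.Fin.Properties using (punchOut-cong; punchOut-injective; punchOut-punchIn; punchInᵢ≢i)
open import Data.Fin.Subset using (Subset; ⊥; ⊤; _∩_; ∣_∣)
open import Data.Integer using (ℤ; +_; _-_) renaming (_+_ to _+ℤ_)
open import Data.List using (List; []; _∷_; allFin; cartesianProductWith)
open import Data.List.Membership.Propositional using (_∈_)
open import Data.List.Membership.Propositional.Properties using (∈-allFin; ∈-cartesianProductWith⁺; ∈-cartesianProductWith⁻)
open import Data.List.Relation.Unary.Any using (here; there)
open import Data.Nat using (ℕ; suc; _+_; _%_; _≡ᵇ_)
open import Data.Nat.Divisibility using (_∣_)
open import Data.Product using (Σ; ∃-syntax; _×_; _,_; proj₁; proj₂; map; swap)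
open import Data.Sum using (_⊎_; inj₁; inj₂)
open import Data.Vec using (Vec; []; _∷_; lookup; tabulate; zipWith; sum)
open import Function using (_∘_; _↔_; _⇔_; Inverse)
open import Level using (0ℓ)
open import Relation.Binary using (Rel)
open import Relation.Binary.Construct.Closure.Equivalence as EqC using (EqClosure)
open import Relation.Binary.PropositionalEquality
  using (_≡_; _≢_; refl; sym; trans; cong; isEquivalence; ≢-sym)
open import Relation.Nullary using (yes; no; contradiction)
open import Relation.Unary using (Pred; _≐_) renaming (_∩_ to _∩ₚ_)

------------------------------------------------------------------------
-- GF(2)-linear algebra on the subsets of a finite set

infixl 6 _⊕_ _+ₛ_

_⊕_ : ∀ {m} → Subset m → Subset m → Subset m
_⊕_ = zipWith _xor_

⟨_,_⟩ : ∀ {m} → Subset m → Subset m → ℕ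
⟨ A , B ⟩ = ∣ A ∩ B ∣ % 2

_ᗮ : ∀ {m} → Pred (Subset m) 0ℓ → Pred (Subset m) 0ℓ
(W ᗮ) A = ∀ B → W B → ⟨ A , B ⟩ ≡ 0

_+ₛ_ : ∀ {m} → Pred (Subset m) 0ℓ → Pred (Subset m) 0ℓ → Pred (Subset m) 0ℓ
(U +ₛ W) A = ∃[ B ] ∃[ C ] U B × W C × B ⊕ C ≡ A

-- The coefficient vector in GF(2)ᵏ is given as a Subset k.
combination : ∀ {k m} → Subset k → Vec (Subset m) k → Subset m
combination []      []       = ⊥
combination (c ∷ cs) (A ∷ As) = (if c then A else ⊥) ⊕ combination cs As

Span : ∀ {k m} → Vec (Subset m) k → Pred (Subset m) 0ℓ
Span As A = ∃[ cs ] combination cs As ≡ A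

LinearlyIndependent : ∀ {k m} → Vec (Subset m) k → Set
LinearlyIndependent As = ∀ cs → combination cs As ≡ ⊥ → cs ≡ ⊥

-- HasDim W d: W is a subspace of dimension d.
HasDim : ∀ {m} → Pred (Subset m) 0ℓ → ℕ → Set
HasDim {m} W d = Σ (Vec (Subset m) d) λ basis → LinearlyIndependent basis × W ≐ Span basis

------------------------------------------------------------------------
-- Finite graphs, loops and multiple edges allowed

-- The order of the two ends of an edge carries no meaning.
record Graph : Set where
  field
    #V #E : ℕ
    ends  : Fin #E → Fin #V × Fin #V

open Graph public

record _≅_ (G H : Graph) : Set where
  field
    V↔ : Fin (#V G) ↔ Fin (#V H)
    E↔ : Fin (#E G) ↔ Fin (#E H)

  mapEnds : Fin (#V G) × Fin (#V G) → Fin (#V H) × Fin (#V H)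
  mapEnds = map (Inverse.to V↔) (Inverse.to V↔)

  field
    ends-≅ : ∀ e → ends H (Inverse.to E↔ e) ≡ mapEnds (ends G e)
                 ⊎ ends H (Inverse.to E↔ e) ≡ swap (mapEnds (ends G e))

Adjacent : (G : Graph) → Rel (Fin (#V G)) 0ℓ
Adjacent G u w = ∃[ e ] ends G e ≡ (u , w)

-- The empty graph counts as connected.
Connected : Graph → Set
Connected G = ∀ u w → EqClosure (Adjacent G) u w

[_≡?_] : ∀ {n} → Fin n → Fin n → ℕ
[ i ≡? j ] with i ≟ j
... | yes _ = 1
... | no  _ = 0

-- Degree in the spanning subgraph with edge set A; a loop counts twice.
degreeIn : (G : Graph) → Subset (#E G) → Fin (#V G) → ℕ
degreeIn G A w = sum (tabulate λ e →
  if lookup A e then [ proj₁ (ends G e) ≡? w ] + [ proj₂ (ends G e) ≡? w ] else 0)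

degree : (G : Graph) → Fin (#V G) → ℕ
degree G = degreeIn G ⊤

Eulerian : Graph → Set
Eulerian G = ∀ w → 2 ∣ degree G w

CycleSpace : (G : Graph) → Pred (Subset (#E G)) 0ℓ
CycleSpace G A = ∀ w → 2 ∣ degreeIn G A w

coboundary : (G : Graph) → Subset (#V G) → Subset (#E G)
coboundary G U = tabulate λ e →
  lookup U (proj₁ (ends G e)) xor lookup U (proj₂ (ends G e))

CoboundarySpace : (G : Graph) → Pred (Subset (#E G)) 0ℓ
CoboundarySpace G A = ∃[ U ] coboundary G U ≡ A

BicycleSpace : (G : Graph) → Pred (Subset (#E G)) 0ℓ
BicycleSpace G = CycleSpace G ∩ₚ CoboundarySpace G

------------------------------------------------------------------------
-- Orbits

-- An enumeration of the classes of the equivalence relation generated by R,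
-- with a chosen representative of each class.
record Classes {n : ℕ} (R : Rel (Fin n) 0ℓ) : Set where
  field
    size      : ℕ
    class     : Fin n → Fin size
    rep       : Fin size → Fin n
    class-rep : ∀ c → class (rep c) ≡ c
    sound     : ∀ {x y} → EqClosure R x y → class x ≡ class y
    complete  : ∀ {x y} → class x ≡ class y → EqClosure R x y

open Classes public

Moves : ∀ {n} → List (Fin n → Fin n) → Rel (Fin n) 0ℓ
Moves gs x y = ∃[ g ] g ∈ gs × g x ≡ y

SameOrbit : ∀ {n} → List (Fin n → Fin n) → Rel (Fin n) 0ℓ
SameOrbit gs = EqClosure (Moves gs)

reclass : ∀ {n} {R S : Rel (Fin n) 0ℓ} →
          (∀ {x y} → R x y → EqClosure S x y) → (∀ {x y} → S x y → EqClosure R x y) →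
          Classes R → Classes S
reclass {R = R} {S} R⇒S S⇒R P = record
  { size      = size P
  ; class     = class P
  ; rep       = rep P
  ; class-rep = class-rep P
  ; sound     = λ p → sound P ((S⇒R EqC.⋆) p)
  ; complete  = λ q → (R⇒S EqC.⋆) (complete P q)
  }

private

  Listed : ∀ {n} → List (Fin n × Fin n) → Rel (Fin n) 0ℓ
  Listed ps x y = (x , y) ∈ ps

  -- The quotient map of Fin (suc k) that identifies j with i.
  glue : ∀ {k} {i j : Fin (suc k)} → j ≢ i → Fin (suc k) → Fin k
  glue {j = j} j≢i l with j ≟ l
  ... | yes _   = punchOut j≢i
  ... | no  j≢l = punchOut j≢l

  glue-≡ : ∀ {k} {i j : Fin (suc k)} (j≢i : j ≢ i) → glue j≢i i ≡ glue j≢i j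
  glue-≡ {i = i} {j} j≢i with j ≟ i | j ≟ j
  ... | yes p | _     = contradiction p j≢i
  ... | no  _ | no ¬p = contradiction refl ¬p
  ... | no  _ | yes _ = punchOut-cong j refl

  glue-punchIn : ∀ {k} {i j : Fin (suc k)} (j≢i : j ≢ i) (l : Fin k) →
                 glue j≢i (punchIn j l) ≡ l
  glue-punchIn {j = j} j≢i l with j ≟ punchIn j l
  ... | yes p = contradiction (sym p) (punchInᵢ≢i j l)
  ... | no  _ = trans (punchOut-cong j refl) (punchOut-punchIn j)

  glue-inv : ∀ {k} {i j : Fin (suc k)} (j≢i : j ≢ i) {l m : Fin (suc k)} →
             glue j≢i l ≡ glue j≢i m → l ≡ m ⊎ (l ≡ i × j ≡ m) ⊎ (j ≡ l × i ≡ m)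
  glue-inv {i = i} {j} j≢i {l} {m} p with j ≟ l | j ≟ m
  ... | yes q | yes r = inj₁ (trans (sym q) r)
  ... | yes q | no  r = inj₂ (inj₂ (q , punchOut-injective j≢i r p))
  ... | no  q | yes r = inj₂ (inj₁ (punchOut-injective q j≢i p , r))
  ... | no  q | no  r = inj₁ (punchOut-injective q r p)

  module _ {n : ℕ} {x y : Fin n} {ps : List (Fin n × Fin n)} where

    weaken : ∀ {u w} → EqClosure (Listed ps) u w → EqClosure (Listed ((x , y) ∷ ps)) u w
    weaken = EqC.map there

    link : EqClosure (Listed ((x , y) ∷ ps)) x y
    link = EqC.return (here refl)

  extend : ∀ {n} (x y : Fin n) {ps} → Classes (Listed ps) → Classes (Listed ((x , y) ∷ ps))
  extend {n} x y {ps} record { size = 0 ; class = cl } with () ← cl x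
  extend {n} x y {ps} record { size = suc k ; class = cl ; rep = rp ; class-rep = cr
                             ; sound = so ; complete = co }
    with cl y ≟ cl x
  ... | yes q = record
    { size      = suc k
    ; class     = cl
    ; rep       = rp
    ; class-rep = cr
    ; sound     = EqC.gfold isEquivalence cl
                    λ { (here refl) → sym q ; (there p) → so (EqC.return p) }
    ; complete  = λ p → weaken (co p)
    }
  ... | no y≢x = record
    { size      = k
    ; class     = glue y≢x ∘ cl
    ; rep       = rp ∘ punchIn (cl y)
    ; class-rep = λ c → trans (cong (glue y≢x) (cr (punchIn (cl y) c))) (glue-punchIn y≢x c)
    ; sound     = EqC.gfold isEquivalence (glue y≢x ∘ cl)
                    λ { (here refl) → glue-≡ y≢x
                      ; (there p)   → cong (glue y≢x) (so (EqC.return p)) }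
    ; complete  = λ p → back (glue-inv y≢x p)
    }
    where
    R⁺ : Rel (Fin n) 0ℓ
    R⁺ = Listed ((x , y) ∷ ps)

    _▸_ : ∀ {u w z} → EqClosure R⁺ u w → EqClosure R⁺ w z → EqClosure R⁺ u z
    _▸_ = EqC.transitive R⁺

    back : ∀ {u w} → cl u ≡ cl w ⊎ (cl u ≡ cl x × cl y ≡ cl w) ⊎ (cl y ≡ cl u × cl x ≡ cl w) →
           EqClosure R⁺ u w
    back (inj₁ p)              = weaken (co p)
    back (inj₂ (inj₁ (p , q))) = (weaken (co p) ▸ link) ▸ weaken (co q)
    back (inj₂ (inj₂ (p , q))) =
      (weaken (co (sym p)) ▸ EqC.symmetric R⁺ link) ▸ weaken (co q)

  classesOf : ∀ {n} (ps : List (Fin n × Fin n)) → Classes (Listed ps)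
  classesOf {n} [] = record
    { size      = n
    ; class     = λ x → x
    ; rep       = λ x → x
    ; class-rep = λ _ → refl
    ; sound     = EqC.fold isEquivalence λ ()
    ; complete  = λ { refl → EqC.reflexive _ }
    }
  classesOf ((x , y) ∷ ps) = extend x y (classesOf ps)

orbits : ∀ {n} (gs : List (Fin n → Fin n)) → Classes (Moves gs)
orbits {n} gs = reclass to from (classesOf moves)
  where
  move : (Fin n → Fin n) → Fin n → Fin n × Fin n
  move g x = x , g x

  moves : List (Fin n × Fin n)
  moves = cartesianProductWith move gs (allFin n)

  to : ∀ {x y} → Listed moves x y → SameOrbit gs x y
  to p with g , _ , g∈ , _ , refl ← ∈-cartesianProductWith⁻ move gs (allFin n) p =
    EqC.return (g , g∈ , refl)

  from : ∀ {x y} → Moves gs x y → EqClosure (Listed moves) x y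
  from {x} (g , g∈ , refl) = EqC.return (∈-cartesianProductWith⁺ move g∈ (∈-allFin x))

------------------------------------------------------------------------
-- Maps

-- A perfect matching on the vertex set Fin n, given as the function sending
-- each vertex to its partner.
record IsMatching {n : ℕ} (p : Fin n → Fin n) : Set where
  field
    involutive : ∀ x → p (p x) ≡ x
    no-fixed   : ∀ x → p x ≢ x

open IsMatching public

-- C_M is the graph on Fin #C whose edge set is the disjoint union of the
-- perfect matchings v, f and a: removing two disjoint perfect matchings from
-- a cubic graph leaves a third one.  An a-edge may be parallel to a v-edge or
-- to an f-edge.  By v≢f and square, the cycle of v ∪ f through x is the 4-cycle
-- x, v x, f (v x), f x.
-- An enumeration SQ of the squares is part of the data, so that a map, its
-- dual and its phial literally share their squares.
record Map : Set where
  field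
    #C         : ℕ
    v f a      : Fin #C → Fin #C
    v-matching : IsMatching v
    f-matching : IsMatching f
    a-matching : IsMatching a
    v≢f        : ∀ x → v x ≢ f x
    square     : ∀ x → v (f x) ≡ f (v x)
    SQ         : Classes (Moves (v ∷ f ∷ []))

  z : Fin #C → Fin #C
  z = v ∘ f

  z-matching : IsMatching z
  z-matching = record
    { involutive = λ x → trans (cong v (trans (cong f (square x)) (involutive f-matching (v x))))
                               (involutive v-matching x)
    ; no-fixed   = λ x p → v≢f x (trans (cong v (sym p)) (involutive v-matching (f x)))
    }

  v-gons : Classes (Moves (v ∷ a ∷ []))
  v-gons = orbits (v ∷ a ∷ [])

open Map public

-- The v-edges of the square of x are {x , v x} and {f x , v (f x)}.
𝔾 : Map → Graph
𝔾 M = record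
  { #V   = size (v-gons M)
  ; #E   = size (SQ M)
  ; ends = λ s → let x = rep (SQ M) s in class (v-gons M) x , class (v-gons M) (f M x)
  }

-- C_M is bipartite.
Orientable : Map → Set
Orientable M = Σ (Fin (#C M) → Bool) λ side →
  ∀ x → side (v M x) ≢ side x × side (f M x) ≢ side x × side (a M x) ≢ side x

dual : Map → Map
dual M = record
  { #C         = #C M
  ; v          = f M
  ; f          = v M
  ; a          = a M
  ; v-matching = f-matching M
  ; f-matching = v-matching M
  ; a-matching = a-matching M
  ; v≢f        = λ x → ≢-sym (v≢f M x)
  ; square     = λ x → sym (square M x)
  ; SQ         = reclass (λ m → EqC.return (exchange m)) (λ m → EqC.return (exchange m)) (SQ M)
  }
  where
  exchange : ∀ {g h : Fin (#C M) → Fin (#C M)} {x y} →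
             Moves (g ∷ h ∷ []) x y → Moves (h ∷ g ∷ []) x y
  exchange (k , here p , q)         = k , there (here p) , q
  exchange (k , there (here p) , q) = k , here p , q

phial : Map → Map
phial M = record
  { #C         = #C M
  ; v          = z M
  ; f          = f M
  ; a          = a M
  ; v-matching = z-matching M
  ; f-matching = f-matching M
  ; a-matching = a-matching M
  ; v≢f        = λ x → no-fixed (v-matching M) (f M x)
  ; square     = λ x → trans (cong (v M) (ff x)) (trans (sym (ff (v M x))) (cong (f M) (sym (square M x))))
  ; SQ         = reclass to from (SQ M)
  }
  where
  ff : ∀ x → f M (f M x) ≡ x
  ff = involutive (f-matching M)

  to : ∀ {x y} → Moves (v M ∷ f M ∷ []) x y → SameOrbit (z M ∷ f M ∷ []) x y
  to {x} (_ , here refl , refl) =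
    EqC.transitive _ (EqC.return (f M , there (here refl) , refl))
                     (EqC.return (z M , here refl , cong (v M) (ff x)))
  to (_ , there (here refl) , refl) = EqC.return (f M , there (here refl) , refl)

  from : ∀ {x y} → Moves (z M ∷ f M ∷ []) x y → SameOrbit (v M ∷ f M ∷ []) x y
  from (_ , here refl , refl) =
    EqC.transitive _ (EqC.return (f M , there (here refl) , refl))
                     (EqC.return (v M , here refl , refl))
  from (_ , there (here refl) , refl) = EqC.return (f M , there (here refl) , refl)

VSpace FSpace ZSpace : (M : Map) → Pred (Subset (size (SQ M))) 0ℓ
VSpace M = CoboundarySpace (𝔾 M)
FSpace M = CoboundarySpace (𝔾 (dual M))
ZSpace M = CoboundarySpace (𝔾 (phial M))

HasDeficiency : Map → ℕ → Set
HasDeficiency M k = ∃[ d ] ∃[ e ]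
  HasDim (VSpace M ᗮ) d × HasDim (FSpace M +ₛ ZSpace M) e × d ≡ e + k

Rich : Map → Set
Rich M = HasDeficiency M 0

MapRich : Graph → Set
MapRich G = ∃[ M ] Rich M × 𝔾 M ≅ G

------------------------------------------------------------------------
-- Graphs cellularly embedded in closed surfaces

-- A t-map (H , S), given by the flags of its barycentric subdivision, one for
-- each triangle (vertex, edge, face).  Across the side of a triangle opposite
-- its vertex-, edge- or face-corner lies its partner under θ₀, θ₁ or θ₂
-- respectively; S is recovered by gluing the triangles along these matchings,
-- and has no boundary because the matchings have no fixed points.  The four
-- triangles around the midpoint of an edge are x, θ₀ x, θ₂ x and θ₀ (θ₂ x).
record TMap : Set where
  field
    #flags      : ℕ
    θ₀ θ₁ θ₂    : Fin #flags → Fin #flags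
    θ₀-matching : IsMatching θ₀
    θ₁-matching : IsMatching θ₁
    θ₂-matching : IsMatching θ₂
    θ₀≢θ₂       : ∀ x → θ₀ x ≢ θ₂ x
    θ₀θ₂-comm   : ∀ x → θ₀ (θ₂ x) ≡ θ₂ (θ₀ x)
    connected   : ∀ x y → SameOrbit (θ₀ ∷ θ₁ ∷ θ₂ ∷ []) x y

  vertices : Classes (Moves (θ₁ ∷ θ₂ ∷ []))
  vertices = orbits (θ₁ ∷ θ₂ ∷ [])

  edges : Classes (Moves (θ₀ ∷ θ₂ ∷ []))
  edges = orbits (θ₀ ∷ θ₂ ∷ [])

  faces : Classes (Moves (θ₀ ∷ θ₁ ∷ []))
  faces = orbits (θ₀ ∷ θ₁ ∷ [])

  -- The flags x and θ₂ x lie on the same edge-end; θ₁ passes from it to one of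
  -- the two neighbouring edge-ends in the cyclic order around the vertex.  So
  -- θ₁ ∘ θ₂ ∘ θ₁ advances by two places, which at a vertex of degree 4 leads to
  -- the opposite edge-end.
  opposite : Fin #flags → Fin #flags
  opposite = θ₁ ∘ θ₂ ∘ θ₁

  -- Only meaningful if all degrees are 4.
  smoothPaths : Classes (Moves (θ₀ ∷ θ₂ ∷ opposite ∷ []))
  smoothPaths = orbits (θ₀ ∷ θ₂ ∷ opposite ∷ [])

open TMap public

underlying : TMap → Graph
underlying T = record
  { #V   = size (vertices T)
  ; #E   = size (edges T)
  ; ends = λ e → let x = rep (edges T) e in class (vertices T) x , class (vertices T) (θ₀ T x)
  }

χ : TMap → ℤ
χ T = + size (vertices T) - + size (edges T) +ℤ + size (faces T)

-- The two sides of the edge of x are on the faces of x and θ₂ x, so the sum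
-- counts the occurrences of the edge in the facial walk of φ.
boundary : (T : TMap) → Fin (size (faces T)) → Subset (size (edges T))
boundary T φ = tabulate λ e → let x = rep (edges T) e in
  ([ class (faces T) x ≡? φ ] + [ class (faces T) (θ₂ T x) ≡? φ ]) ≡ᵇ 1

smoothPathEdges : (T : TMap) → Fin (size (smoothPaths T)) → Subset (size (edges T))
smoothPathEdges T p = tabulate λ e →
  [ class (smoothPaths T) (rep (edges T) e) ≡? p ] ≡ᵇ 1

FaceTwoColourable : TMap → Set
FaceTwoColourable T = Σ (Fin (size (faces T)) → Bool) λ colour →
  ∀ x → colour (class (faces T) x) ≢ colour (class (faces T) (θ₂ T x))

-- If all degrees are 4, the two passages of smooth paths through the vertex of
-- x use the edge-ends of x and of θ₁ x respectively.
smoothPathGraph : TMap → Graph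
smoothPathGraph T = record
  { #V   = size (smoothPaths T)
  ; #E   = size (vertices T)
  ; ends = λ w → let x = rep (vertices T) w in
             class (smoothPaths T) x , class (smoothPaths T) (θ₁ T x)
  }

record IsSpEmbedding (T : TMap) (G : Graph) : Set where
  field
    four-regular    : ∀ w → degree (underlying T) w ≡ 4
    face-colourable : FaceTwoColourable T
    graph           : G ≅ smoothPathGraph T

{-# OPTIONS --safe #-}
module Submission where

-- Subsets of SQ(M) are handled as GF(2)-valued functions on the vertices of C_M:
-- an element of V, F or Z is the coboundary of a function u, g or h that is
-- constant on the v-gons, on the f-gons or on the (z,a)-gons.  A map turns out to
-- be rich if and only if every cycle of the 4-regular graph obtained by
-- contracting the squares (its edges are the a-edges) is a sum u + g + h.  This
-- condition is symmetric in v, f, z, so richness passes to the dual and the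
-- phial; hence a bicycle of G_M, being orthogonal to V + Z = F^⊥ and to
-- V + F = Z^⊥, lies in F ∩ Z, while F ∩ Z always consists of bicycles.
--
-- That 4-regular graph is the medial graph of the map with vertices the f-gons and
-- faces the z-gons.  Its faces are the f-gons and z-gons and its smooth paths are
-- the v-gons, so it is an sp-embedding of G_M whose condition (iii) is the splitting
-- condition, and every sp-embedding arises in this way.  With connectedness,
-- dim V = |V(G_M)| - 1 and similarly for F and Z, so that comparing
-- dim V^⊥ with dim F + dim Z - dim (F ∩ Z) gives the Euler characteristic.

open import Defs
open import Data.Integer using (+_; _-_; _+_)
open import Data.Nat using (_≤_)
open import Data.Product using (_×_; ∃-syntax)
open import Data.Vec using (_++_; tabulate)
open import Function using (_⇔_)
open import Relation.Binary.PropositionalEquality using (_≡_)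
open import Relation.Unary using (_≐_)

import Algebra.Properties.CommutativeMonoid.Sum
import Algebra.Properties.Group
import Algebra.Properties.Semiring.Sum
import Data.Bool as Bool
import Data.Integer.Properties as ℤ
import Data.List.Membership.DecPropositional
import Data.Nat as ℕ
import Data.Nat.Properties as ℕ
import Data.Nat.Solver
import Data.Product as Product
import Data.Vec as Vec
import Data.Vec.Properties as Vec
import Relation.Binary.PropositionalEquality as ≡
open import Algebra.Bundles using (AbelianGroup; CommutativeMonoid; CommutativeRing)
open import Data.Bool using (Bool; true; false; not; _∧_; _xor_; if_then_else_)
open import Data.Bool.Properties using (∧-assoc; ∧-comm; ∧-distribʳ-xor; ∧-distribˡ-xor; ∧-identityʳ; ∧-zeroʳ; not-distribʳ-xor; not-distribˡ-xor; not-involutive; xor-assoc; xor-comm; xor-identityʳ; xor-identityˡ; xor-same; xor-∧-commutativeRing)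
open import Data.Bool.Solver using (module xor-∧-Solver)
open import Data.Fin using (Fin; zero; suc; fromℕ<; _≟_; _<?_)
open import Data.Fin.Properties using (injective⇒≤; toℕ-injective; 2↔Bool; *↔×; +↔⊎)
open import Data.Fin.Subset using (Subset; ⊥; ⊤; _∩_; ∣_∣)
open import Data.Fin.Subset.Properties using (anySubset?)
open import Data.Integer.Solver using (module +-*-Solver)
open import Data.List using (List; []; _∷_; foldr; length)
open import Data.List.Membership.Propositional using (_∈_; _∉_)
open import Data.List.Relation.Unary.All using ([]; _∷_)
open import Data.List.Relation.Unary.All.Properties using (All¬⇒¬Any)
open import Data.List.Relation.Unary.AllPairs using ([]; _∷_)
open import Data.List.Relation.Unary.Any using (here; there)
open import Data.List.Relation.Unary.Unique.Propositional using (Unique)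
open import Data.Nat using (ℕ; zero; suc)
open import Data.Nat.Divisibility using (_∣_; divides; _∣0; ∣-refl; ∣m∣n⇒∣m+n; m%n≡0⇒n∣m; n∣m⇒m%n≡0)
open import Data.Product using (_,_; proj₁; proj₂; swap)
open import Data.Product.Function.NonDependent.Propositional using (_×-↔_)
open import Data.Sum using (_⊎_; inj₁; inj₂)
open import Data.Unit using () renaming (⊤ to Unit)
open import Data.Vec using (Vec; []; _∷_; lookup)
open import Data.Vec.Properties using (lookup∘tabulate; lookup-replicate; lookup-zipWith; tabulate-cong; tabulate∘lookup; zipWith-assoc; zipWith-comm; zipWith-identityˡ; zipWith-identityʳ)
open import Function using (_∘_; _⟨_⟩_; _↔_; Equivalence; Injection; Inverse; case_of_; mk⇔; mk↔ₛ′)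
open import Function.Properties.Inverse using (↔-refl; ↔-sym; ↔-trans; ↔⇒↣)
open import Level using (0ℓ)
open import Relation.Binary using (Rel)
open import Relation.Binary.Construct.Closure.Equivalence as EqC using (EqClosure)
open import Relation.Binary.Construct.Closure.ReflexiveTransitive using (_◅_) renaming (ε to nil)
open import Relation.Binary.Construct.Closure.Symmetric using (fwd; bwd)
open import Relation.Binary.PropositionalEquality using (_≢_; refl; sym; trans; cong; cong₂; subst; module ≡-Reasoning)
open import Relation.Nullary using (Dec; yes; no; ¬_; contradiction)
open import Relation.Nullary.Decidable using (does; does-⇔; isYes)
open import Relation.Unary using (Pred) renaming (_⊆_ to _⊆ₚ_; _∩_ to _∩ₚ_)

open ≡-Reasoning

-- The bridge from sets of squares to functions is integration: A is orthogonal to V exactly when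
-- some a-invariant `k` on the vertices of C_M jumps across a v-edge precisely when the square of
-- that edge lies in A. Such a `k` is unique up to functions constant on the v-gons, and A lies in F
-- + Z precisely when one choice of it has the form g + h; this is where the triple sum u + g + h
-- comes from. The symmetry in v, f, z becomes visible only here: V^⊥ and F + Z treat the three
-- unequally, while the cycle condition merely adds the values of `k` at the four corners of a
-- square. When richness has to be deduced from the Euler characteristic, the bicycle space cannot
-- yet be identified with F ∩ Z. Instead the inequalities dim (F + Z) ≤ dim V^⊥ and dim (F ∩ Z) ≤ γ
-- are added; the characteristic turns the sum into an equality, hence both summands as well. The 3
-- in the formula collects the three defects of 1 between dim V, dim F, dim Z and the numbers of
-- gons. Part (b) integrates in the same way, with functions that are complemented along a matching
-- next to invariant ones.

_∈?_ : ∀ {n} (x : Fin n) ys → Dec (x ∈ ys)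
_∈?_ = Data.List.Membership.DecPropositional._∈?_ _≟_

-- Sums over the fibres of a function, in any commutative monoid

module FibreSum (M : CommutativeMonoid 0ℓ 0ℓ) where

  open CommutativeMonoid M
  open Algebra.Properties.CommutativeMonoid.Sum M
  open import Relation.Binary.Reasoning.Setoid setoid renaming (begin_ to begin≈_; _∎ to _∎≈)

  private
    only : Bool → Carrier → Carrier
    only b x = if b then x else ε

    ∑-only-≟ : ∀ {n} (h : Fin n → Carrier) y → sum (λ x → only (does (x ≟ y)) (h x)) ≈ h y
    ∑-only-≟ {suc n} h zero    = trans≈ (∙-congˡ (sum-replicate-zero n)) (identityʳ _)
      where trans≈ = CommutativeMonoid.trans M
    ∑-only-≟ {suc n} h (suc y) = trans≈ (identityˡ _) (∑-only-≟ (h ∘ suc) y)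
      where trans≈ = CommutativeMonoid.trans M

  listSum : ∀ {n} → (Fin n → Carrier) → List (Fin n) → Carrier
  listSum h []       = ε
  listSum h (y ∷ ys) = h y ∙ listSum h ys

  sum-∈ : ∀ {n} (h : Fin n → Carrier) {ys} → Unique ys →
          sum (λ x → only (does (x ∈? ys)) (h x)) ≈ listSum h ys
  sum-∈ {n} h {[]}     []            = sum-replicate-zero n
  sum-∈ {n} h {y ∷ ys} (y∉ys ∷ uniq) = begin≈
    sum (λ x → only (does (x ∈? (y ∷ ys))) (h x))
      ≈⟨ sum-cong-≋ pointwise ⟩
    sum (λ x → only (does (x ≟ y)) (h x) ∙ only (does (x ∈? ys)) (h x))
      ≈⟨ ∑-distrib-+ {n} (λ x → only (does (x ≟ y)) (h x)) (λ x → only (does (x ∈? ys)) (h x)) ⟩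
    sum (λ x → only (does (x ≟ y)) (h x)) ∙ sum (λ x → only (does (x ∈? ys)) (h x))
      ≈⟨ ∙-cong (∑-only-≟ h y) (sum-∈ h uniq) ⟩
    h y ∙ listSum h ys ∎≈
    where
    pointwise : ∀ x → only (does (x ∈? (y ∷ ys))) (h x) ≈
                only (does (x ≟ y)) (h x) ∙ only (does (x ∈? ys)) (h x)
    pointwise x with x ≟ y | x ∈? ys
    ... | yes x≡y | yes x∈ = contradiction x∈ (subst (_∉ ys) (≡.sym x≡y) (All¬⇒¬Any y∉ys))
    ... | yes _   | no  _  = CommutativeMonoid.sym M (identityʳ _)
    ... | no  _   | yes _  = CommutativeMonoid.sym M (identityˡ _)
    ... | no  _   | no  _  = CommutativeMonoid.sym M (identityˡ _)

  sum-enumerated : ∀ {n} {P : Fin n → Set} (P? : ∀ x → Dec (P x)) (h : Fin n → Carrier) ys → Unique ys →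
                   (∀ {x} → P x → x ∈ ys) → (∀ {x} → x ∈ ys → P x) →
                   sum (λ x → only (does (P? x)) (h x)) ≈ listSum h ys
  sum-enumerated P? h ys uniq to from = CommutativeMonoid.trans M
    (reflexive (sum-cong-≗ λ x → cong (λ b → only b (h x)) (does-⇔ (mk⇔ to from) (P? x) (x ∈? ys))))
    (sum-∈ h uniq)

  -- Double counting: `h x` is spread over all s as a term supported at s = `c x`, and the two sums
  -- are exchanged. Fibres are duplicate-free lists, so that a-edges and squares give explicit sums
  -- of two or four terms. The monoid stays general because the lemma serves both for sums in GF(2)
  -- and for counting in ℕ.
  sum-fibres : ∀ {n m} (c : Fin n → Fin m) (fibre : Fin m → List (Fin n)) → (∀ s → Unique (fibre s)) →
               (∀ {x s} → c x ≡ s → x ∈ fibre s) → (∀ {x s} → x ∈ fibre s → c x ≡ s) →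
               (h : Fin n → Carrier) → sum h ≈ sum (λ s → listSum h (fibre s))
  sum-fibres {n} {m} c fibre uniq to from h = begin≈
    sum h
      ≈⟨ sum-cong-≋ (λ x → CommutativeMonoid.sym M (∑-only-≟ (λ _ → h x) (c x))) ⟩
    sum (λ x → sum λ s → only (does (s ≟ c x)) (h x))
      ≈⟨ ∑-comm {n} {m} (λ x s → only (does (s ≟ c x)) (h x)) ⟩
    sum (λ s → sum λ x → only (does (s ≟ c x)) (h x))
      ≈⟨ sum-cong-≋ (λ s → sum-enumerated (λ x → s ≟ c x) h (fibre s) (uniq s) (to ∘ ≡.sym) (≡.sym ∘ from)) ⟩
    sum (λ s → listSum h (fibre s)) ∎≈

-- Sums over GF(2), parity and the bilinear form with values in `Bool`

module ∑ = Algebra.Properties.Semiring.Sum (CommutativeRing.semiring xor-∧-commutativeRing)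

opaque

  ∑ : ∀ {n} → (Fin n → Bool) → Bool
  ∑ = ∑.sum

  ∑-zero : (h : Fin 0 → Bool) → ∑ h ≡ false
  ∑-zero h = refl

  ∑-suc : ∀ {n} (h : Fin (suc n) → Bool) → ∑ h ≡ h zero xor ∑ (h ∘ suc)
  ∑-suc h = refl

  ∑-cong : ∀ {n} {g h : Fin n → Bool} → (∀ i → g i ≡ h i) → ∑ g ≡ ∑ h
  ∑-cong = ∑.sum-cong-≗

  ∑-false : ∀ {n} {g : Fin n → Bool} → (∀ i → g i ≡ false) → ∑ g ≡ false
  ∑-false {n} p = trans (∑-cong p) (∑.sum-replicate-zero n)

  ∑-xor : ∀ {n} (g h : Fin n → Bool) → ∑ (λ i → g i xor h i) ≡ ∑ g xor ∑ h
  ∑-xor = ∑.∑-distrib-+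

  ∑-comm : ∀ {m n} (h : Fin m → Fin n → Bool) → ∑ (λ i → ∑ (h i)) ≡ ∑ (λ j → ∑ λ i → h i j)
  ∑-comm = ∑.∑-comm

  ∧-∑ : ∀ {n} b (h : Fin n → Bool) → b ∧ ∑ h ≡ ∑ λ i → b ∧ h i
  ∧-∑ = ∑.*-distribˡ-sum

  ∑-permute : ∀ {m n} (h : Fin n → Bool) (π : Fin m ↔ Fin n) → ∑ h ≡ ∑ (h ∘ Inverse.to π)
  ∑-permute = ∑.sum-permute

  ∑-fibres : ∀ {n m} (c : Fin n → Fin m) (fibre : Fin m → List (Fin n)) → (∀ s → Unique (fibre s)) →
             (∀ {x s} → c x ≡ s → x ∈ fibre s) → (∀ {x s} → x ∈ fibre s → c x ≡ s) →
             (h : Fin n → Bool) → ∑ h ≡ ∑ (λ s → foldr (λ x b → h x xor b) false (fibre s))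
  ∑-fibres c fibre uniq to from h = trans (FS.sum-fibres c fibre uniq to from h) (∑-cong λ s → lists (fibre s))
    where
    module FS = FibreSum (CommutativeRing.+-commutativeMonoid xor-∧-commutativeRing)

    lists : ∀ xs → FS.listSum h xs ≡ foldr (λ x b → h x xor b) false xs
    lists []       = refl
    lists (x ∷ xs) = cong (h x xor_) (lists xs)

xor-cancel : ∀ {x y} → x xor y ≡ false → x ≡ y
xor-cancel {false} p = sym p
xor-cancel {true} {true} _ = refl

odd : ℕ → Bool
odd zero    = false
odd (suc n) = not (odd n)

odd-+ : ∀ m n → odd (m ℕ.+ n) ≡ odd m xor odd n
odd-+ zero    n = refl
odd-+ (suc m) n = trans (cong not (odd-+ m n)) (not-distribˡ-xor (odd m) (odd n))

even⇒2∣ : ∀ n → odd n ≡ false → 2 ∣ n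
even⇒2∣ zero          _ = 2 ∣0
even⇒2∣ (suc (suc n)) p = ∣m∣n⇒∣m+n ∣-refl (even⇒2∣ n (trans (sym (not-involutive (odd n))) p))

2∣⇒even : ∀ {n} → 2 ∣ n → odd n ≡ false
2∣⇒even (divides q refl) = double q
  where
  double : ∀ q → odd (q ℕ.* 2) ≡ false
  double zero    = refl
  double (suc q) = trans (not-involutive _) (double q)

odd-sum : ∀ {n} (h : Fin n → ℕ) → odd (Vec.sum (tabulate h)) ≡ ∑ (odd ∘ h)
odd-sum {zero}  h = sym (∑-zero _)
odd-sum {suc n} h = trans (odd-+ (h zero) _)
  (trans (cong (odd (h zero) xor_) (odd-sum (h ∘ suc))) (sym (∑-suc _)))

opaque

  dot : ∀ {m} → Subset m → Subset m → Bool
  dot A B = ∑ λ i → lookup A i ∧ lookup B i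

  dot-def : ∀ {m} (A B : Subset m) → dot A B ≡ ∑ λ i → lookup A i ∧ lookup B i
  dot-def A B = refl

dot-[] : (A B : Subset 0) → dot A B ≡ false
dot-[] A B = trans (dot-def A B) (∑-zero _)

dot-∷ : ∀ {m} a b (A B : Subset m) → dot (a ∷ A) (b ∷ B) ≡ (a ∧ b) xor dot A B
dot-∷ a b A B = trans (dot-def (a ∷ A) (b ∷ B)) (trans (∑-suc _) (cong ((a ∧ b) xor_) (sym (dot-def A B))))

dot-odd : ∀ {m} (A B : Subset m) → odd ∣ A ∩ B ∣ ≡ dot A B
dot-odd []          []          = sym (dot-[] [] [])
dot-odd (true ∷ A)  (true ∷ B)  = trans (cong not (dot-odd A B)) (sym (dot-∷ true true A B))
dot-odd (true ∷ A)  (false ∷ B) = trans (dot-odd A B) (sym (dot-∷ true false A B))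
dot-odd (false ∷ A) (b ∷ B)     = trans (dot-odd A B) (sym (dot-∷ false b A B))

⟨⟩≡0⇒dot : ∀ {m} (A B : Subset m) → ⟨ A , B ⟩ ≡ 0 → dot A B ≡ false
⟨⟩≡0⇒dot A B p = trans (sym (dot-odd A B)) (2∣⇒even (m%n≡0⇒n∣m ∣ A ∩ B ∣ 2 p))

dot⇒⟨⟩≡0 : ∀ {m} (A B : Subset m) → dot A B ≡ false → ⟨ A , B ⟩ ≡ 0
dot⇒⟨⟩≡0 A B p = n∣m⇒m%n≡0 ∣ A ∩ B ∣ 2 (even⇒2∣ _ (trans (dot-odd A B) p))

lookup-ext : ∀ {m} {A B : Subset m} → (∀ i → lookup A i ≡ lookup B i) → A ≡ B
lookup-ext {A = A} {B} p =
  trans (sym (tabulate∘lookup A)) (trans (tabulate-cong p) (tabulate∘lookup B))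

lookup-⊕ : ∀ {m} (A B : Subset m) i → lookup (A ⊕ B) i ≡ lookup A i xor lookup B i
lookup-⊕ A B i = lookup-zipWith _xor_ i A B

lookup-⊥ : ∀ {m} (i : Fin m) → lookup ⊥ i ≡ false
lookup-⊥ i = lookup-replicate i false

dot-comm : ∀ {m} (A B : Subset m) → dot A B ≡ dot B A
dot-comm A B = trans (dot-def A B)
  (trans (∑-cong λ i → ∧-comm (lookup A i) (lookup B i)) (sym (dot-def B A)))

dot-⊕ˡ : ∀ {m} (A B C : Subset m) → dot (A ⊕ B) C ≡ dot A C xor dot B C
dot-⊕ˡ A B C = begin
  dot (A ⊕ B) C
    ≡⟨ dot-def (A ⊕ B) C ⟩
  ∑ (λ i → lookup (A ⊕ B) i ∧ lookup C i)
    ≡⟨ ∑-cong (λ i → trans (cong (_∧ lookup C i) (lookup-⊕ A B i))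
                           (∧-distribʳ-xor (lookup C i) (lookup A i) (lookup B i))) ⟩
  ∑ (λ i → (lookup A i ∧ lookup C i) xor (lookup B i ∧ lookup C i))
    ≡⟨ ∑-xor _ _ ⟩
  ∑ (λ i → lookup A i ∧ lookup C i) xor ∑ (λ i → lookup B i ∧ lookup C i)
    ≡⟨ cong₂ _xor_ (dot-def A C) (dot-def B C) ⟨
  dot A C xor dot B C ∎

dot-⊕ʳ : ∀ {m} (A B C : Subset m) → dot A (B ⊕ C) ≡ dot A B xor dot A C
dot-⊕ʳ A B C = trans (dot-comm A (B ⊕ C))
  (trans (dot-⊕ˡ B C A) (cong₂ _xor_ (dot-comm B A) (dot-comm C A)))

dot-⊥ˡ : ∀ {m} (A : Subset m) → dot ⊥ A ≡ false
dot-⊥ˡ A = trans (dot-def ⊥ A) (∑-false λ i → cong (_∧ lookup A i) (lookup-⊥ i))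

dot-⊥ʳ : ∀ {m} (A : Subset m) → dot A ⊥ ≡ false
dot-⊥ʳ A = trans (dot-comm A ⊥) (dot-⊥ˡ A)

⊕-assoc : ∀ {m} (A B C : Subset m) → (A ⊕ B) ⊕ C ≡ A ⊕ (B ⊕ C)
⊕-assoc = zipWith-assoc xor-assoc

⊕-comm : ∀ {m} (A B : Subset m) → A ⊕ B ≡ B ⊕ A
⊕-comm = zipWith-comm xor-comm

⊕-identityˡ : ∀ {m} (A : Subset m) → ⊥ ⊕ A ≡ A
⊕-identityˡ = zipWith-identityˡ xor-identityˡ

⊕-identityʳ : ∀ {m} (A : Subset m) → A ⊕ ⊥ ≡ A
⊕-identityʳ = zipWith-identityʳ xor-identityʳ

⊕-self : ∀ {m} (A : Subset m) → A ⊕ A ≡ ⊥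
⊕-self A = lookup-ext λ i →
  trans (lookup-⊕ A A i) (trans (xor-same (lookup A i)) (sym (lookup-⊥ i)))

⊕-cancel : ∀ {m} {A B : Subset m} → A ⊕ B ≡ ⊥ → A ≡ B
⊕-cancel {A = A} {B} p = begin
  A           ≡⟨ ⊕-identityʳ A ⟨
  A ⊕ ⊥       ≡⟨ cong (A ⊕_) (⊕-self B) ⟨
  A ⊕ (B ⊕ B) ≡⟨ ⊕-assoc A B B ⟨
  (A ⊕ B) ⊕ B ≡⟨ cong (_⊕ B) p ⟩
  ⊥ ⊕ B       ≡⟨ ⊕-identityˡ B ⟩
  B           ∎

⊕-interchange : ∀ {m} (A B C D : Subset m) → (A ⊕ B) ⊕ (C ⊕ D) ≡ (A ⊕ C) ⊕ (B ⊕ D)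
⊕-interchange A B C D = begin
  (A ⊕ B) ⊕ (C ⊕ D) ≡⟨ ⊕-assoc A B _ ⟩
  A ⊕ (B ⊕ (C ⊕ D)) ≡⟨ cong (A ⊕_) (⊕-assoc B C D) ⟨
  A ⊕ ((B ⊕ C) ⊕ D) ≡⟨ cong (λ X → A ⊕ (X ⊕ D)) (⊕-comm B C) ⟩
  A ⊕ ((C ⊕ B) ⊕ D) ≡⟨ cong (A ⊕_) (⊕-assoc C B D) ⟩
  A ⊕ (C ⊕ (B ⊕ D)) ≡⟨ ⊕-assoc A C _ ⟨
  (A ⊕ C) ⊕ (B ⊕ D) ∎

-- Linear algebra over GF(2)

combination-⊥ : ∀ {k m} (As : Vec (Subset m) k) → combination ⊥ As ≡ ⊥
combination-⊥ []       = refl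
combination-⊥ (A ∷ As) = trans (⊕-identityˡ _) (combination-⊥ As)

combination-⊕ : ∀ {k m} (cs ds : Subset k) (As : Vec (Subset m) k) →
                combination (cs ⊕ ds) As ≡ combination cs As ⊕ combination ds As
combination-⊕ []       []       []       = sym (⊕-self ⊥)
combination-⊕ (c ∷ cs) (d ∷ ds) (A ∷ As) = trans
  (cong₂ _⊕_ (scalar c d) (combination-⊕ cs ds As))
  (⊕-interchange _ _ _ _)
  where
  scalar : ∀ c d → (if c xor d then A else ⊥) ≡ (if c then A else ⊥) ⊕ (if d then A else ⊥)
  scalar false d     = sym (⊕-identityˡ _)
  scalar true  false = sym (⊕-identityʳ _)
  scalar true  true  = sym (⊕-self A)

lookup-combination : ∀ {k m} (cs : Subset k) (As : Vec (Subset m) k) e →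
                     lookup (combination cs As) e ≡ ∑ λ i → lookup cs i ∧ lookup (lookup As i) e
lookup-combination []       []       e = trans (lookup-⊥ e) (sym (∑-zero _))
lookup-combination (c ∷ cs) (A ∷ As) e = trans (lookup-⊕ (if c then A else ⊥) (combination cs As) e)
  (trans (cong₂ _xor_ (scalar c) (lookup-combination cs As e)) (sym (∑-suc _)))
  where
  scalar : ∀ c → lookup (if c then A else ⊥) e ≡ c ∧ lookup A e
  scalar false = lookup-⊥ e
  scalar true  = refl

combination-++ : ∀ {k l m} (cs : Subset k) (ds : Subset l)
                 (As : Vec (Subset m) k) (Bs : Vec (Subset m) l) →
                 combination (cs ++ ds) (As ++ Bs) ≡ combination cs As ⊕ combination ds Bs
combination-++ []       ds []       Bs = sym (⊕-identityˡ _)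
combination-++ (c ∷ cs) ds (A ∷ As) Bs =
  trans (cong (_ ⊕_) (combination-++ cs ds As Bs)) (sym (⊕-assoc _ _ _))

Additive : ∀ {k m} → (Subset k → Subset m) → Set
Additive φ = ∀ A B → φ (A ⊕ B) ≡ φ A ⊕ φ B

module _ {k m : ℕ} {φ : Subset k → Subset m} (φ-⊕ : Additive φ) where

  additive-⊥ : φ ⊥ ≡ ⊥
  additive-⊥ = begin
    φ ⊥                 ≡⟨ ⊕-identityʳ _ ⟨
    φ ⊥ ⊕ ⊥             ≡⟨ cong (φ ⊥ ⊕_) (⊕-self (φ ⊥)) ⟨
    φ ⊥ ⊕ (φ ⊥ ⊕ φ ⊥)   ≡⟨ ⊕-assoc _ _ _ ⟨
    (φ ⊥ ⊕ φ ⊥) ⊕ φ ⊥   ≡⟨ cong (_⊕ φ ⊥) (φ-⊕ ⊥ ⊥) ⟨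
    φ (⊥ ⊕ ⊥) ⊕ φ ⊥     ≡⟨ cong (λ A → φ A ⊕ φ ⊥) (⊕-self ⊥) ⟩
    φ ⊥ ⊕ φ ⊥           ≡⟨ ⊕-self (φ ⊥) ⟩
    ⊥                   ∎

  additive-combination : ∀ {l} (cs : Subset l) As →
                         φ (combination cs As) ≡ combination cs (Vec.map φ As)
  additive-combination []       []       = additive-⊥
  additive-combination (c ∷ cs) (A ∷ As) =
    trans (φ-⊕ _ _) (cong₂ _⊕_ (scalar c) (additive-combination cs As))
    where
    scalar : ∀ c → φ (if c then A else ⊥) ≡ (if c then φ A else ⊥)
    scalar false = additive-⊥
    scalar true  = refl

span-⊥ : ∀ {k m} (As : Vec (Subset m) k) → Span As ⊥
span-⊥ As = ⊥ , combination-⊥ As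

span-⊕ : ∀ {k m} (As : Vec (Subset m) k) {A B} → Span As A → Span As B → Span As (A ⊕ B)
span-⊕ As (cs , refl) (ds , refl) = cs ⊕ ds , combination-⊕ cs ds As

span-∷ : ∀ {k m} {A B : Subset m} {As : Vec (Subset m) k} → Span As B → Span (A ∷ As) B
span-∷ (cs , refl) = false ∷ cs , ⊕-identityˡ _

span-head : ∀ {k m} (A : Subset m) (As : Vec (Subset m) k) → Span (A ∷ As) A
span-head A As = true ∷ ⊥ , trans (cong (A ⊕_) (combination-⊥ As)) (⊕-identityʳ A)

span? : ∀ {k m} (As : Vec (Subset m) k) A → Dec (Span As A)
span? As A = anySubset? λ cs → Vec.≡-dec Bool._≟_ (combination cs As) A

span-⊥ᗮ : ∀ {k m} (Bs : Vec (Subset m) k) {C} → (∀ i → dot (lookup Bs i) C ≡ false) →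
          ∀ {A} → Span Bs A → dot A C ≡ false
span-⊥ᗮ []       {C} p ([] , refl)     = dot-⊥ˡ C
span-⊥ᗮ (B ∷ Bs) {C} p (c ∷ cs , refl) = trans (dot-⊕ˡ _ _ C)
  (cong₂ _xor_ (scalar c) (span-⊥ᗮ Bs (p ∘ suc) (cs , refl)))
  where
  scalar : ∀ c → dot (if c then B else ⊥) C ≡ false
  scalar false = dot-⊥ˡ C
  scalar true  = p zero

-- Gaussian elimination in dual form. If `B` is outside the span of `Bs`, some `C` vanishes on `Bs`
-- but not on `B`; then `A` is replaced by A + ⟨A,C⟩B. A functional `D` that separates the new
-- vector from `Bs` becomes one for `B ∷ Bs` after adding ⟨B,D⟩C, which makes it vanish on `B` too.
-- Double orthogonal complements and the solvability of linear systems both rest on this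
-- alternative.
separation : ∀ {k m} (Bs : Vec (Subset m) k) A →
             Span Bs A ⊎ ∃[ C ] (∀ i → dot (lookup Bs i) C ≡ false) × dot A C ≡ true
separation {m = m} [] A = base A
  where
  base : ∀ {m} (A : Subset m) →
         Span [] A ⊎ ∃[ C ] ((i : Fin 0) → dot (lookup [] i) C ≡ false) × dot A C ≡ true
  base []          = inj₁ ([] , refl)
  base (true ∷ A)  = inj₂ (true ∷ ⊥ , (λ ()) ,
    trans (dot-∷ true true A ⊥) (cong not (dot-⊥ʳ A)))
  base (false ∷ A) with base A
  ... | inj₁ ([] , p)    = inj₁ ([] , cong (false ∷_) p)
  ... | inj₂ (C , _ , p) = inj₂ (false ∷ C , (λ ()) , trans (dot-∷ false false A C) p)
separation (B ∷ Bs) A with separation Bs B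
... | inj₁ B∈ with separation Bs A
...   | inj₁ A∈            = inj₁ (span-∷ A∈)
...   | inj₂ (C , C⊥ , AC) =
  inj₂ (C , (λ { zero → span-⊥ᗮ Bs C⊥ B∈ ; (suc i) → C⊥ i }) , AC)
separation (B ∷ Bs) A | inj₂ (C , C⊥ , BC) with separation Bs (A ⊕ (if dot A C then B else ⊥))
... | inj₁ A′∈ = inj₁ (subst (Span (B ∷ Bs)) undo (span-⊕ (B ∷ Bs) (span-∷ A′∈) (multiple (dot A C))))
  where
  multiple : ∀ c → Span (B ∷ Bs) (if c then B else ⊥)
  multiple false = span-⊥ (B ∷ Bs)
  multiple true  = span-head B Bs

  undo : ∀ {X} → (A ⊕ X) ⊕ X ≡ A
  undo {X} = trans (⊕-assoc A X X) (trans (cong (A ⊕_) (⊕-self X)) (⊕-identityʳ A))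
... | inj₂ (D , D⊥ , A′D) = inj₂ (D ⊕ X , perp , trans (trans (dot-⊕ʳ A D X) swap-scalar) (trans (sym (dot-⊕ˡ A _ D)) A′D))
  where
  X : Subset _
  X = if dot B D then C else ⊥

  scale : ∀ c (E F : Subset _) → dot E (if c then F else ⊥) ≡ c ∧ dot E F
  scale false E F = dot-⊥ʳ E
  scale true  E F = refl

  swap-scalar : dot A D xor dot A X ≡ dot A D xor dot (if dot A C then B else ⊥) D
  swap-scalar = cong (dot A D xor_) (begin
    dot A X                            ≡⟨ scale (dot B D) A C ⟩
    dot B D ∧ dot A C                  ≡⟨ ∧-comm (dot B D) (dot A C) ⟩
    dot A C ∧ dot B D                  ≡⟨ cong (dot A C ∧_) (dot-comm B D) ⟩
    dot A C ∧ dot D B                  ≡⟨ scale (dot A C) D B ⟨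
    dot D (if dot A C then B else ⊥)   ≡⟨ dot-comm D _ ⟩
    dot (if dot A C then B else ⊥) D   ∎)

  perp : ∀ i → dot (lookup (B ∷ Bs) i) (D ⊕ X) ≡ false
  perp zero = begin
    dot B (D ⊕ X)                  ≡⟨ dot-⊕ʳ B D X ⟩
    dot B D xor dot B X            ≡⟨ cong (dot B D xor_) (scale (dot B D) B C) ⟩
    dot B D xor (dot B D ∧ dot B C) ≡⟨ cong (λ b → dot B D xor (dot B D ∧ b)) BC ⟩
    dot B D xor (dot B D ∧ true)   ≡⟨ cong (dot B D xor_) (∧-identityʳ (dot B D)) ⟩
    dot B D xor dot B D            ≡⟨ xor-same (dot B D) ⟩
    false                          ∎
  perp (suc i) = trans (dot-⊕ʳ (lookup Bs i) D X) (cong₂ _xor_ (D⊥ i)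
    (trans (scale (dot B D) _ C) (trans (cong (dot B D ∧_) (C⊥ i)) (∧-zeroʳ (dot B D)))))

independent-∷ : ∀ {k m} {A : Subset m} {As : Vec (Subset m) k} →
                LinearlyIndependent As → ¬ Span As A → LinearlyIndependent (A ∷ As)
independent-∷ ind A∉ (true ∷ cs)  p = contradiction (cs , sym (⊕-cancel p)) A∉
independent-∷ ind A∉ (false ∷ cs) p = cong (false ∷_) (ind cs (trans (sym (⊕-identityˡ _)) p))

Image : ∀ {k m} → (Subset k → Subset m) → Pred (Subset k) 0ℓ → Pred (Subset m) 0ℓ
Image φ D A = ∃[ B ] D B × φ B ≡ A

Kernel : ∀ {k m} → (Subset k → Subset m) → Pred (Subset k) 0ℓ
Kernel φ A = φ A ≡ ⊥

hasDim-≐ : ∀ {m} {U W : Pred (Subset m) 0ℓ} {d} → U ⊆ₚ W → W ⊆ₚ U → HasDim U d → HasDim W d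
hasDim-≐ U⊆W W⊆U (As , ind , ⊆ , ⊇) = As , ind , (λ p → ⊆ (W⊆U p)) , (λ p → U⊆W (⊇ p))

hasDim-image : ∀ {k m} {φ : Subset k → Subset m} {D d} → Additive φ →
               (∀ {A} → D A → φ A ≡ ⊥ → A ≡ ⊥) → HasDim D d → HasDim (Image φ D) d
hasDim-image {φ = φ} φ-⊕ inj (As , ind , ⊆ , ⊇) =
  Vec.map φ As ,
  (λ cs p → ind cs (inj (⊇ (cs , refl)) (trans (additive-combination φ-⊕ cs As) p))) ,
  (λ { (B , B∈ , refl) → let cs , p = ⊆ B∈ in
       cs , trans (sym (additive-combination φ-⊕ cs As)) (cong φ p) }) ,
  (λ { (cs , refl) → combination cs As , ⊇ (cs , refl) , additive-combination φ-⊕ cs As })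

All : ∀ {k} → Pred (Subset k) 0ℓ
All _ = Unit

opaque

  -- Induction on the dimension of the source: `φ` is first restricted to the vectors with leading
  -- coordinate `false`. The image of the remaining basis vector either lies in the restricted
  -- image, and the kernel gains a dimension, or it lies outside, and the image does.
  rank-nullity : ∀ {k m} (φ : Subset k → Subset m) → Additive φ →
                 ∃[ r ] ∃[ d ] HasDim (Image φ All) r × HasDim (Kernel φ) d × r ℕ.+ d ≡ k
  rank-nullity {zero} φ φ-⊕ =
    0 , 0 ,
    ([] , (λ { [] _ → refl }) , (λ { ([] , _ , refl) → [] , sym (additive-⊥ φ-⊕) }) ,
      (λ { ([] , refl) → [] , _ , additive-⊥ φ-⊕ })) ,
    ([] , (λ { [] _ → refl }) , (λ { {[]} _ → [] , refl }) , (λ { ([] , refl) → additive-⊥ φ-⊕ })) ,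
    refl
  rank-nullity {suc k} {m} φ φ-⊕
    with r , d , dimI@(Bs , indI , ⊆I , ⊇I) , dimK@(Ks , indK , ⊆K , ⊇K) , r+d≡k ←
           rank-nullity (φ ∘ (false ∷_)) (λ A B → φ-⊕ (false ∷ A) (false ∷ B))
    with span? Bs (φ (true ∷ ⊥))
  ... | yes w∈ =
    -- Since `false ∷ y` and `true ∷ ⊥` have the same image, `true ∷ y` is the new kernel vector.
    let y , _ , φy≡w = ⊇I w∈
        φ-true : ∀ x → φ (true ∷ x) ≡ φ (false ∷ (y ⊕ x))
        φ-true x = begin
          φ (true ∷ x)                 ≡⟨ cong (λ X → φ (true ∷ X)) (⊕-identityˡ x) ⟨
          φ (true ∷ (⊥ ⊕ x))           ≡⟨ φ-⊕ (true ∷ ⊥) (false ∷ x) ⟩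
          φ (true ∷ ⊥) ⊕ φ (false ∷ x) ≡⟨ cong (_⊕ φ (false ∷ x)) φy≡w ⟨
          φ (false ∷ y) ⊕ φ (false ∷ x) ≡⟨ φ-⊕ (false ∷ y) (false ∷ x) ⟨
          φ (false ∷ (y ⊕ x))          ∎
        lift-comb : ∀ {l} (cs : Subset l) As → combination cs (Vec.map (false ∷_) As) ≡ false ∷ combination cs As
        lift-comb cs As = sym (additive-combination (λ _ _ → refl) cs As)
    in
    r , suc d ,
    hasDim-≐ (λ { (x , _ , p) → false ∷ x , _ , p })
             (λ { (true ∷ x , _ , p) → y ⊕ x , _ , trans (sym (φ-true x)) p
                ; (false ∷ x , _ , p) → x , _ , p }) dimI ,
    ((true ∷ y) ∷ Vec.map (false ∷_) Ks ,
     independent-∷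
       (λ cs p → indK cs (cong Vec.tail (trans (sym (lift-comb cs Ks)) p)))
       (λ { (cs , p) → case cong Vec.head (trans (sym (lift-comb cs Ks)) p) of λ () }) ,
     (λ { {true ∷ x} p →
            let cs , q = ⊆K {y ⊕ x} (trans (sym (φ-true x)) p) in
            true ∷ cs , trans (cong ((true ∷ y) ⊕_) (trans (lift-comb cs Ks) (cong (false ∷_) q)))
              (cong (true ∷_) (trans (sym (⊕-assoc y y x)) (trans (cong (_⊕ x) (⊕-self y)) (⊕-identityˡ x))))
        ; {false ∷ x} p →
            let cs , q = ⊆K {x} p in
            false ∷ cs , trans (⊕-identityˡ _) (trans (lift-comb cs Ks) (cong (false ∷_) q)) }) ,
     (λ { (true ∷ cs , refl) → trans (cong (λ X → φ ((true ∷ y) ⊕ X)) (lift-comb cs Ks))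
            (trans (φ-true _) (trans (cong (λ X → φ (false ∷ X)) (trans (sym (⊕-assoc y y _))
              (trans (cong (_⊕ combination cs Ks) (⊕-self y)) (⊕-identityˡ _)))) (⊇K (cs , refl))))
        ; (false ∷ cs , refl) → trans (cong φ (trans (⊕-identityˡ _) (lift-comb cs Ks))) (⊇K (cs , refl)) })) ,
    trans (ℕ.+-suc r d) (cong suc r+d≡k)
  ... | no w∉ =
    let w = φ (true ∷ ⊥)
        φ-true : ∀ x → φ (true ∷ x) ≡ w ⊕ φ (false ∷ x)
        φ-true x = trans (cong (λ X → φ (true ∷ X)) (sym (⊕-identityˡ x))) (φ-⊕ (true ∷ ⊥) (false ∷ x))
    in
    suc r , d ,
    (w ∷ Bs , independent-∷ indI w∉ ,
     (λ { (true ∷ x , _ , refl) → let cs , p = ⊆I (x , _ , refl) in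
            true ∷ cs , trans (cong (w ⊕_) p) (sym (φ-true x))
        ; (false ∷ x , _ , refl) → span-∷ (⊆I (x , _ , refl)) }) ,
     (λ { (true ∷ cs , refl) → let x , _ , p = ⊇I (cs , refl) in
            true ∷ x , _ , trans (φ-true x) (cong (w ⊕_) p)
        ; (false ∷ cs , refl) → let x , _ , p = ⊇I (cs , refl) in
            false ∷ x , _ , trans p (sym (⊕-identityˡ _)) })) ,
    hasDim-≐ (λ { (x , p , refl) → p })
             (λ { {true ∷ x} p → contradiction (⊆I (x , _ , sym (⊕-cancel (trans (sym (φ-true x)) p)))) w∉
                ; {false ∷ x} p → x , p , refl })
             (hasDim-image (λ _ _ → refl) (λ _ p → cong Vec.tail p) dimK) ,
    cong suc r+d≡k

subset↔ : ∀ n → Subset n ↔ Fin (2 ℕ.^ n)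
subset↔ zero    = mk↔ₛ′ (λ _ → zero) (λ _ → []) (λ { zero → refl }) (λ { [] → refl })
subset↔ (suc n) = ↔-trans uncons (↔-trans (↔-sym 2↔Bool ×-↔ subset↔ n) (↔-sym *↔×))
  where
  uncons : Subset (suc n) ↔ (Bool × Subset n)
  uncons = mk↔ₛ′ (λ { (b ∷ A) → b , A }) (λ { (b , A) → b ∷ A }) (λ _ → refl) (λ { (_ ∷ _) → refl })

-- Compares the cardinalities 2^k and 2^l. Applied to coordinate vectors in `dim-≤`, this replaces
-- the Steinitz exchange lemma.
injection⇒≤ : ∀ {k l} (h : Subset k → Subset l) → (∀ {A B} → h A ≡ h B → A ≡ B) → k ≤ l
injection⇒≤ {k} {l} h inj = ℕ.≮⇒≥ λ l<k →
  ℕ.<⇒≱ (ℕ.^-monoʳ-< 2 (ℕ.s≤s (ℕ.s≤s ℕ.z≤n)) l<k) (injective⇒≤ {f = code} code-injective)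
  where
  module K = Inverse (subset↔ k)
  module L = Inverse (subset↔ l)

  code : Fin (2 ℕ.^ k) → Fin (2 ℕ.^ l)
  code = L.to ∘ h ∘ K.from

  code-injective : ∀ {i j} → code i ≡ code j → i ≡ j
  code-injective {i} {j} p = begin
    i               ≡⟨ K.strictlyInverseˡ i ⟨
    K.to (K.from i) ≡⟨ cong K.to (inj (trans (sym (L.strictlyInverseʳ _))
                         (trans (cong L.from p) (L.strictlyInverseʳ _)))) ⟩
    K.to (K.from j) ≡⟨ K.strictlyInverseˡ j ⟩
    j               ∎

dim-≤ : ∀ {m} {U W : Pred (Subset m) 0ℓ} {k l} → U ⊆ₚ W → HasDim U k → HasDim W l → k ≤ l
dim-≤ U⊆W (As , ind , _ , ⊇) (Bs , _ , ⊆ , _) = injection⇒≤ (proj₁ ∘ coord) λ {cs} {ds} p →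
  ⊕-cancel (ind (cs ⊕ ds) (trans (combination-⊕ cs ds As)
    (trans (cong (_⊕ combination ds As) (trans (sym (proj₂ (coord cs)))
      (trans (cong (λ es → combination es Bs) p) (proj₂ (coord ds))))) (⊕-self _))))
  where
  coord : ∀ cs → Span Bs (combination cs As)
  coord cs = ⊆ (U⊆W (⊇ (cs , refl)))

dim-unique : ∀ {m} {W : Pred (Subset m) 0ℓ} {k l} → HasDim W k → HasDim W l → k ≡ l
dim-unique p q = ℕ.≤-antisym (dim-≤ (λ x → x) p q) (dim-≤ (λ x → x) q p)

-- A vector of W outside U would extend the basis of U to k + 1 independent vectors in a space of
-- dimension k. Membership in a span is decidable, so the argument is constructive.
dim-≡⇒⊇ : ∀ {m} {U W : Pred (Subset m) 0ℓ} {k} → U ⊆ₚ W → HasDim U k → HasDim W k → W ⊆ₚ U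
dim-≡⇒⊇ U⊆W (As , ind , ⊆ , ⊇) (Bs , ind′ , ⊆′ , ⊇′) {A} A∈W with span? As A
... | yes A∈ = ⊇ A∈
... | no  A∉ = contradiction
  (dim-≤ {U = Span (A ∷ As)} {W = Span Bs} A∷As⊆ (A ∷ As , independent-∷ ind A∉ , (λ p → p) , (λ p → p))
         (Bs , ind′ , (λ p → p) , (λ p → p)))
  (ℕ.<⇒≱ ℕ.≤-refl)
  where
  A∷As⊆ : Span (A ∷ As) ⊆ₚ Span Bs
  A∷As⊆ (true ∷ cs , refl)  = span-⊕ Bs (⊆′ A∈W) (⊆′ (U⊆W (⊇ (cs , refl))))
  A∷As⊆ (false ∷ cs , refl) = subst (Span Bs) (sym (⊕-identityˡ _)) (⊆′ (U⊆W (⊇ (cs , refl))))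

hasDim-All : ∀ k → HasDim (All {k}) k
hasDim-All k with rank-nullity {k} (λ A → A) (λ _ _ → refl)
... | r , d , dimI , dimK , r+d≡k = subst (HasDim All) r≡k (hasDim-≐ _ (λ _ → _ , _ , refl) dimI)
  where
  d≤0 : d ≤ 0
  d≤0 = dim-≤ {W = Span []} (λ { refl → [] , refl }) dimK ([] , (λ { [] _ → refl }) , (λ p → p) , (λ p → p))

  r≡k : r ≡ k
  r≡k = trans (sym (ℕ.+-identityʳ r)) (trans (cong (r ℕ.+_) (sym (ℕ.n≤0⇒n≡0 d≤0))) r+d≡k)

ᗮᗮ-⊆ : ∀ {m} {W : Pred (Subset m) 0ℓ} {d} → HasDim W d → ((W ᗮ) ᗮ) ⊆ₚ W
ᗮᗮ-⊆ (As , ind , ⊆ , ⊇) {A} A∈ with separation As A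
... | inj₁ A∈As = ⊇ A∈As
... | inj₂ (C , C⊥ , AC) = contradiction
  (trans (sym AC) (⟨⟩≡0⇒dot A C (A∈ C λ B B∈ → dot⇒⟨⟩≡0 C B
    (trans (dot-comm C B) (span-⊥ᗮ As C⊥ (⊆ B∈)))))) λ ()

dots : ∀ {d m} → Vec (Subset m) d → Subset m → Subset d
dots As A = tabulate λ i → dot (lookup As i) A

dots-⊕ : ∀ {d m} (As : Vec (Subset m) d) → Additive (dots As)
dots-⊕ As A B = lookup-ext λ i → trans (lookup∘tabulate _ i) (trans (dot-⊕ʳ (lookup As i) A B)
  (sym (trans (lookup-⊕ (dots As A) (dots As B) i) (cong₂ _xor_ (lookup∘tabulate _ i) (lookup∘tabulate _ i)))))

nondegenerate : ∀ {m} (A : Subset m) → (∀ B → dot A B ≡ false) → A ≡ ⊥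
nondegenerate []      p = refl
nondegenerate (b ∷ A) p = cong₂ _∷_
  (trans (sym (trans (dot-∷ b true A ⊥) (trans (cong₂ _xor_ (∧-identityʳ b) (dot-⊥ʳ A)) (xor-identityʳ b))))
         (p (true ∷ ⊥)))
  (nondegenerate A λ B → trans (sym (trans (dot-∷ b false A B) (cong (_xor dot A B) (∧-zeroʳ b)))) (p (false ∷ B)))

opaque

  -- The complement is the kernel of `dots As`, so the claim is that this map is onto. It is adjoint
  -- to the map from coefficients to combinations of `As`; a vector orthogonal to its image is
  -- therefore the coefficient vector of a vanishing combination, and independence of `As` makes it
  -- zero.
  hasDim-ᗮ : ∀ {m} {W : Pred (Subset m) 0ℓ} {d} → HasDim W d → ∃[ e ] HasDim (W ᗮ) e × d ℕ.+ e ≡ m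
  hasDim-ᗮ {m} {W} {d} (As , ind , ⊆ , ⊇) with rank-nullity (dots As) (dots-⊕ As)
  ... | r , e , dimI@(Bs , _ , ⊆I , ⊇I) , dimK , r+e≡m =
    e , hasDim-≐ kernel⊆ᗮ ᗮ⊆kernel dimK , trans (cong (ℕ._+ e) d≡r) r+e≡m
    where
    ψ : Subset m → Subset d
    ψ = dots As

    kernel⊆ᗮ : Kernel ψ ⊆ₚ (W ᗮ)
    kernel⊆ᗮ {A} p B B∈ = dot⇒⟨⟩≡0 A B (trans (dot-comm A B) (span-⊥ᗮ As
      (λ i → trans (sym (lookup∘tabulate _ i)) (trans (cong (λ X → lookup X i) p) (lookup-⊥ i))) (⊆ B∈)))

    ᗮ⊆kernel : (W ᗮ) ⊆ₚ Kernel ψ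
    ᗮ⊆kernel {A} p = lookup-ext λ i → trans (lookup∘tabulate _ i)
      (trans (dot-comm (lookup As i) A) (trans (⟨⟩≡0⇒dot A (lookup As i) (p _ (⊇ (unit As i)))) (sym (lookup-⊥ i))))
      where
      unit : ∀ {k} (As : Vec (Subset m) k) i → Span As (lookup As i)
      unit (A ∷ As) zero    = span-head A As
      unit (A ∷ As) (suc i) = span-∷ (unit As i)

    ψ-adjoint : ∀ A cs → dot (ψ A) cs ≡ dot (combination cs As) A
    ψ-adjoint A cs = begin
      dot (ψ A) cs
        ≡⟨ dot-def (ψ A) cs ⟩
      ∑ (λ i → lookup (ψ A) i ∧ lookup cs i)
        ≡⟨ ∑-cong (λ i → trans (cong (_∧ lookup cs i) (lookup∘tabulate _ i)) (∧-comm _ (lookup cs i))) ⟩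
      ∑ (λ i → lookup cs i ∧ dot (lookup As i) A)
        ≡⟨ ∑-cong (λ i → trans (cong (lookup cs i ∧_) (dot-def (lookup As i) A)) (∧-∑ (lookup cs i) _)) ⟩
      ∑ (λ i → ∑ λ j → lookup cs i ∧ (lookup (lookup As i) j ∧ lookup A j))
        ≡⟨ ∑-comm _ ⟩
      ∑ (λ j → ∑ λ i → lookup cs i ∧ (lookup (lookup As i) j ∧ lookup A j))
        ≡⟨ ∑-cong (λ j → trans (∑-cong λ i → trans (sym (∧-assoc (lookup cs i) _ _)) (∧-comm _ (lookup A j)))
             (trans (sym (∧-∑ (lookup A j) _)) (∧-comm (lookup A j) _))) ⟩
      ∑ (λ j → ∑ (λ i → lookup cs i ∧ lookup (lookup As i) j) ∧ lookup A j)
        ≡⟨ ∑-cong (λ j → cong (_∧ lookup A j) (sym (lookup-combination cs As j))) ⟩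
      ∑ (λ j → lookup (combination cs As) j ∧ lookup A j)
        ≡⟨ dot-def (combination cs As) A ⟨
      dot (combination cs As) A ∎

    surjective : ∀ cs → Image ψ All cs
    surjective cs with separation Bs cs
    ... | inj₁ cs∈ = ⊇I cs∈
    ... | inj₂ (ds , ds⊥ , p) = contradiction (trans (sym p) (trans (cong (dot cs) ds≡⊥) (dot-⊥ʳ cs))) λ ()
      where
      ds≡⊥ : ds ≡ ⊥
      ds≡⊥ = ind ds (nondegenerate _ λ A → trans (sym (ψ-adjoint A ds)) (span-⊥ᗮ Bs ds⊥ (⊆I (A , _ , refl))))

    d≡r : d ≡ r
    d≡r = dim-unique (hasDim-All d) (hasDim-≐ _ (λ _ → surjective _) dimI)

opaque

  -- Rank and nullity of the map sending coefficients for `As ++ Bs` to their combination. Its image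
  -- is the sum; a kernel element is a pair of coefficient vectors for one and the same vector of
  -- the intersection, which `π` reads off from the first block.
  hasDim-+ₛ-∩ : ∀ {m} {U W : Pred (Subset m) 0ℓ} {k l} → HasDim U k → HasDim W l →
                ∃[ s ] ∃[ t ] HasDim (U +ₛ W) s × HasDim (U ∩ₚ W) t × s ℕ.+ t ≡ k ℕ.+ l
  hasDim-+ₛ-∩ {m} {U} {W} {k} {l} (As , indA , ⊆A , ⊇A) (Bs , indB , ⊆B , ⊇B)
    with s , t , dimI , dimK , s+t ← rank-nullity {k = k ℕ.+ l} (λ cs → combination cs (As ++ Bs)) (λ cs ds → combination-⊕ cs ds (As ++ Bs))
    = s , t ,
      hasDim-≐ (λ { (cs , _ , refl) → _ , _ , ⊇A (Vec.take k cs , refl) , ⊇B (Vec.drop k cs , refl) , sym (split cs) })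
               (λ { (A , B , A∈ , B∈ , refl) → let c , p = ⊆A A∈ ; d , q = ⊆B B∈ in
                    c ++ d , _ , trans (combination-++ c d As Bs) (cong₂ _⊕_ p q) }) dimI ,
      hasDim-≐ (λ { (cs , cs∈ , refl) → ⊇A (Vec.take k cs , refl) ,
                    subst W (sym (⊕-cancel (trans (sym (split cs)) cs∈))) (⊇B (Vec.drop k cs , refl)) })
               (λ { {A} (A∈U , A∈W) → let c , p = ⊆A A∈U ; d , q = ⊆B A∈W in
                    c ++ d , trans (combination-++ c d As Bs) (trans (cong₂ _⊕_ p q) (⊕-self A)) ,
                    trans (cong (λ x → combination x As) (Vec.++-injectiveˡ (Vec.take k (c ++ d)) c (Vec.take++drop≡id k (c ++ d)))) p })
               (hasDim-image π-⊕ (λ {cs} → π-injective cs) dimK) ,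
      s+t
    where
    split : ∀ cs → combination cs (As ++ Bs) ≡ combination (Vec.take k cs) As ⊕ combination (Vec.drop k cs) Bs
    split cs = trans (cong (λ x → combination x (As ++ Bs)) (sym (Vec.take++drop≡id k cs)))
                     (combination-++ (Vec.take k cs) (Vec.drop k cs) As Bs)

    π : Subset (k ℕ.+ l) → Subset m
    π cs = combination (Vec.take k cs) As

    π-⊕ : Additive π
    π-⊕ cs ds = trans (cong (λ x → combination x As) (Vec.take-zipWith _xor_ cs ds))
                      (combination-⊕ (Vec.take k cs) (Vec.take k ds) As)

    π-injective : ∀ cs → combination cs (As ++ Bs) ≡ ⊥ → π cs ≡ ⊥ → cs ≡ ⊥
    π-injective cs p q = trans (sym (Vec.take++drop≡id k cs))
      (trans (cong₂ _++_ (indA (Vec.take k cs) q) (indB (Vec.drop k cs) (trans (sym (⊕-cancel (trans (sym (split cs)) p))) q)))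
             (sym (replicate-++ k)))
      where
      replicate-++ : ∀ k → ⊥ {k ℕ.+ l} ≡ ⊥ {k} ++ ⊥ {l}
      replicate-++ zero    = refl
      replicate-++ (suc k) = cong (false ∷_) (replicate-++ k)

-- Orbits of matchings

Inv : ∀ {n} {A : Set} → (Fin n → Fin n) → (Fin n → A) → Set
Inv g h = ∀ x → h (g x) ≡ h x

orbit-invariant : ∀ {n} {A : Set} {gs : List (Fin n → Fin n)} (h : Fin n → A) →
                  (∀ {g} → g ∈ gs → Inv g h) → ∀ {x y} → SameOrbit gs x y → h x ≡ h y
orbit-invariant h inv = EqC.gfold ≡.isEquivalence h λ { (_ , g∈ , refl) → sym (inv g∈ _) }

orbit-invariant₂ : ∀ {n} {A : Set} {p q : Fin n → Fin n} (h : Fin n → A) → Inv p h → Inv q h →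
                   ∀ {x y} → SameOrbit (p ∷ q ∷ []) x y → h x ≡ h y
orbit-invariant₂ h p-inv q-inv =
  orbit-invariant h λ { (here refl) → p-inv ; (there (here refl)) → q-inv }

-- For involutions a backward move is also a forward one, so closure under forward moves suffices.
orbit-closed : ∀ {n} {gs : List (Fin n → Fin n)} (P : Fin n → Set) →
               (∀ {g} → g ∈ gs → ∀ x → g (g x) ≡ x) → (∀ {g} → g ∈ gs → ∀ {x} → P x → P (g x)) →
               ∀ {x y} → SameOrbit gs x y → P x → P y
orbit-closed P inv closed nil = λ Px → Px
orbit-closed P inv closed (fwd (_ , g∈ , refl) ◅ xs) = orbit-closed P inv closed xs ∘ closed g∈
orbit-closed P inv closed (bwd (_ , g∈ , refl) ◅ xs) =
  orbit-closed P inv closed xs ∘ subst P (inv g∈ _) ∘ closed g∈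

class-step : ∀ {n} {gs : List (Fin n → Fin n)} (P : Classes (Moves gs)) {g} → g ∈ gs → Inv g (class P)
class-step P g∈ x = sym (sound P (EqC.return (_ , g∈ , refl)))

rep∼ : ∀ {n} {R : Rel (Fin n) 0ℓ} (P : Classes R) x → EqClosure R (rep P (class P x)) x
rep∼ P x = complete P (class-rep P (class P x))

matching↔ : ∀ {n} {p : Fin n → Fin n} → IsMatching p → Fin n ↔ Fin n
matching↔ {p = p} mp = mk↔ₛ′ p p (involutive mp) (involutive mp)

matching-injective : ∀ {n} {p : Fin n → Fin n} → IsMatching p → ∀ {x y} → p x ≡ p y → x ≡ y
matching-injective {p = p} mp {x} {y} e =
  trans (sym (involutive mp x)) (trans (cong p e) (involutive mp y))

-- The equal values at x and `p x` cancel in characteristic 2. Used with p = a, this is the source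
-- of all orthogonality relations between V, F and Z.
∑-matching : ∀ {n} {p : Fin n → Fin n} → IsMatching p → (h : Fin n → Bool) → Inv p h → ∑ h ≡ false
∑-matching {n} {p} mp h inv = trans
  (∑-fibres (class P) fibre
    (λ s → ((λ e → no-fixed mp _ (sym e)) ∷ []) ∷ [] ∷ [])
    (λ { {x} refl → orbit-closed (_∈ fibre (class P x)) (λ { (here refl) → involutive mp })
           (λ { (here refl) (here refl) → there (here refl)
              ; (here refl) (there (here refl)) → here (involutive mp _) }) (rep∼ P x) (here refl) })
    (λ { (here refl) → class-rep P _
       ; (there (here refl)) → trans (class-step P (here refl) _) (class-rep P _) })
    h)
  (∑-false λ s → trans (cong (h (rep P s) xor_) (trans (xor-identityʳ _) (inv _))) (xor-same (h (rep P s))))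
  where
  P : Classes (Moves (p ∷ []))
  P = orbits (p ∷ [])

  fibre : Fin (size P) → List (Fin n)
  fibre s = rep P s ∷ p (rep P s) ∷ []

-- Two commuting matchings without a common edge generate a Klein four-group that acts freely, so
-- every orbit has exactly the four listed elements.
module FourOrbit {n : ℕ} {p q : Fin n → Fin n} (mp : IsMatching p) (mq : IsMatching q)
                 (p≢q : ∀ x → p x ≢ q x) (comm : ∀ x → p (q x) ≡ q (p x))
                 (P : Classes (Moves (p ∷ q ∷ []))) where

  orbitList : Fin n → List (Fin n)
  orbitList x = x ∷ p x ∷ q x ∷ p (q x) ∷ []

  orbitList-unique : ∀ x → Unique (orbitList x)
  orbitList-unique x =
    ((no-fixed mp x ∘ sym) ∷ (no-fixed mq x ∘ sym) ∷
       (λ e → p≢q x (matching-injective mp (trans (involutive mp x) e))) ∷ []) ∷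
    (p≢q x ∷ (λ e → no-fixed mq x (sym (matching-injective mp e))) ∷ []) ∷
    ((no-fixed mp (q x) ∘ sym) ∷ []) ∷ [] ∷ []

  orbitList-complete : ∀ {x y} → SameOrbit (p ∷ q ∷ []) x y → y ∈ orbitList x
  orbitList-complete {x} xy = orbit-closed (_∈ orbitList x)
    (λ { (here refl) → involutive mp ; (there (here refl)) → involutive mq })
    (λ { (here refl) (here refl) → there (here refl)
       ; (here refl) (there (here refl)) → here (involutive mp x)
       ; (here refl) (there (there (here refl))) → there (there (there (here refl)))
       ; (here refl) (there (there (there (here refl)))) → there (there (here (involutive mp (q x))))
       ; (there (here refl)) (here refl) → there (there (here refl))
       ; (there (here refl)) (there (here refl)) → there (there (there (here (sym (comm x)))))
       ; (there (here refl)) (there (there (here refl))) → here (involutive mq x)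
       ; (there (here refl)) (there (there (there (here refl)))) →
           there (here (trans (sym (comm (q x))) (cong p (involutive mq x)))) })
    xy (here refl)

  class-p : Inv p (class P)
  class-p = class-step P (here refl)

  class-q : Inv q (class P)
  class-q = class-step P (there (here refl))

  ∈-orbitList : ∀ {x s} → class P x ≡ s → x ∈ orbitList (rep P s)
  ∈-orbitList {x} refl = orbitList-complete (rep∼ P x)

  orbitList-class : ∀ {x s} → x ∈ orbitList (rep P s) → class P x ≡ s
  orbitList-class {s = s} (here refl) = class-rep P s
  orbitList-class {s = s} (there (here refl)) = trans (class-p _) (class-rep P s)
  orbitList-class {s = s} (there (there (here refl))) = trans (class-q _) (class-rep P s)
  orbitList-class {s = s} (there (there (there (here refl)))) =
    trans (class-p _) (trans (class-q _) (class-rep P s))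

  ∑-orbits : (h : Fin n → Bool) →
             ∑ h ≡ ∑ λ s → let r = rep P s in (h r xor h (p r)) xor (h (q r) xor h (p (q r)))
  ∑-orbits h = trans
    (∑-fibres (class P) (λ s → orbitList (rep P s)) (λ s → orbitList-unique (rep P s))
              ∈-orbitList orbitList-class h)
    (∑-cong λ s → trans (sym (xor-assoc (h (rep P s)) _ _))
      (cong (λ b → (h (rep P s) xor h (p (rep P s))) xor (h (q (rep P s)) xor b)) (xor-identityʳ _)))

-- The orbits of p ∘ q are permuted by p without fixed orbits, and q acts on
-- them in the same way as p; so it suffices to compare an orbit with its partner.
flipper : ∀ {n} {p q : Fin n → Fin n} → IsMatching p → IsMatching q →
          ∃[ s ] (∀ x → s (p x) ≡ not (s x)) × (∀ x → s (q x) ≡ not (s x))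
flipper {n} {p} {q} mp mq = s , s-p , s-q
  where
  r : Fin n → Fin n
  r = p ∘ q

  P : Classes (Moves (r ∷ []))
  P = orbits (r ∷ [])

  r-p : ∀ x → r (p (r x)) ≡ p x
  r-p x = cong p (trans (cong q (involutive mp (q x))) (involutive mq x))

  r^ : ℕ → Fin n → Fin n
  r^ zero    x = x
  r^ (suc k) x = r^ k (r x)

  r-injective : ∀ {x y} → r x ≡ r y → x ≡ y
  r-injective = matching-injective mq ∘ matching-injective mp

  r^-r : ∀ k x → r^ k (r x) ≡ r (r^ k x)
  r^-r zero    x = refl
  r^-r (suc k) x = r^-r k (r x)

  -- The generator `r` is not an involution: a walk in its orbit is straightened to a power of `r`
  -- taken in one of the two directions.
  power : ∀ {x y} → SameOrbit (r ∷ []) x y → ∃[ k ] (r^ k x ≡ y ⊎ r^ k y ≡ x)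
  power nil = 0 , inj₁ refl
  power (fwd (_ , here refl , refl) ◅ xs) with power xs
  ... | k     , inj₁ e = suc k , inj₁ e
  ... | zero  , inj₂ e = 1 , inj₁ (sym e)
  ... | suc k , inj₂ e = k , inj₂ (r-injective (trans (sym (r^-r k _)) e))
  power {x} (bwd (_ , here refl , refl) ◅ xs) with power xs
  ... | k     , inj₂ e = suc k , inj₂ (trans (r^-r k _) (cong r e))
  ... | zero  , inj₁ e = 1 , inj₂ (cong r (sym e))
  ... | suc k , inj₁ e = k , inj₁ e

  -- In a dihedral group, a reflection is compared with a rotation. Cancelling an `r` by means of r
  -- p r = p lowers the exponent by two, until `p` (exponent 0) or `q` (exponent 1) would have a
  -- fixed point.
  p-power : ∀ k x → r^ k x ≢ p x
  p-power 0 x e = no-fixed mp x (sym e)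
  p-power 1 x e = no-fixed mq x (matching-injective mp e)
  p-power (suc (suc k)) x e =
    p-power k (r x) (r-injective (trans (sym (r^-r k (r x))) (trans e (sym (r-p x)))))

  p-orbit : ∀ x → class P (p x) ≢ class P x
  p-orbit x e with power (complete P e)
  ... | k , inj₁ e = p-power k (p x) (trans e (sym (involutive mp x)))
  ... | k , inj₂ e = p-power k x e

  class-r : Inv r (class P)
  class-r = class-step P (here refl)

  class-pr : ∀ x → class P (p (r x)) ≡ class P (p x)
  class-pr x = trans (sym (class-r (p (r x)))) (cong (class P) (r-p x))

  class-q : ∀ x → class P (q x) ≡ class P (p x)
  class-q x = trans (cong (class P) (sym (involutive mp (q x)))) (class-pr x)

  s : Fin n → Bool
  s x = isYes (class P x <? class P (p x))

  compare : ∀ {m} {i j : Fin m} → j ≢ i → isYes (j <? i) ≡ not (isYes (i <? j))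
  compare {i = i} {j} j≢i with j <? i | i <? j
  ... | yes j<i | yes i<j = contradiction i<j (ℕ.<-asym j<i)
  ... | yes _   | no  _   = refl
  ... | no  _   | yes _   = refl
  ... | no  j≮i | no  i≮j = contradiction (toℕ-injective (ℕ.≤-antisym (ℕ.≮⇒≥ i≮j) (ℕ.≮⇒≥ j≮i))) j≢i

  s-p : ∀ x → s (p x) ≡ not (s x)
  s-p x = trans (cong (λ y → isYes (class P (p x) <? class P y)) (involutive mp x)) (compare (p-orbit x))

  s-q : ∀ x → s (q x) ≡ not (s x)
  s-q x = trans (cong₂ (λ c d → isYes (c <? d)) (class-q x) (class-r x)) (compare (p-orbit x))

-- The bilinear form under concatenation and permutation of coordinates

dot-++ : ∀ {k l} (A C : Subset k) (B D : Subset l) → dot (A ++ B) (C ++ D) ≡ dot A C xor dot B D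
dot-++ []      []      B D = sym (cong (_xor dot B D) (dot-[] [] []))
dot-++ (a ∷ A) (c ∷ C) B D = begin
  dot (a ∷ (A ++ B)) (c ∷ (C ++ D))        ≡⟨ dot-∷ a c (A ++ B) (C ++ D) ⟩
  (a ∧ c) xor dot (A ++ B) (C ++ D)        ≡⟨ cong ((a ∧ c) xor_) (dot-++ A C B D) ⟩
  (a ∧ c) xor (dot A C xor dot B D)        ≡⟨ xor-assoc (a ∧ c) _ _ ⟨
  ((a ∧ c) xor dot A C) xor dot B D        ≡⟨ cong (_xor dot B D) (dot-∷ a c A C) ⟨
  dot (a ∷ A) (c ∷ C) xor dot B D          ∎

dot-tabulateʳ : ∀ {m} (A : Subset m) (h : Fin m → Bool) → dot A (tabulate h) ≡ ∑ λ i → lookup A i ∧ h i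
dot-tabulateʳ A h = trans (dot-def A (tabulate h)) (∑-cong λ i → cong (lookup A i ∧_) (lookup∘tabulate h i))

permuted : ∀ {k m} → (Fin m → Fin k) → Subset k → Subset m
permuted p A = tabulate (lookup A ∘ p)

permuted-⊕ : ∀ {k m} (p : Fin m → Fin k) → Additive (permuted p)
permuted-⊕ p A B = lookup-ext λ i → trans (lookup∘tabulate _ i) (trans (lookup-⊕ A B (p i))
  (sym (trans (lookup-⊕ (permuted p A) (permuted p B) i)
    (cong₂ _xor_ (lookup∘tabulate _ i) (lookup∘tabulate _ i)))))

dot-permuted : ∀ {k m} (π : Fin m ↔ Fin k) A B →
               dot (permuted (Inverse.to π) A) (permuted (Inverse.to π) B) ≡ dot A B
dot-permuted π A B = begin
  dot (permuted (Inverse.to π) A) (permuted (Inverse.to π) B)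
    ≡⟨ dot-def (permuted (Inverse.to π) A) (permuted (Inverse.to π) B) ⟩
  ∑ (λ i → lookup (permuted (Inverse.to π) A) i ∧ lookup (permuted (Inverse.to π) B) i)
    ≡⟨ ∑-cong (λ i → cong₂ _∧_ (lookup∘tabulate _ i) (lookup∘tabulate _ i)) ⟩
  ∑ (λ i → lookup A (Inverse.to π i) ∧ lookup B (Inverse.to π i))
    ≡⟨ ∑-permute (λ i → lookup A i ∧ lookup B i) π ⟨
  ∑ (λ i → lookup A i ∧ lookup B i)
    ≡⟨ dot-def A B ⟨
  dot A B ∎

permuted-permuted : ∀ {k l m} (p : Fin m → Fin l) (q : Fin l → Fin k) A →
                    permuted p (permuted q A) ≡ permuted (q ∘ p) A
permuted-permuted p q A = tabulate-cong λ i → lookup∘tabulate _ (p i)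

permuted-id : ∀ {k} {p : Fin k → Fin k} → (∀ i → p i ≡ i) → ∀ A → permuted p A ≡ A
permuted-id e A = trans (tabulate-cong λ i → cong (lookup A) (e i)) (tabulate∘lookup A)

dot-matching : ∀ {n} {p : Fin n → Fin n} → IsMatching p → ∀ A B → dot (permuted p A) B ≡ dot A (permuted p B)
dot-matching {p = p} mp A B = trans
  (cong (dot (permuted p A)) (sym (trans (permuted-permuted p p B) (permuted-id (involutive mp) B))))
  (dot-permuted (matching↔ mp) A (permuted p B))

-- Richness as splitting of cycles

-- For a `u` constant on v-edges this is the edge cut of G_M that `u` describes. Only then is the
-- value at a square independent of the chosen representative; see `lookup-δ`.
δ : (M : Map) → (Fin (#C M) → Bool) → Subset (size (SQ M))
δ M u = tabulate λ s → u (rep (SQ M) s) xor u (f M (rep (SQ M) s))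

VGonal : (M : Map) → (Fin (#C M) → Bool) → Set
VGonal M u = Inv (v M) u × Inv (a M) u

vspace⇒δ : ∀ M {A} → VSpace M A → ∃[ u ] VGonal M u × δ M u ≡ A
vspace⇒δ M (U , refl) =
  lookup U ∘ class (v-gons M) ,
  ((λ x → cong (lookup U) (class-step (v-gons M) (here refl) x)) ,
   (λ x → cong (lookup U) (class-step (v-gons M) (there (here refl)) x))) , refl

δ⇒vspace : ∀ M {u} → VGonal M u → VSpace M (δ M u)
δ⇒vspace M {u} (u-v , u-a) = tabulate (u ∘ rep (v-gons M)) ,
  tabulate-cong λ s → cong₂ _xor_ (value _) (value _)
  where
  value : ∀ x → lookup (tabulate (u ∘ rep (v-gons M))) (class (v-gons M) x) ≡ u x
  value x = trans (lookup∘tabulate _ (class (v-gons M) x)) (orbit-invariant₂ u u-v u-a (rep∼ (v-gons M) x))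

module _ (M : Map) where

  module Squares = FourOrbit (v-matching M) (f-matching M) (v≢f M) (square M) (SQ M)

  zv : ∀ x → z M (f M x) ≡ v M x
  zv x = cong (v M) (involutive (f-matching M) x)

  zf : ∀ x → z M (v M x) ≡ f M x
  zf x = trans (cong (v M) (sym (square M x))) (involutive (v-matching M) (f M x))

  squareSet : (Fin (#C M) → Bool) → Subset (size (SQ M))
  squareSet t = tabulate (t ∘ rep (SQ M))

  lookup-squareSet : ∀ {t} → Inv (v M) t → Inv (f M) t → ∀ x → lookup (squareSet t) (class (SQ M) x) ≡ t x
  lookup-squareSet {t} t-v t-f x =
    trans (lookup∘tabulate _ (class (SQ M) x)) (orbit-invariant₂ t t-v t-f (rep∼ (SQ M) x))

  lookup-δ : ∀ {u} → Inv (v M) u → ∀ x → lookup (δ M u) (class (SQ M) x) ≡ u x xor u (f M x)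
  lookup-δ {u} u-v = lookup-squareSet
    (λ x → cong₂ _xor_ (u-v x) (trans (cong u (sym (square M x))) (u-v (f M x))))
    (λ x → trans (cong (u (f M x) xor_) (cong u (involutive (f-matching M) x))) (xor-comm _ (u x)))

  pairing : ∀ {u} → Inv (v M) u → (k : Fin (#C M) → Bool) →
            ∑ (λ x → k x ∧ u x) ≡ ∑ λ s → let r = rep (SQ M) s in
              ((k r xor k (v M r)) ∧ u r) xor ((k (f M r) xor k (z M r)) ∧ u (f M r))
  pairing {u} u-v k = trans (Squares.∑-orbits (λ x → k x ∧ u x)) (∑-cong λ s → cong₂ _xor_ (edge _) (edge _))
    where
    edge : ∀ x → (k x ∧ u x) xor (k (v M x) ∧ u (v M x)) ≡ (k x xor k (v M x)) ∧ u x
    edge x = trans (cong (λ b → (k x ∧ u x) xor (k (v M x) ∧ b)) (u-v x))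
                   (sym (∧-distribʳ-xor (u x) (k x) (k (v M x))))

  -- Summation by parts. Each of the two v-edges of a square contributes the jump of `k` times the
  -- value of `u` on it; the two jumps agree, and the two values of `u` add up to the coboundary.
  pairing-δ : ∀ {u k A} → Inv (v M) u → (∀ x → k x xor k (v M x) ≡ lookup A (class (SQ M) x)) →
              ∑ (λ x → k x ∧ u x) ≡ dot A (δ M u)
  pairing-δ {u} {k} {A} u-v kA = trans (pairing u-v k) (trans
    (∑-cong λ s → let r = rep (SQ M) s in begin
      ((k r xor k (v M r)) ∧ u r) xor ((k (f M r) xor k (z M r)) ∧ u (f M r))
        ≡⟨ cong₂ (λ b c → (b ∧ u r) xor (c ∧ u (f M r)))
             (trans (kA r) (cong (lookup A) (class-rep (SQ M) s)))
             (trans (kA (f M r)) (cong (lookup A) (trans (Squares.class-q r) (class-rep (SQ M) s)))) ⟩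
      (lookup A s ∧ u r) xor (lookup A s ∧ u (f M r))
        ≡⟨ ∧-distribˡ-xor (lookup A s) _ _ ⟨
      lookup A s ∧ (u r xor u (f M r)) ∎)
    (sym (dot-tabulateʳ A _)))

  ᗮ⇒dot : ∀ A → (VSpace M ᗮ) A → ∀ {u} → VGonal M u → dot A (δ M u) ≡ false
  ᗮ⇒dot A A∈ {u} u-inv = ⟨⟩≡0⇒dot A (δ M u) (A∈ _ (δ⇒vspace M u-inv))

  dot⇒ᗮ : ∀ A → (∀ {u} → VGonal M u → dot A (δ M u) ≡ false) → (VSpace M ᗮ) A
  dot⇒ᗮ A p B B∈ with u , u-inv , refl ← vspace⇒δ M B∈ = dot⇒⟨⟩≡0 A (δ M u) (p u-inv)

  -- By `pairing-δ` the pairing of A with a cut is a sum of values of k · u, which cancel in pairs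
  -- along a. Such a `k` is an integral of A along the v-edges; `potential` is the converse.
  ᗮ-pairing : ∀ A {k} → Inv (a M) k → (∀ x → k x xor k (v M x) ≡ lookup A (class (SQ M) x)) → (VSpace M ᗮ) A
  ᗮ-pairing A {k} k-a kA = dot⇒ᗮ A λ {u} (u-v , u-a) → trans (sym (pairing-δ {u} {k} {A} u-v kA))
    (∑-matching (a-matching M) _ λ x → cong₂ _∧_ (k-a x) (u-a x))

xor-interchange : ∀ a b c d → (a xor b) xor (c xor d) ≡ (a xor c) xor (b xor d)
xor-interchange = solve 4 (λ a b c d → (a :+ b) :+ (c :+ d) := (a :+ c) :+ (b :+ d)) refl
  where open xor-∧-Solver

lookup-δ-dual : ∀ M {g} → VGonal (dual M) g → ∀ x → lookup (δ (dual M) g) (class (SQ M) x) ≡ g x xor g (v M x)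
lookup-δ-dual M (g-f , _) = lookup-δ (dual M) g-f

phial-v : ∀ M {h : Fin (#C M) → Bool} → Inv (z M) h → ∀ x → h (v M x) ≡ h (f M x)
phial-v M {h} h-z x = trans (sym (h-z (v M x))) (cong h (zf M x))

-- By definition the jump of `h` is taken across f-edges; as v x and f x are joined by z, it equals
-- the jump across v-edges. In this form it can be added to coboundaries of the dual, which are
-- taken across v-edges.
lookup-δ-phial : ∀ M {h} → VGonal (phial M) h → ∀ x → lookup (δ (phial M) h) (class (SQ M) x) ≡ h x xor h (v M x)
lookup-δ-phial M {h} (h-z , _) x = trans (lookup-δ (phial M) h-z x) (cong (h x xor_) (sym (phial-v M h-z x)))

f⊆vᗮ : ∀ M → FSpace M ⊆ₚ (VSpace M ᗮ)
f⊆vᗮ M A∈ with vspace⇒δ (dual M) A∈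
... | g , g-inv@(_ , g-a) , refl = ᗮ-pairing M (δ (dual M) g) {g} g-a (λ x → sym (lookup-δ-dual M g-inv x))

z⊆vᗮ : ∀ M → ZSpace M ⊆ₚ (VSpace M ᗮ)
z⊆vᗮ M A∈ with vspace⇒δ (phial M) A∈
... | h , h-inv@(_ , h-a) , refl = ᗮ-pairing M (δ (phial M) h) {h} h-a (λ x → sym (lookup-δ-phial M h-inv x))

ᗮ-⊕ : ∀ {m} {W : Pred (Subset m) 0ℓ} A B → (W ᗮ) A → (W ᗮ) B → (W ᗮ) (A ⊕ B)
ᗮ-⊕ A B p q C C∈ = dot⇒⟨⟩≡0 (A ⊕ B) C (trans (dot-⊕ˡ A B C)
  (cong₂ _xor_ (⟨⟩≡0⇒dot A C (p C C∈)) (⟨⟩≡0⇒dot B C (q C C∈))))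

f+z⊆vᗮ : ∀ M → (FSpace M +ₛ ZSpace M) ⊆ₚ (VSpace M ᗮ)
f+z⊆vᗮ M (B , C , B∈ , C∈ , refl) = ᗮ-⊕ {W = VSpace M} B C (f⊆vᗮ M B∈) (z⊆vᗮ M C∈)

coboundary-⊕ : ∀ G → Additive (coboundary G)
coboundary-⊕ G A B = lookup-ext λ e → let x , y = ends G e in begin
  lookup (coboundary G (A ⊕ B)) e
    ≡⟨ lookup∘tabulate _ e ⟩
  lookup (A ⊕ B) x xor lookup (A ⊕ B) y
    ≡⟨ cong₂ _xor_ (lookup-⊕ A B x) (lookup-⊕ A B y) ⟩
  (lookup A x xor lookup B x) xor (lookup A y xor lookup B y)
    ≡⟨ xor-interchange (lookup A x) (lookup B x) (lookup A y) (lookup B y) ⟩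
  (lookup A x xor lookup A y) xor (lookup B x xor lookup B y)
    ≡⟨ cong₂ _xor_ (lookup∘tabulate _ e) (lookup∘tabulate _ e) ⟨
  lookup (coboundary G A) e xor lookup (coboundary G B) e
    ≡⟨ lookup-⊕ (coboundary G A) (coboundary G B) e ⟨
  lookup (coboundary G A ⊕ coboundary G B) e ∎

coboundary-dim : ∀ G → ∃[ r ] ∃[ d ]
  HasDim (CoboundarySpace G) r × HasDim (Kernel (coboundary G)) d × r ℕ.+ d ≡ #V G
coboundary-dim G = drop-All (rank-nullity (coboundary G) (coboundary-⊕ G))
  where
  drop-All : ∃[ r ] ∃[ d ] HasDim (Image (coboundary G) All) r × HasDim (Kernel (coboundary G)) d × r ℕ.+ d ≡ #V G →
             ∃[ r ] ∃[ d ] HasDim (CoboundarySpace G) r × HasDim (Kernel (coboundary G)) d × r ℕ.+ d ≡ #V G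
  drop-All (r , d , dimI , dimK , e) =
    r , d , hasDim-≐ (λ { (U , _ , p) → U , p }) (λ { (U , p) → U , _ , p }) dimI , dimK , e

vspace-dim : ∀ M → ∃[ d ] HasDim (VSpace M) d
vspace-dim M = proj₁ (coboundary-dim (𝔾 M)) , proj₁ (proj₂ (proj₂ (coboundary-dim (𝔾 M))))

rich⇒vᗮ⊆f+z : ∀ M → Rich M → (VSpace M ᗮ) ⊆ₚ (FSpace M +ₛ ZSpace M)
rich⇒vᗮ⊆f+z M (d , e , dimV , dimFZ , d≡e+0) = dim-≡⇒⊇ {U = FSpace M +ₛ ZSpace M} (f+z⊆vᗮ M) dimFZ
  (subst (HasDim (VSpace M ᗮ)) (trans d≡e+0 (ℕ.+-identityʳ e)) dimV)

vᗮ⊆f+z⇒rich : ∀ M → (VSpace M ᗮ) ⊆ₚ (FSpace M +ₛ ZSpace M) → Rich M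
vᗮ⊆f+z⇒rich M ⊆ = e , e , dim , hasDim-≐ {U = VSpace M ᗮ} ⊆ (f+z⊆vᗮ M) dim , sym (ℕ.+-identityʳ e)
  where
  e : ℕ
  e = proj₁ (hasDim-ᗮ (proj₂ (vspace-dim M)))

  dim : HasDim (VSpace M ᗮ) e
  dim = proj₁ (proj₂ (hasDim-ᗮ (proj₂ (vspace-dim M))))

-- Orthogonality of A to V means that the increments prescribed on the v-edges
-- sum to zero along every v-gon.
potential : ∀ M {A} → (VSpace M ᗮ) A →
            ∃[ k ] Inv (a M) k × (∀ x → k x xor k (v M x) ≡ lookup A (class (SQ M) x))
potential M {A} A∈ = found (separation Bs target)
  where
  n : ℕ
  n = #C M

  -- The unknown `k` solves the linear system k + k∘a = 0, k + k∘v = t. The two blocks are the two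
  -- left-hand sides, and solvability is decided by `separation`.
  Φ : Subset n → Subset (n ℕ.+ n)
  Φ K = (K ⊕ permuted (a M) K) ++ (K ⊕ permuted (v M) K)

  Φ-⊕ : Additive Φ
  Φ-⊕ K L = trans (cong₂ _++_ (half (a M)) (half (v M)))
    (sym (Vec.zipWith-++ _xor_ (K ⊕ permuted (a M) K) _ (L ⊕ permuted (a M) L) _))
    where
    half : ∀ p → (K ⊕ L) ⊕ permuted p (K ⊕ L) ≡ (K ⊕ permuted p K) ⊕ (L ⊕ permuted p L)
    half p = trans (cong ((K ⊕ L) ⊕_) (permuted-⊕ p K L)) (⊕-interchange K L _ _)

  ranks : ∃[ r ] ∃[ d ] HasDim (Image Φ All) r × HasDim (Kernel Φ) d × r ℕ.+ d ≡ n
  ranks = rank-nullity Φ Φ-⊕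

  Bs : Vec (Subset (n ℕ.+ n)) (proj₁ ranks)
  Bs = proj₁ (proj₁ (proj₂ (proj₂ ranks)))

  span⇒image : Span Bs ⊆ₚ Image Φ All
  span⇒image = proj₂ (proj₂ (proj₂ (proj₁ (proj₂ (proj₂ ranks)))))

  image⇒span : Image Φ All ⊆ₚ Span Bs
  image⇒span = proj₁ (proj₂ (proj₂ (proj₁ (proj₂ (proj₂ ranks)))))

  t : Fin n → Bool
  t x = lookup A (class (SQ M) x)

  target : Subset (n ℕ.+ n)
  target = ⊥ {n} ++ tabulate t

  solved : Span Bs target → ∃[ k ] Inv (a M) k × (∀ x → k x xor k (v M x) ≡ t x)
  solved t∈ with K , _ , e ← span⇒image t∈ = lookup K ,
    (λ x → sym (xor-cancel (trans (entry (a M) K x)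
      (trans (cong (λ X → lookup X x) (Vec.++-injectiveˡ (K ⊕ permuted (a M) K) ⊥ e)) (lookup-⊥ x))))) ,
    (λ x → trans (entry (v M) K x)
      (trans (cong (λ X → lookup X x) (Vec.++-injectiveʳ (K ⊕ permuted (a M) K) ⊥ e)) (lookup∘tabulate t x)))
    where
    entry : ∀ p K x → lookup K x xor lookup K (p x) ≡ lookup (K ⊕ permuted p K) x
    entry p K x = sym (trans (lookup-⊕ K (permuted p K) x) (cong (lookup K x xor_) (lookup∘tabulate _ x)))

  -- A functional (c, d) that vanishes on the image of `Φ` satisfies c + c∘a = d + d∘v, because
  -- permuting along a matching is self-adjoint. The common value `e` is invariant under a through
  -- its left side and under v through its right side, so it is constant on v-gons and its cut is
  -- orthogonal to A.
  module Obstruction (c d : Subset n) (perp : ∀ K → dot (Φ K) (c ++ d) ≡ false) where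

    dot-Φ : ∀ K → dot (Φ K) (c ++ d) ≡ dot ((c ⊕ permuted (a M) c) ⊕ (d ⊕ permuted (v M) d)) K
    dot-Φ K = begin
      dot (Φ K) (c ++ d)
        ≡⟨ dot-++ (K ⊕ permuted (a M) K) c (K ⊕ permuted (v M) K) d ⟩
      dot (K ⊕ permuted (a M) K) c xor dot (K ⊕ permuted (v M) K) d
        ≡⟨ cong₂ _xor_ (half (a-matching M) c) (half (v-matching M) d) ⟩
      dot (c ⊕ permuted (a M) c) K xor dot (d ⊕ permuted (v M) d) K
        ≡⟨ dot-⊕ˡ (c ⊕ permuted (a M) c) (d ⊕ permuted (v M) d) K ⟨
      dot ((c ⊕ permuted (a M) c) ⊕ (d ⊕ permuted (v M) d)) K ∎
      where
      half : ∀ {p} → IsMatching p → ∀ c → dot (K ⊕ permuted p K) c ≡ dot (c ⊕ permuted p c) K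
      half {p} mp c = begin
        dot (K ⊕ permuted p K) c            ≡⟨ dot-⊕ˡ K (permuted p K) c ⟩
        dot K c xor dot (permuted p K) c    ≡⟨ cong (dot K c xor_) (dot-matching mp K c) ⟩
        dot K c xor dot K (permuted p c)    ≡⟨ dot-⊕ʳ K c (permuted p c) ⟨
        dot K (c ⊕ permuted p c)            ≡⟨ dot-comm K _ ⟩
        dot (c ⊕ permuted p c) K            ∎

    e : Fin n → Bool
    e x = lookup d x xor lookup d (v M x)

    balance : ∀ x → lookup c x xor lookup c (a M x) ≡ e x
    balance x = begin
      lookup c x xor lookup c (a M x)
        ≡⟨ entry (a M) c ⟨
      lookup (c ⊕ permuted (a M) c) x
        ≡⟨ cong (λ X → lookup X x) (⊕-cancel {A = c ⊕ permuted (a M) c} {d ⊕ permuted (v M) d}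
             (nondegenerate _ λ K → trans (sym (dot-Φ K)) (perp K))) ⟩
      lookup (d ⊕ permuted (v M) d) x
        ≡⟨ entry (v M) d ⟩
      e x ∎
      where
      entry : ∀ p c → lookup (c ⊕ permuted p c) x ≡ lookup c x xor lookup c (p x)
      entry p c = trans (lookup-⊕ c (permuted p c) x) (cong (lookup c x xor_) (lookup∘tabulate _ x))

    e-inv : VGonal M e
    e-inv =
      (λ x → trans (cong (lookup d (v M x) xor_) (cong (lookup d) (involutive (v-matching M) x)))
                   (xor-comm _ (lookup d x))) ,
      (λ x → trans (sym (balance (a M x))) (trans
        (cong (lookup c (a M x) xor_) (cong (lookup c) (involutive (a-matching M) x)))
        (trans (xor-comm _ (lookup c x)) (balance x))))

    -- Here `t` takes the v-invariant place in `pairing`. It is constant on each square, so only the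
    -- jumps `e` of `d` on the two v-edges remain, and they form the cut of `e`.
    t⊥d : ∑ (λ x → lookup d x ∧ t x) ≡ false
    t⊥d = begin
      ∑ (λ x → lookup d x ∧ t x)
        ≡⟨ pairing M {t} (λ x → cong (lookup A) (Squares.class-p M x)) (lookup d) ⟩
      ∑ (λ s → let r = rep (SQ M) s in
           (e r ∧ t r) xor ((lookup d (f M r) xor lookup d (z M r)) ∧ t (f M r)))
        ≡⟨ ∑-cong (λ s → let r = rep (SQ M) s in trans
             (cong₂ (λ b b′ → (e r ∧ b) xor (e (f M r) ∧ b′))
               (cong (lookup A) (class-rep (SQ M) s))
               (cong (lookup A) (trans (Squares.class-q M r) (class-rep (SQ M) s))))
             (trans (sym (∧-distribʳ-xor (lookup A s) (e r) (e (f M r)))) (∧-comm (e r xor e (f M r)) (lookup A s)))) ⟩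
      ∑ (λ s → let r = rep (SQ M) s in lookup A s ∧ (e r xor e (f M r)))
        ≡⟨ dot-tabulateʳ A _ ⟨
      dot A (δ M e)
        ≡⟨ ᗮ⇒dot M A A∈ e-inv ⟩
      false ∎

    target⊥ : dot target (c ++ d) ≡ false
    target⊥ = begin
      dot target (c ++ d)             ≡⟨ dot-++ ⊥ c (tabulate t) d ⟩
      dot ⊥ c xor dot (tabulate t) d  ≡⟨ cong₂ _xor_ (dot-⊥ˡ c) (trans (dot-comm (tabulate t) d) (dot-tabulateʳ d t)) ⟩
      ∑ (λ x → lookup d x ∧ t x)      ≡⟨ t⊥d ⟩
      false                           ∎

  found : Span Bs target ⊎ ∃[ C ] (∀ i → dot (lookup Bs i) C ≡ false) × dot target C ≡ true →
          ∃[ k ] Inv (a M) k × (∀ x → k x xor k (v M x) ≡ t x)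
  found (inj₁ t∈) = solved t∈
  found (inj₂ (C , C⊥ , p)) with c , d , refl ← Vec.splitAt n C = contradiction
    (trans (sym p) (Obstruction.target⊥ c d λ K → span-⊥ᗮ Bs C⊥ (image⇒span (K , _ , refl)))) λ ()


-- The function k is a cycle of the 4-regular graph whose edges are the a-edges
-- and whose vertices are the squares.
IsCycle : (M : Map) → (Fin (#C M) → Bool) → Set
IsCycle M k = Inv (a M) k × (∀ x → (k x xor k (v M x)) xor (k (f M x) xor k (z M x)) ≡ false)

Splits : (M : Map) → (Fin (#C M) → Bool) → Set
Splits M k = ∃[ u ] ∃[ g ] ∃[ h ]
  VGonal M u × VGonal (dual M) g × VGonal (phial M) h × (∀ x → k x ≡ u x xor (g x xor h x))

AllCyclesSplit : Map → Set
AllCyclesSplit M = ∀ k → IsCycle M k → Splits M k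

-- The cycle condition says that `k` has the same jump on both v-edges of a square, so the jumps
-- form a set of squares, which lies in V^⊥. Richness writes it as a sum of coboundaries of some `g`
-- and `h`; then k + g + h has no jump across v-edges and serves as `u`.
rich⇒split : ∀ M → Rich M → AllCyclesSplit M
rich⇒split M rich k (k-a , cycle) =
  from-sum (rich⇒vᗮ⊆f+z M rich (ᗮ-pairing M t {k} k-a λ x → sym (lookup-squareSet M t-v t-f x)))
  where
  t′ : Fin (#C M) → Bool
  t′ x = k x xor k (v M x)

  t : Subset (size (SQ M))
  t = squareSet M t′

  t-v : Inv (v M) t′
  t-v x = trans (cong (k (v M x) xor_) (cong k (involutive (v-matching M) x))) (xor-comm _ (k x))

  t-f : Inv (f M) t′
  t-f x = sym (xor-cancel (cycle x))

  from-sum : (FSpace M +ₛ ZSpace M) t → Splits M k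
  from-sum (B , C , B∈ , C∈ , e) with vspace⇒δ (dual M) B∈ | vspace⇒δ (phial M) C∈
  ... | g , g-inv , refl | h , h-inv , refl =
    (λ x → k x xor (g x xor h x)) , g , h ,
    ((λ x → xor-cancel (begin
        (k (v M x) xor (g (v M x) xor h (v M x))) xor (k x xor (g x xor h x))
          ≡⟨ regroup (k (v M x)) (g (v M x)) (h (v M x)) (k x) (g x) (h x) ⟩
        (k x xor k (v M x)) xor ((g x xor g (v M x)) xor (h x xor h (v M x)))
          ≡⟨ cong ((k x xor k (v M x)) xor_) (trans (sym (cong₂ _xor_
               (lookup-δ-dual M g-inv x) (lookup-δ-phial M h-inv x)))
               (trans (sym (lookup-⊕ (δ (dual M) g) (δ (phial M) h) (class (SQ M) x)))
                 (trans (cong (λ X → lookup X (class (SQ M) x)) e) (lookup-squareSet M t-v t-f x)))) ⟩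
        t′ x xor t′ x
          ≡⟨ xor-same (t′ x) ⟩
        false ∎)) ,
     (λ x → cong₂ _xor_ (k-a x) (cong₂ _xor_ (proj₂ g-inv x) (proj₂ h-inv x)))) ,
    g-inv , h-inv ,
    (λ x → restore (k x) (g x xor h x))
    where
    open xor-∧-Solver

    regroup : ∀ k′ g′ h′ k g h →
              (k′ xor (g′ xor h′)) xor (k xor (g xor h)) ≡ (k xor k′) xor ((g xor g′) xor (h xor h′))
    regroup = solve 6 (λ k′ g′ h′ k g h →
      (k′ :+ (g′ :+ h′)) :+ (k :+ (g :+ h)) := (k :+ k′) :+ ((g :+ g′) :+ (h :+ h′))) refl

    restore : ∀ k g → k ≡ (k xor g) xor g
    restore = solve 2 (λ k g → k := (k :+ g) :+ g) refl


-- A potential of an element A of V^⊥ is a cycle, since both v-edges of a square carry the increment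
-- prescribed by A. In its splitting `u` has no jump across v-edges, so A is the sum of the
-- coboundaries of `g` and `h`.
split⇒rich : ∀ M → AllCyclesSplit M → Rich M
split⇒rich M split = vᗮ⊆f+z⇒rich M λ {A} A∈ →
  let k , k-a , kA = potential M {A} A∈
      t : ∀ x → Bool
      t x = lookup A (class (SQ M) x)
      u , g , h , (u-v , _) , g-inv , h-inv , k≡ = split k (k-a , λ x → trans
        (cong₂ _xor_ (kA x) (trans (kA (f M x)) (cong (lookup A) (Squares.class-q M x)))) (xor-same (t x)))
  in δ (dual M) g , δ (phial M) h , δ⇒vspace (dual M) g-inv , δ⇒vspace (phial M) h-inv ,
     lookup-ext λ s → let x = rep (SQ M) s in begin
       lookup (δ (dual M) g ⊕ δ (phial M) h) s
         ≡⟨ cong (lookup (δ (dual M) g ⊕ δ (phial M) h)) (class-rep (SQ M) s) ⟨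
       lookup (δ (dual M) g ⊕ δ (phial M) h) (class (SQ M) x)
         ≡⟨ lookup-⊕ (δ (dual M) g) (δ (phial M) h) (class (SQ M) x) ⟩
       lookup (δ (dual M) g) (class (SQ M) x) xor lookup (δ (phial M) h) (class (SQ M) x)
         ≡⟨ cong₂ _xor_ (lookup-δ-dual M g-inv x) (lookup-δ-phial M h-inv x) ⟩
       (g x xor g (v M x)) xor (h x xor h (v M x))
         ≡⟨ insert (u x) (g x) (g (v M x)) (h x) (h (v M x)) ⟩
       (u x xor (g x xor h x)) xor (u x xor (g (v M x) xor h (v M x)))
         ≡⟨ cong (λ b → (u x xor (g x xor h x)) xor (b xor (g (v M x) xor h (v M x)))) (u-v x) ⟨
       (u x xor (g x xor h x)) xor (u (v M x) xor (g (v M x) xor h (v M x)))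
         ≡⟨ cong₂ _xor_ (k≡ x) (k≡ (v M x)) ⟨
       k x xor k (v M x)
         ≡⟨ kA x ⟩
       lookup A (class (SQ M) x)
         ≡⟨ cong (lookup A) (class-rep (SQ M) s) ⟩
       lookup A s ∎
  where
  open xor-∧-Solver

  insert : ∀ u g g′ h h′ → (g xor g′) xor (h xor h′) ≡ (u xor (g xor h)) xor (u xor (g′ xor h′))
  insert = solve 5 (λ u g g′ h h′ → (g :+ g′) :+ (h :+ h′) := (u :+ (g :+ h)) :+ (u :+ (g′ :+ h′))) refl

-- Degree parity and the cycle space as an orthogonal complement

≡?-suc : ∀ {n} (i j : Fin n) → [ suc i ≡? suc j ] ≡ [ i ≡? j ]
≡?-suc i j with i ≟ j
... | yes _ = refl
... | no  _ = refl

≡?-refl : ∀ {n} (i : Fin n) → [ i ≡? i ] ≡ 1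
≡?-refl i with i ≟ i
... | yes _ = refl
... | no ¬p = contradiction refl ¬p

∑-point : ∀ {n} (h : Fin n → Bool) i → ∑ (λ j → h j ∧ odd [ i ≡? j ]) ≡ h i
∑-point {suc n} h zero    = trans (∑-suc _) (trans
  (cong₂ _xor_ (∧-identityʳ (h zero)) (∑-false λ j → ∧-zeroʳ (h (suc j)))) (xor-identityʳ (h zero)))
∑-point {suc n} h (suc i) = trans (∑-suc _) (trans
  (cong₂ _xor_ (∧-zeroʳ (h zero)) (∑-cong λ j → cong (λ m → h (suc j) ∧ odd m) (≡?-suc i j)))
  (∑-point (h ∘ suc) i))

point : ∀ {n} → Fin n → Subset n
point j = tabulate λ i → odd [ i ≡? j ]

lookup-combination-tabulate : ∀ {k m} (cs : Subset k) (As : Fin k → Subset m) e →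
                              lookup (combination cs (tabulate As)) e ≡ ∑ λ i → lookup cs i ∧ lookup (As i) e
lookup-combination-tabulate cs As e = trans (lookup-combination cs (tabulate As) e)
  (∑-cong λ i → cong (λ A → lookup cs i ∧ lookup A e) (lookup∘tabulate As i))

combination-points : ∀ {n} (U : Subset n) → combination U (tabulate point) ≡ U
combination-points U = lookup-ext λ i → trans (lookup-combination-tabulate U point i)
  (trans (∑-cong λ j → cong (lookup U j ∧_) (lookup∘tabulate _ i)) (∑-point (lookup U) i))

-- The parity of a degree is the pairing with the star of the vertex: a loop adds 2 to the degree
-- and is absent from the star. Stars span the coboundary space, so even degrees mean orthogonality
-- to all cuts.
odd-degreeIn : ∀ G A w → odd (degreeIn G A w) ≡ dot A (coboundary G (point w))
odd-degreeIn G A w = trans (odd-sum {#E G} _) (trans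
  (∑-cong λ e → let x , y = ends G e in trans (summand (lookup A e) [ x ≡? w ] [ y ≡? w ])
    (cong (lookup A e ∧_) (sym (cong₂ _xor_ (lookup∘tabulate _ x) (lookup∘tabulate _ y)))))
  (sym (dot-tabulateʳ A _)))
  where
  summand : ∀ b i j → odd (if b then i ℕ.+ j else 0) ≡ b ∧ (odd i xor odd j)
  summand false i j = refl
  summand true  i j = odd-+ i j

cycle⇒ᗮ : ∀ G A → CycleSpace G A → (CoboundarySpace G ᗮ) A
cycle⇒ᗮ G A cyc B (U , refl) = dot⇒⟨⟩≡0 A (coboundary G U) (trans (dot-comm A _) (span-⊥ᗮ
  (Vec.map (coboundary G) (tabulate point))
  (λ w → trans (cong (λ X → dot X A) (trans (Vec.lookup-map w (coboundary G) (tabulate point)) (cong (coboundary G) (lookup∘tabulate point w))))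
    (trans (dot-comm _ A) (trans (sym (odd-degreeIn G A w)) (2∣⇒even (cyc w)))))
  (U , trans (sym (additive-combination (coboundary-⊕ G) U (tabulate point))) (cong (coboundary G) (combination-points U)))))

ᗮ⇒cycle : ∀ G A → (CoboundarySpace G ᗮ) A → CycleSpace G A
ᗮ⇒cycle G A A∈ w = even⇒2∣ _ (trans (odd-degreeIn G A w)
  (⟨⟩≡0⇒dot A _ (A∈ _ (point w , refl))))

-- Richness of the dual and the phial, and bicycles

-- The cycle condition is a sum over the four corners of a square, and passing to the dual or the
-- phial only permutes the corners and the roles of `u`, `g`, `h`. The work lies in the fact that z
-- is v∘f here and f∘v in the dual, which agree only pointwise.
split-dual : ∀ M → AllCyclesSplit M → AllCyclesSplit (dual M)
split-dual M split k (k-a , cyc) =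
  let u , g , h , u-inv , g-inv , (h-z , h-a) , k≡ = split k (k-a , λ x → trans
        (trans (xor-interchange (k x) (k (v M x)) (k (f M x)) (k (z M x)))
               (cong (λ y → (k x xor k (f M x)) xor (k (v M x) xor k y)) (square M x)))
        (cyc x))
  in g , u , h , g-inv , u-inv , ((λ x → trans (cong h (sym (square M x))) (h-z x)) , h-a) ,
     λ x → trans (k≡ x) (rotate (u x) (g x) (h x))
  where
  open xor-∧-Solver

  rotate : ∀ u g h → u xor (g xor h) ≡ g xor (u xor h)
  rotate = solve 3 (λ u g h → u :+ (g :+ h) := g :+ (u :+ h)) refl

split-phial : ∀ M → AllCyclesSplit M → AllCyclesSplit (phial M)
split-phial M split k (k-a , cyc) =
  let u , g , h , (u-v , u-a) , g-inv , h-inv , k≡ = split k (k-a , λ x → trans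
        (trans (regroup (k x) (k (v M x)) (k (f M x)) (k (z M x))) (cong (λ y → (k x xor k (z M x)) xor (k (f M x) xor k y)) (sym (zv M x))))
        (cyc x))
  in h , g , u , h-inv , g-inv , ((λ x → trans (cong u (zv M x)) (u-v x)) , u-a) ,
     λ x → trans (k≡ x) (rotate (u x) (g x) (h x))
  where
  open xor-∧-Solver

  regroup : ∀ a b c d → (a xor b) xor (c xor d) ≡ (a xor d) xor (c xor b)
  regroup = solve 4 (λ a b c d → (a :+ b) :+ (c :+ d) := (a :+ d) :+ (c :+ b)) refl

  rotate : ∀ u g h → u xor (g xor h) ≡ h xor (g xor u)
  rotate = solve 3 (λ u g h → u :+ (g :+ h) := h :+ (g :+ u)) refl

-- In this and the next two inclusions the gons are the same on both sides. What may change is the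
-- matching across which a jump is measured, and two such matchings differ by one under which the
-- function is invariant.
zspace-dual⊆ : ∀ M → ZSpace (dual M) ⊆ₚ ZSpace M
zspace-dual⊆ M {A} A∈ = from-δ (vspace⇒δ (phial (dual M)) A∈)
  where
  from-δ : ∃[ h ] VGonal (phial (dual M)) h × δ (phial (dual M)) h ≡ A → ZSpace M A
  from-δ (h , (h-z , h-a) , e) = subst (ZSpace M)
    (trans (tabulate-cong λ s → cong (h (rep (SQ M) s) xor_) (sym (phial-v M h-z′ (rep (SQ M) s)))) e)
    (δ⇒vspace (phial M) (h-z′ , h-a))
    where
    h-z′ : Inv (z M) h
    h-z′ x = trans (cong h (square M x)) (h-z x)

fspace-phial⊆ : ∀ M → FSpace (phial M) ⊆ₚ FSpace M
fspace-phial⊆ M {A} A∈ = from-δ (vspace⇒δ (dual (phial M)) A∈)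
  where
  from-δ : ∃[ g ] VGonal (dual (phial M)) g × δ (dual (phial M)) g ≡ A → FSpace M A
  from-δ (g , (g-f , g-a) , e) = subst (FSpace M)
    (trans (tabulate-cong λ s → cong (g (rep (SQ M) s) xor_)
      (sym (trans (cong g (square M (rep (SQ M) s))) (g-f (v M (rep (SQ M) s)))))) e)
    (δ⇒vspace (dual M) (g-f , g-a))

zspace-phial⊆ : ∀ M → ZSpace (phial M) ⊆ₚ VSpace M
zspace-phial⊆ M {A} A∈ = from-δ (vspace⇒δ (phial (phial M)) A∈)
  where
  from-δ : ∃[ u ] VGonal (phial (phial M)) u × δ (phial (phial M)) u ≡ A → VSpace M A
  from-δ (u , (u-zf , u-a) , e) =
    subst (VSpace M) e (δ⇒vspace M ((λ x → trans (cong u (sym (zv M x))) (u-zf x)) , u-a))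

rich-dual : ∀ M → Rich M → Rich (dual M)
rich-dual M rich = split⇒rich (dual M) (split-dual M (rich⇒split M rich))

rich-phial : ∀ M → Rich M → Rich (phial M)
rich-phial M rich = split⇒rich (phial M) (split-phial M (rich⇒split M rich))

+ₛ-mono : ∀ {m} {U U′ W W′ : Pred (Subset m) 0ℓ} → U ⊆ₚ U′ → W ⊆ₚ W′ → (U +ₛ W) ⊆ₚ (U′ +ₛ W′)
+ₛ-mono U⊆ W⊆ (B , C , B∈ , C∈ , e) = B , C , U⊆ B∈ , W⊆ C∈ , e

ᗮ-sym : ∀ {m} {U W : Pred (Subset m) 0ℓ} → U ⊆ₚ (W ᗮ) → W ⊆ₚ (U ᗮ)
ᗮ-sym U⊥W {B} B∈ A A∈ = dot⇒⟨⟩≡0 B A (trans (dot-comm B A) (⟨⟩≡0⇒dot A B (U⊥W A∈ B B∈)))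

-- A vector orthogonal to U and W is orthogonal to U + W, hence to the complement of X, and X is its
-- own double complement.
⊥-sum⇒∈ : ∀ {m} {U W X : Pred (Subset m) 0ℓ} {d} → HasDim X d → (X ᗮ) ⊆ₚ (U +ₛ W) →
          ∀ {A} → (U ᗮ) A → (W ᗮ) A → X A
⊥-sum⇒∈ {U = U} {W} {X} dim Xᗮ⊆ {A} A⊥U A⊥W = ᗮᗮ-⊆ dim λ B B∈ → perp B (Xᗮ⊆ {B} B∈)
  where
  perp : ∀ B → (U +ₛ W) B → ⟨ A , B ⟩ ≡ 0
  perp B (C , D , C∈ , D∈ , refl) = dot⇒⟨⟩≡0 A (C ⊕ D) (trans (dot-⊕ʳ A C D)
    (cong₂ _xor_ (⟨⟩≡0⇒dot A C (A⊥U C C∈)) (⟨⟩≡0⇒dot A D (A⊥W D D∈))))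

rich⇒∈f : ∀ M → Rich M → ∀ {A} → (VSpace M ᗮ) A → (ZSpace M ᗮ) A → FSpace M A
rich⇒∈f M rich = ⊥-sum⇒∈ {U = VSpace M} {ZSpace M} (proj₂ (vspace-dim (dual M)))
  (λ {B} B∈ → +ₛ-mono {W = ZSpace (dual M)} (λ p → p) (zspace-dual⊆ M) (rich⇒vᗮ⊆f+z (dual M) (rich-dual M rich) {B} B∈))

phial-rich⇒∈z : ∀ M → Rich (phial M) → ∀ {A} → (FSpace M ᗮ) A → (VSpace M ᗮ) A → ZSpace M A
phial-rich⇒∈z M rich = ⊥-sum⇒∈ {U = FSpace M} {VSpace M} (proj₂ (vspace-dim (phial M)))
  (λ {B} B∈ → +ₛ-mono {U = FSpace (phial M)} {W = ZSpace (phial M)} (fspace-phial⊆ M) (zspace-phial⊆ M) (rich⇒vᗮ⊆f+z (phial M) rich {B} B∈))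

bicycle⊆f∩z : ∀ M → Rich M → BicycleSpace (𝔾 M) ⊆ₚ (FSpace M ∩ₚ ZSpace M)
bicycle⊆f∩z M rich {A} (cyc , A∈V) =
  rich⇒∈f M rich {A} (cycle⇒ᗮ (𝔾 M) A cyc) (ᗮ-sym {U = ZSpace M} (z⊆vᗮ M) A∈V) ,
  phial-rich⇒∈z M (rich-phial M rich) {A} (ᗮ-sym {U = FSpace M} (f⊆vᗮ M) A∈V) (cycle⇒ᗮ (𝔾 M) A cyc)

-- If δ g = δ h, then g + h is constant on the v-edges, and it has the same coboundary.
f∩z⊆bicycle : ∀ M → (FSpace M ∩ₚ ZSpace M) ⊆ₚ BicycleSpace (𝔾 M)
f∩z⊆bicycle M {A} (A∈F , A∈Z) =
  ᗮ⇒cycle (𝔾 M) A (f⊆vᗮ M A∈F) , absorb (vspace⇒δ (dual M) A∈F) (vspace⇒δ (phial M) A∈Z)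
  where
  open xor-∧-Solver

  regroup : ∀ g h g′ h′ → (g′ xor h′) xor (g xor h) ≡ (g xor g′) xor (h xor h′)
  regroup = solve 4 (λ g h g′ h′ → (g′ :+ h′) :+ (g :+ h) := (g :+ g′) :+ (h :+ h′)) refl

  drop-g : ∀ g h h′ → (g xor h) xor (g xor h′) ≡ h xor h′
  drop-g = solve 3 (λ g h h′ → (g :+ h) :+ (g :+ h′) := h :+ h′) refl

  absorb : ∃[ g ] VGonal (dual M) g × δ (dual M) g ≡ A → ∃[ h ] VGonal (phial M) h × δ (phial M) h ≡ A → VSpace M A
  absorb (g , g-inv@(g-f , g-a) , e) (h , h-inv@(h-z , h-a) , e′) = subst (VSpace M)
    (trans (tabulate-cong λ s → let x = rep (SQ M) s in
       trans (cong (λ b → (g x xor h x) xor (b xor h (f M x))) (g-f x)) (drop-g (g x) (h x) (h (f M x)))) e′)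
    (δ⇒vspace M {λ x → g x xor h x} (u-v , λ x → cong₂ _xor_ (g-a x) (h-a x)))
    where
    u-v : Inv (v M) (λ x → g x xor h x)
    u-v x = xor-cancel (trans (regroup (g x) (h x) (g (v M x)) (h (v M x))) (trans
      (cong₂ _xor_ (trans (sym (lookup-δ-dual M g-inv x)) (cong (λ X → lookup X (class (SQ M) x)) e))
                   (trans (sym (lookup-δ-phial M h-inv x)) (cong (λ X → lookup X (class (SQ M) x)) e′)))
      (xor-same (lookup A (class (SQ M) x)))))

-- Orientability of the phial

≢⇒not : ∀ {b c : Bool} → b ≢ c → b ≡ not c
≢⇒not {false} {false} p = contradiction refl p
≢⇒not {false} {true}  p = refl
≢⇒not {true}  {false} p = refl
≢⇒not {true}  {true}  p = contradiction refl p

not⇒≢ : ∀ {b c : Bool} → b ≡ not c → b ≢ c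
not⇒≢ {c = false} refl ()
not⇒≢ {c = true}  refl ()

xor-not : ∀ b → b xor not b ≡ true
xor-not false = refl
xor-not true  = refl

-- If `s` and `t` are both complemented by p, their sum is p-invariant and (s + t) · u cancels in
-- pairs. Hence a function alternating along a can be exchanged for any other one, however they
-- behave on the squares.
∑-flip : ∀ {n} {p : Fin n → Fin n} → IsMatching p → ∀ {s t u : Fin n → Bool} →
         (∀ x → s (p x) ≡ not (s x)) → (∀ x → t (p x) ≡ not (t x)) → Inv p u →
         ∑ (λ x → s x ∧ u x) ≡ ∑ (λ x → t x ∧ u x)
∑-flip mp {s} {t} {u} s-p t-p u-p = xor-cancel (trans (sym (∑-xor _ _)) (∑-matching mp _ λ x →
  cong₂ _xor_ (cong₂ _∧_ (s-p x) (u-p x)) (cong₂ _∧_ (t-p x) (u-p x)) ⟨ trans ⟩ double-not (s x) (t x) (u x)))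
  where
  double-not : ∀ s t u → (not s ∧ u) xor (not t ∧ u) ≡ (s ∧ u) xor (t ∧ u)
  double-not false false u = xor-same u
  double-not false true  u = xor-identityʳ u
  double-not true  false u = sym (xor-identityʳ u)
  double-not true  true  u = sym (xor-same u)

lookup-⊤ : ∀ {m} (i : Fin m) → lookup ⊤ i ≡ true
lookup-⊤ i = lookup-replicate i true

-- A v-edge amounts to an f-edge followed by a z-edge, so a bipartition of the phial does not jump
-- across v-edges, while a function alternating on the v-gons jumps across all of them. Both
-- alternate along a; by `∑-flip` the full set of squares therefore pairs with V like the empty set.
orientable-phial⇒eulerian : ∀ M → Orientable (phial M) → Eulerian (𝔾 M)
orientable-phial⇒eulerian M (side , flips) = ᗮ⇒cycle (𝔾 M) ⊤ (dot⇒ᗮ M ⊤ λ {u} → ⊤⊥ {u})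
  where
  side-v : Inv (v M) side
  side-v x = begin
    side (v M x)        ≡⟨ cong side (zv M x) ⟨
    side (z M (f M x))  ≡⟨ ≢⇒not (proj₁ (flips (f M x))) ⟩
    not (side (f M x))  ≡⟨ cong not (≢⇒not (proj₁ (proj₂ (flips x)))) ⟩
    not (not (side x))  ≡⟨ not-involutive (side x) ⟩
    side x              ∎

  s : ∃[ s ] (∀ x → s (v M x) ≡ not (s x)) × (∀ x → s (a M x) ≡ not (s x))
  s = flipper (v-matching M) (a-matching M)

  ⊤⊥ : ∀ {u} → VGonal M u → dot ⊤ (δ M u) ≡ false
  ⊤⊥ {u} (u-v , u-a) = begin
    dot ⊤ (δ M u)
      ≡⟨ pairing-δ M {u} {proj₁ s} {⊤} u-v (λ x → trans (cong (proj₁ s x xor_) (proj₁ (proj₂ s) x))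
           (trans (xor-not (proj₁ s x)) (sym (lookup-⊤ (class (SQ M) x))))) ⟨
    ∑ (λ x → proj₁ s x ∧ u x)
      ≡⟨ ∑-flip (a-matching M) (proj₂ (proj₂ s)) (λ x → ≢⇒not (proj₂ (proj₂ (flips x)))) u-a ⟩
    ∑ (λ x → side x ∧ u x)
      ≡⟨ pairing-δ M {u} {side} {⊥} u-v (λ x → trans (cong (side x xor_) (side-v x))
           (trans (xor-same (side x)) (sym (lookup-⊥ (class (SQ M) x))))) ⟩
    dot ⊥ (δ M u)
      ≡⟨ dot-⊥ˡ (δ M u) ⟩
    false ∎

-- Colour the (z,a)-gons alternately.  The squares on which f fails to change
-- the colour form a set orthogonal to F and V, hence in Z, so that switching
-- the colouring on some (z,a)-gons repairs them.
rich-eulerian⇒orientable : ∀ M → Rich (phial M) → Eulerian (𝔾 M) → Orientable (phial M)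
rich-eulerian⇒orientable M rich eulerian = orient (vspace⇒δ (phial M) bad∈Z)
  where
  s : ∃[ s ] (∀ x → s (z M x) ≡ not (s x)) × (∀ x → s (a M x) ≡ not (s x))
  s = flipper (z-matching M) (a-matching M)

  σ : Fin (#C M) → Bool
  σ = proj₁ s

  σ-z : ∀ x → σ (z M x) ≡ not (σ x)
  σ-z = proj₁ (proj₂ s)

  σ-a : ∀ x → σ (a M x) ≡ not (σ x)
  σ-a = proj₂ (proj₂ s)

  σ-v : ∀ x → σ (v M x) ≡ not (σ (f M x))
  σ-v x = trans (cong σ (sym (zv M x))) (σ-z (f M x))

  e : Fin (#C M) → Bool
  e x = σ x xor σ (v M x)

  bad : Subset (size (SQ M))
  bad = squareSet M e

  lookup-bad : ∀ x → σ x xor σ (v M x) ≡ lookup bad (class (SQ M) x)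
  lookup-bad x = sym (lookup-squareSet M
    (λ x → trans (cong (σ (v M x) xor_) (cong σ (involutive (v-matching M) x))) (xor-comm _ (σ x)))
    (λ x → begin
      σ (f M x) xor σ (z M x)            ≡⟨ cong (σ (f M x) xor_) (σ-z x) ⟩
      σ (f M x) xor not (σ x)            ≡⟨ not-distribʳ-xor (σ (f M x)) (σ x) ⟨
      not (σ (f M x) xor σ x)            ≡⟨ not-distribˡ-xor (σ (f M x)) (σ x) ⟩
      not (σ (f M x)) xor σ x            ≡⟨ cong (_xor σ x) (σ-v x) ⟨
      σ (v M x) xor σ x                  ≡⟨ xor-comm _ (σ x) ⟩
      σ x xor σ (v M x)                  ∎) x)

  -- Both `σ` and `t` alternate along a, so `bad` pairs with V like the full set of squares, which
  -- is orthogonal to V because G_M is eulerian.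
  bad⊥V : (VSpace M ᗮ) bad
  bad⊥V = dot⇒ᗮ M bad λ {u} (u-v , u-a) → begin
    dot bad (δ M u)                ≡⟨ pairing-δ M {u} {σ} {bad} u-v lookup-bad ⟨
    ∑ (λ x → σ x ∧ u x)            ≡⟨ ∑-flip (a-matching M) σ-a (proj₂ (proj₂ t)) u-a ⟩
    ∑ (λ x → proj₁ t x ∧ u x)      ≡⟨ pairing-δ M {u} {proj₁ t} {⊤} u-v (λ x →
                                        trans (cong (proj₁ t x xor_) (proj₁ (proj₂ t) x))
                                        (trans (xor-not (proj₁ t x)) (sym (lookup-⊤ (class (SQ M) x))))) ⟩
    dot ⊤ (δ M u)                  ≡⟨ ᗮ⇒dot M ⊤ (cycle⇒ᗮ (𝔾 M) ⊤ eulerian) (u-v , u-a) ⟩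
    false                          ∎
    where
    t : ∃[ t ] (∀ x → t (v M x) ≡ not (t x)) × (∀ x → t (a M x) ≡ not (t x))
    t = flipper (v-matching M) (a-matching M)

  -- By `σ-v`, the squares on which `σ` jumps across f-edges form the complement of `bad`. That
  -- complement pairs with F like the full set, so the difference `bad` pairs to zero.
  bad⊥F : (FSpace M ᗮ) bad
  bad⊥F = dot⇒ᗮ (dual M) bad λ {u} (u-f , u-a) → xor-cancel′ (begin
    dot (bad ⊕ ⊤) (δ (dual M) u)   ≡⟨ pairing-δ (dual M) {u} {σ} {bad ⊕ ⊤} u-f (λ x → trans
                                        (trans (double-not (σ x) (σ (f M x))) (cong (λ b → not (σ x xor b)) (sym (σ-v x))))
                                        (trans (cong not (lookup-bad x)) (sym (lookup-complement bad (class (SQ M) x))))) ⟨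
    ∑ (λ x → σ x ∧ u x)            ≡⟨ ∑-flip (a-matching M) σ-a (proj₂ (proj₂ t)) u-a ⟩
    ∑ (λ x → proj₁ t x ∧ u x)      ≡⟨ pairing-δ (dual M) {u} {proj₁ t} {⊤} u-f (λ x →
                                        trans (cong (proj₁ t x xor_) (proj₁ (proj₂ t) x))
                                        (trans (xor-not (proj₁ t x)) (sym (lookup-⊤ (class (SQ M) x))))) ⟩
    dot ⊤ (δ (dual M) u)           ∎) (dot-⊕ˡ bad ⊤ (δ (dual M) u))
    where
    t : ∃[ t ] (∀ x → t (f M x) ≡ not (t x)) × (∀ x → t (a M x) ≡ not (t x))
    t = flipper (f-matching M) (a-matching M)

    double-not : ∀ b c → b xor c ≡ not (b xor not c)
    double-not b c = trans (cong (b xor_) (sym (not-involutive c))) (sym (not-distribʳ-xor b (not c)))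

    lookup-complement : ∀ {m} (A : Subset m) i → lookup (A ⊕ ⊤) i ≡ not (lookup A i)
    lookup-complement A i = trans (lookup-⊕ A ⊤ i) (trans (cong (lookup A i xor_) (lookup-⊤ i)) (xor-comm (lookup A i) true))

    xor-cancel′ : ∀ {b c d} → d ≡ c → d ≡ b xor c → b ≡ false
    xor-cancel′ {false} _ _ = refl
    xor-cancel′ {true} {false} refl ()
    xor-cancel′ {true} {true} refl ()

  bad∈Z : ZSpace M bad
  bad∈Z = phial-rich⇒∈z M rich {bad} bad⊥F bad⊥V

  orient : ∃[ h ] VGonal (phial M) h × δ (phial M) h ≡ bad → Orientable (phial M)
  orient (h , h-inv@(h-z , h-a) , p) = (λ x → σ x xor h x) , λ x →
    not⇒≢ (trans (cong₂ _xor_ (σ-z x) (h-z x)) (sym (not-distribˡ-xor (σ x) (h x)))) ,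
    not⇒≢ (repaired (σ x) (h x) (σ (f M x)) (h (f M x)) (begin
      h x xor h (f M x)                    ≡⟨ lookup-δ (phial M) h-z x ⟨
      lookup (δ (phial M) h) (class (SQ M) x) ≡⟨ cong (λ X → lookup X (class (SQ M) x)) p ⟩
      lookup bad (class (SQ M) x)          ≡⟨ lookup-bad x ⟨
      σ x xor σ (v M x)                    ≡⟨ cong (σ x xor_) (σ-v x) ⟩
      σ x xor not (σ (f M x))              ∎)) ,
    not⇒≢ (trans (cong₂ _xor_ (σ-a x) (h-a x)) (sym (not-distribˡ-xor (σ x) (h x))))
    where
    repaired : ∀ s h s′ h′ → h xor h′ ≡ s xor not s′ → s′ xor h′ ≡ not (s xor h)
    repaired false false false false ()
    repaired false false false true  _ = refl
    repaired false false true  false _ = refl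
    repaired false false true  true  ()
    repaired false true  false false _ = refl
    repaired false true  false true  ()
    repaired false true  true  false ()
    repaired false true  true  true  _ = refl
    repaired true  false false false _ = refl
    repaired true  false false true  ()
    repaired true  false true  false ()
    repaired true  false true  true  _ = refl
    repaired true  true  false false ()
    repaired true  true  false true  _ = refl
    repaired true  true  true  false _ = refl
    repaired true  true  true  true  ()

-- Bijections between orbit sets, and isomorphisms of graphs

module _ {n m : ℕ} {R : Rel (Fin n) 0ℓ} {S : Rel (Fin m) 0ℓ} (P : Classes R) (Q : Classes S)
         (φ : Fin n → Fin m) (ψ : Fin m → Fin n)
         (φ-resp : ∀ {x y} → class P x ≡ class P y → class Q (φ x) ≡ class Q (φ y))
         (ψ-resp : ∀ {x y} → class Q x ≡ class Q y → class P (ψ x) ≡ class P (ψ y))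
         (ψφ : ∀ x → class P (ψ (φ x)) ≡ class P x) (φψ : ∀ x → class Q (φ (ψ x)) ≡ class Q x) where

  classes↔ : Fin (size P) ↔ Fin (size Q)
  classes↔ = mk↔ₛ′ (λ c → class Q (φ (rep P c))) (λ d → class P (ψ (rep Q d)))
    (λ d → trans (φ-resp (class-rep P _)) (trans (φψ (rep Q d)) (class-rep Q d)))
    (λ c → trans (ψ-resp (class-rep Q _)) (trans (ψφ (rep P c)) (class-rep P c)))

  classes↔-class : ∀ x → Inverse.to classes↔ (class P x) ≡ class Q (φ x)
  classes↔-class x = φ-resp (class-rep P (class P x))

↔⇒≡ : ∀ {m n} → Fin m ↔ Fin n → m ≡ n
↔⇒≡ π = ℕ.≤-antisym (injective⇒≤ (Injection.injective (↔⇒↣ π))) (injective⇒≤ (Injection.injective (↔⇒↣ (↔-sym π))))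

≅-sym : ∀ {G H} → G ≅ H → H ≅ G
≅-sym {G} {H} i = record { V↔ = ↔-sym V↔ ; E↔ = ↔-sym E↔ ; ends-≅ = λ e → back e (ends-≅ (Inverse.from E↔ e)) }
  where
  open _≅_ i

  unmap : Fin (#V H) × Fin (#V H) → Fin (#V G) × Fin (#V G)
  unmap = Product.map (Inverse.from V↔) (Inverse.from V↔)

  unmap-map : ∀ p → unmap (mapEnds p) ≡ p
  unmap-map (x , y) = cong₂ _,_ (Inverse.strictlyInverseʳ V↔ x) (Inverse.strictlyInverseʳ V↔ y)

  back : ∀ e → ends H (Inverse.to E↔ (Inverse.from E↔ e)) ≡ mapEnds (ends G (Inverse.from E↔ e))
             ⊎ ends H (Inverse.to E↔ (Inverse.from E↔ e)) ≡ swap (mapEnds (ends G (Inverse.from E↔ e))) →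
         ends G (Inverse.from E↔ e) ≡ unmap (ends H e) ⊎ ends G (Inverse.from E↔ e) ≡ swap (unmap (ends H e))
  back e (inj₁ p) = inj₁ (sym (trans (cong unmap (trans (sym (cong (ends H) (Inverse.strictlyInverseˡ E↔ e))) p)) (unmap-map _)))
  back e (inj₂ p) = inj₂ (sym (trans (cong (swap ∘ unmap) (trans (sym (cong (ends H) (Inverse.strictlyInverseˡ E↔ e))) p)) (unmap-map _)))

≅-trans : ∀ {G H K} → G ≅ H → H ≅ K → G ≅ K
≅-trans {G} {H} {K} i j = record
  { V↔ = ↔-trans I.V↔ J.V↔ ; E↔ = ↔-trans I.E↔ J.E↔
  ; ends-≅ = λ e → compose (I.ends-≅ e) (J.ends-≅ (Inverse.to I.E↔ e)) }
  where
  module I = _≅_ i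
  module J = _≅_ j

  compose : ∀ {p q r} → q ≡ I.mapEnds p ⊎ q ≡ swap (I.mapEnds p) → r ≡ J.mapEnds q ⊎ r ≡ swap (J.mapEnds q) →
            r ≡ J.mapEnds (I.mapEnds p) ⊎ r ≡ swap (J.mapEnds (I.mapEnds p))
  compose (inj₁ refl) (inj₁ refl) = inj₁ refl
  compose (inj₁ refl) (inj₂ refl) = inj₂ refl
  compose (inj₂ refl) (inj₁ refl) = inj₂ refl
  compose (inj₂ refl) (inj₂ refl) = inj₁ refl

-- Medial graphs

-- The flags of T are the pairs (x , b): the flag lies on an (f,a)-gon if b is
-- false and on a (z,a)-gon if b is true.
record IsMedial {n : ℕ} (f z a : Fin n → Fin n) (T : TMap) : Set where
  field
    ι    : Fin n → Bool → Fin (#flags T)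
    π    : Fin (#flags T) → Fin n
    side : Fin (#flags T) → Bool
    ι-π    : ∀ y → ι (π y) (side y) ≡ y
    π-ι    : ∀ x b → π (ι x b) ≡ x
    side-ι : ∀ x b → side (ι x b) ≡ b

  turn : Bool → Fin n → Fin n
  turn b = if b then z else f

  field
    θ₀-ι : ∀ x b → θ₀ T (ι x b) ≡ ι (a x) b
    θ₁-ι : ∀ x b → θ₁ T (ι x b) ≡ ι (turn b x) b
    θ₂-ι : ∀ x b → θ₂ T (ι x b) ≡ ι x (not b)

  π-θ₀ : ∀ y → π (θ₀ T y) ≡ a (π y)
  π-θ₀ y = trans (cong (π ∘ θ₀ T) (sym (ι-π y))) (trans (cong π (θ₀-ι _ _)) (π-ι _ _))

  π-θ₁ : ∀ y → π (θ₁ T y) ≡ turn (side y) (π y)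
  π-θ₁ y = trans (cong (π ∘ θ₁ T) (sym (ι-π y))) (trans (cong π (θ₁-ι _ _)) (π-ι _ _))

  π-θ₂ : ∀ y → π (θ₂ T y) ≡ π y
  π-θ₂ y = trans (cong (π ∘ θ₂ T) (sym (ι-π y))) (trans (cong π (θ₂-ι _ _)) (π-ι _ _))

  side-θ₀ : ∀ y → side (θ₀ T y) ≡ side y
  side-θ₀ y = trans (cong (side ∘ θ₀ T) (sym (ι-π y))) (trans (cong side (θ₀-ι _ _)) (side-ι _ _))

  side-θ₁ : ∀ y → side (θ₁ T y) ≡ side y
  side-θ₁ y = trans (cong (side ∘ θ₁ T) (sym (ι-π y))) (trans (cong side (θ₁-ι _ _)) (side-ι _ _))

  side-θ₂ : ∀ y → side (θ₂ T y) ≡ not (side y)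
  side-θ₂ y = trans (cong (side ∘ θ₂ T) (sym (ι-π y))) (trans (cong side (θ₂-ι _ _)) (side-ι _ _))

  private
    ι-matching : ∀ b {θ : Fin (#flags T) → Fin (#flags T)} {p} → IsMatching θ → (∀ x → θ (ι x b) ≡ ι (p x) b) → IsMatching p
    ι-matching b {θ} {p} mθ θ-ι = record
      { involutive = λ x → trans (sym (π-ι _ b)) (trans (cong π (trans (sym (θ-ι (p x)))
          (trans (cong θ (sym (θ-ι x))) (involutive mθ (ι x b))))) (π-ι x b))
      ; no-fixed = λ x e → no-fixed mθ (ι x b) (trans (θ-ι x) (cong (λ y → ι y b) e)) }

  a-isMatching : IsMatching a
  a-isMatching = ι-matching false (θ₀-matching T) (λ x → θ₀-ι x false)

  f-isMatching : IsMatching f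
  f-isMatching = ι-matching false (θ₁-matching T) (λ x → θ₁-ι x false)

  z-isMatching : IsMatching z
  z-isMatching = ι-matching true (θ₁-matching T) (λ x → θ₁-ι x true)

  module _ {A : Set} {h : Fin (#flags T) → A} where

    via-θ₀ : Inv (θ₀ T) h → ∀ b → Inv a (λ x → h (ι x b))
    via-θ₀ inv b x = trans (cong h (sym (θ₀-ι x b))) (inv (ι x b))

    via-θ₁ : Inv (θ₁ T) h → ∀ b → Inv (turn b) (λ x → h (ι x b))
    via-θ₁ inv b x = trans (cong h (sym (θ₁-ι x b))) (inv (ι x b))

    via-θ₂ : Inv (θ₂ T) h → ∀ x b c → h (ι x b) ≡ h (ι x c)
    via-θ₂ inv x false false = refl
    via-θ₂ inv x false true  = trans (sym (inv (ι x false))) (cong h (θ₂-ι x false))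
    via-θ₂ inv x true  false = trans (sym (inv (ι x true))) (cong h (θ₂-ι x true))
    via-θ₂ inv x true  true  = refl

    via-π : Inv (θ₂ T) h → ∀ y → h (ι (π y) false) ≡ h y
    via-π inv y = trans (via-θ₂ inv (π y) false (side y)) (cong h (ι-π y))

  vertexOf : Fin n → Fin (size (vertices T))
  vertexOf x = class (vertices T) (ι x false)

  vertexOf-π : ∀ y → vertexOf (π y) ≡ class (vertices T) y
  vertexOf-π = via-π (class-step (vertices T) (there (here refl)))

  vertexOf-f : Inv f vertexOf
  vertexOf-f = via-θ₁ (class-step (vertices T) (here refl)) false

  vertexOf-z : Inv z vertexOf
  vertexOf-z x = trans (via-θ₂ θ₂-inv (z x) false true)
    (trans (via-θ₁ (class-step (vertices T) (here refl)) true x) (via-θ₂ θ₂-inv x true false))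
    where
    θ₂-inv : Inv (θ₂ T) (class (vertices T))
    θ₂-inv = class-step (vertices T) (there (here refl))

  -- An element of Fin n stands for an edge-end of the 4-regular graph, that is, for two flags
  -- related by θ₂. An edge is then a pair {x, a x}, which is why `edgeFibre` has two entries.
  edgeOf : Fin n → Fin (size (edges T))
  edgeOf x = class (edges T) (ι x false)

  edgeOf-π : ∀ y → edgeOf (π y) ≡ class (edges T) y
  edgeOf-π = via-π (class-step (edges T) (there (here refl)))

  edgeOf-a : Inv a edgeOf
  edgeOf-a = via-θ₀ (class-step (edges T) (here refl)) false

  edgeRep : Fin (size (edges T)) → Fin n
  edgeRep e = π (rep (edges T) e)

  edgeOf-rep : ∀ e → edgeOf (edgeRep e) ≡ e
  edgeOf-rep e = trans (edgeOf-π _) (class-rep (edges T) e)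

  edgeFibre : Fin (size (edges T)) → List (Fin n)
  edgeFibre e = edgeRep e ∷ a (edgeRep e) ∷ []

  edgeFibre-unique : ∀ e → Unique (edgeFibre e)
  edgeFibre-unique e = ((no-fixed a-isMatching _ ∘ sym) ∷ []) ∷ [] ∷ []

  ∈-edgeFibre : ∀ {x e} → edgeOf x ≡ e → x ∈ edgeFibre e
  ∈-edgeFibre {x} refl = subst (_∈ edgeFibre (edgeOf x)) (π-ι x false)
    (orbit-closed (λ y → π y ∈ edgeFibre (edgeOf x))
      (λ { (here refl) → involutive (θ₀-matching T) ; (there (here refl)) → involutive (θ₂-matching T) })
      (λ { (here refl) {y} y∈ → subst (_∈ edgeFibre (edgeOf x)) (sym (π-θ₀ y)) (a-closed y∈)
         ; (there (here refl)) {y} y∈ → subst (_∈ edgeFibre (edgeOf x)) (sym (π-θ₂ y)) y∈ })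
      (rep∼ (edges T) (ι x false)) (here refl))
    where
    a-closed : ∀ {e y} → y ∈ edgeFibre e → a y ∈ edgeFibre e
    a-closed (here refl) = there (here refl)
    a-closed (there (here refl)) = here (involutive a-isMatching _)

  edgeFibre-class : ∀ {x e} → x ∈ edgeFibre e → edgeOf x ≡ e
  edgeFibre-class {e = e} (here refl) = edgeOf-rep e
  edgeFibre-class {e = e} (there (here refl)) = trans (edgeOf-a _) (edgeOf-rep e)

  ends-rep : ∀ e → ends (underlying T) e ≡ (vertexOf (edgeRep e) , vertexOf (a (edgeRep e)))
  ends-rep e = cong₂ _,_ (sym (vertexOf-π _))
    (trans (sym (vertexOf-π _)) (cong vertexOf (π-θ₀ _)))

module Medial (M : Map) (T : TMap) (medial : IsMedial (f M) (z M) (a M) T) where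

  open IsMedial medial public

  -- The two θ₁ steps are taken on different sides, so one of them turns by f and the other by z,
  -- and the product is v in either order. For this reason smooth paths follow the v-gons.
  opposite-ι : ∀ x b → opposite T (ι x b) ≡ ι (v M x) (not b)
  opposite-ι x b = trans (cong (θ₁ T ∘ θ₂ T) (θ₁-ι x b)) (trans (cong (θ₁ T) (θ₂-ι (turn b x) b))
    (trans (θ₁-ι (turn b x) (not b)) (cong (λ y → ι y (not b)) (half-turn b x))))
    where
    half-turn : ∀ b x → turn (not b) (turn b x) ≡ v M x
    half-turn false x = zv M x
    half-turn true  x = trans (sym (square M (f M x))) (cong (v M) (involutive (f-matching M) x))

  module _ {A : Set} {h : Fin (#flags T) → A} where

    via-opposite : Inv (θ₂ T) h → Inv (opposite T) h → ∀ b → Inv (v M) (λ x → h (ι x b))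
    via-opposite inv₂ inv b x = trans (via-θ₂ inv₂ (v M x) b (not b)) (trans (cong h (sym (opposite-ι x b))) (inv (ι x b)))

  π-opposite : ∀ y → π (opposite T y) ≡ v M (π y)
  π-opposite y = trans (cong (π ∘ opposite T) (sym (ι-π y))) (trans (cong π (opposite-ι _ _)) (π-ι _ _))

  squareOf : Fin (#flags T) → Fin (size (SQ M))
  squareOf = class (SQ M) ∘ π

  squareOf-turn : ∀ b x → class (SQ M) (turn b x) ≡ class (SQ M) x
  squareOf-turn false x = Squares.class-q M x
  squareOf-turn true  x = trans (Squares.class-p M (f M x)) (Squares.class-q M x)

  squareOf-resp : ∀ {y y′} → class (vertices T) y ≡ class (vertices T) y′ → squareOf y ≡ squareOf y′
  squareOf-resp p = orbit-invariant₂ squareOf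
    (λ y → trans (cong (class (SQ M)) (π-θ₁ y)) (squareOf-turn (side y) (π y)))
    (λ y → cong (class (SQ M)) (π-θ₂ y))
    (complete (vertices T) p)

  vertexOf-v : Inv (v M) vertexOf
  vertexOf-v x = trans (cong vertexOf (sym (zv M x))) (trans (vertexOf-z (f M x)) (vertexOf-f x))

  vertexOf-resp : ∀ {x x′} → class (SQ M) x ≡ class (SQ M) x′ → vertexOf x ≡ vertexOf x′
  vertexOf-resp p = orbit-invariant₂ vertexOf vertexOf-v vertexOf-f (complete (SQ M) p)

  squares↔vertices : Fin (size (SQ M)) ↔ Fin (size (vertices T))
  squares↔vertices = classes↔ (SQ M) (vertices T) (λ x → ι x false) π vertexOf-resp squareOf-resp
    (λ x → cong (class (SQ M)) (π-ι x false)) vertexOf-π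

  pathOf : Fin (#C M) → Fin (size (smoothPaths T))
  pathOf x = class (smoothPaths T) (ι x false)

  path-θ₂ : Inv (θ₂ T) (class (smoothPaths T))
  path-θ₂ = class-step (smoothPaths T) (there (here refl))

  pathOf-a : Inv (a M) pathOf
  pathOf-a = via-θ₀ (class-step (smoothPaths T) (here refl)) false

  pathOf-v : Inv (v M) pathOf
  pathOf-v = via-opposite path-θ₂ (class-step (smoothPaths T) (there (there (here refl)))) false

  pathOf-π : ∀ y → pathOf (π y) ≡ class (smoothPaths T) y
  pathOf-π = via-π path-θ₂

  vgonOf-resp : ∀ {y y′} → class (smoothPaths T) y ≡ class (smoothPaths T) y′ →
                class (v-gons M) (π y) ≡ class (v-gons M) (π y′)
  vgonOf-resp p = orbit-invariant (class (v-gons M) ∘ π)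
    (λ { (here refl) y → trans (cong (class (v-gons M)) (π-θ₀ y)) (class-step (v-gons M) (there (here refl)) (π y))
       ; (there (here refl)) y → cong (class (v-gons M)) (π-θ₂ y)
       ; (there (there (here refl))) y → trans (cong (class (v-gons M)) (π-opposite y)) (class-step (v-gons M) (here refl) (π y)) })
    (complete (smoothPaths T) p)

  pathOf-resp : ∀ {x x′} → class (v-gons M) x ≡ class (v-gons M) x′ → pathOf x ≡ pathOf x′
  pathOf-resp p = orbit-invariant₂ pathOf pathOf-v pathOf-a (complete (v-gons M) p)

  vgons↔paths : Fin (size (v-gons M)) ↔ Fin (size (smoothPaths T))
  vgons↔paths = classes↔ (v-gons M) (smoothPaths T) (λ x → ι x false) π pathOf-resp vgonOf-resp
    (λ x → cong (class (v-gons M)) (π-ι x false)) pathOf-π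

  path-turn : ∀ y → class (smoothPaths T) (θ₁ T y) ≡ pathOf (f M (π y))
  path-turn y = trans (sym (pathOf-π (θ₁ T y))) (trans
    (cong pathOf (π-θ₁ y))
    (either (side y)))
    where
    either : ∀ b → pathOf (turn b (π y)) ≡ pathOf (f M (π y))
    either false = refl
    either true  = pathOf-v (f M (π y))

  graph-iso : 𝔾 M ≅ smoothPathGraph T
  graph-iso = record { V↔ = vgons↔paths ; E↔ = squares↔vertices ; ends-≅ = λ s → ends-agree s }
    where
    to : Fin (size (v-gons M)) → Fin (size (smoothPaths T))
    to = Inverse.to vgons↔paths

    module _ (s : Fin (size (SQ M))) where

      r = rep (SQ M) s
      w = rep (vertices T) (vertexOf r)

      π-w∈ : π w ∈ Squares.orbitList M r
      π-w∈ = Squares.∈-orbitList M (trans (squareOf-resp (class-rep (vertices T) (vertexOf r)))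
        (trans (cong (class (SQ M)) (π-ι r false)) (class-rep (SQ M) s)))

      pathOf-z : pathOf (z M r) ≡ pathOf (f M r)
      pathOf-z = pathOf-v (f M r)

      to-class : ∀ x → to (class (v-gons M) x) ≡ pathOf x
      to-class = classes↔-class (v-gons M) (smoothPaths T) (λ x → ι x false) π pathOf-resp vgonOf-resp
        (λ x → cong (class (v-gons M)) (π-ι x false)) pathOf-π

      -- The representative of the vertex may be any corner of the square. Passing from r to f r or
      -- z r exchanges the two v-edges, and with them the two ends of the edge.
      by-position : ∀ {y} → y ∈ Squares.orbitList M r →
        (pathOf y ≡ pathOf r × pathOf (f M y) ≡ pathOf (f M r)) ⊎ (pathOf y ≡ pathOf (f M r) × pathOf (f M y) ≡ pathOf r)
      by-position (here refl) = inj₁ (refl , refl)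
      by-position (there (here refl)) = inj₁ (pathOf-v r , trans (cong pathOf (sym (square M r))) pathOf-z)
      by-position (there (there (here refl))) = inj₂ (refl , cong pathOf (involutive (f-matching M) r))
      by-position (there (there (there (here refl)))) = inj₂ (pathOf-z ,
        trans (cong pathOf (trans (sym (square M (f M r))) (cong (v M) (involutive (f-matching M) r)))) (pathOf-v r))

      ends-agree : (class (smoothPaths T) w , class (smoothPaths T) (θ₁ T w)) ≡
                     (to (class (v-gons M) r) , to (class (v-gons M) (f M r)))
                 ⊎ (class (smoothPaths T) w , class (smoothPaths T) (θ₁ T w)) ≡
                     (to (class (v-gons M) (f M r)) , to (class (v-gons M) r))
      ends-agree = assemble (by-position π-w∈)
        where
        assemble : (pathOf (π w) ≡ pathOf r × pathOf (f M (π w)) ≡ pathOf (f M r)) ⊎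
                   (pathOf (π w) ≡ pathOf (f M r) × pathOf (f M (π w)) ≡ pathOf r) → _
        assemble (inj₁ (p , q)) = inj₁ (cong₂ _,_
          (trans (sym (pathOf-π w)) (trans p (sym (to-class r)))) (trans (path-turn w) (trans q (sym (to-class (f M r))))))
        assemble (inj₂ (p , q)) = inj₂ (cong₂ _,_
          (trans (sym (pathOf-π w)) (trans p (sym (to-class (f M r))))) (trans (path-turn w) (trans q (sym (to-class r)))))

-- Counting vertices, edges and faces of the medial graph

module ℕΣ = Algebra.Properties.CommutativeMonoid.Sum ℕ.+-0-commutativeMonoid
module ℕFibre = FibreSum ℕ.+-0-commutativeMonoid

ℕ∑ : ∀ {n} → (Fin n → ℕ) → ℕ
ℕ∑ = ℕΣ.sum

vec-sum : ∀ {n} (h : Fin n → ℕ) → Vec.sum (tabulate h) ≡ ℕ∑ h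
vec-sum {zero}  h = refl
vec-sum {suc n} h = cong (h zero ℕ.+_) (vec-sum (h ∘ suc))

ℕ∑-const : ∀ n c → ℕ∑ {n} (λ _ → c) ≡ n ℕ.* c
ℕ∑-const zero    c = refl
ℕ∑-const (suc n) c = cong (c ℕ.+_) (ℕ∑-const n c)

≡?-if : ∀ {n} (i j : Fin n) → [ i ≡? j ] ≡ (if does (i ≟ j) then 1 else 0)
≡?-if i j with i ≟ j
... | yes _ = refl
... | no  _ = refl

listSum-one : ∀ {n} (ys : List (Fin n)) → ℕFibre.listSum (λ _ → 1) ys ≡ length ys
listSum-one []       = refl
listSum-one (y ∷ ys) = cong suc (listSum-one ys)

count-enumerated : ∀ {n m} (c : Fin n → Fin m) s ys → Unique ys →
                   (∀ {x} → c x ≡ s → x ∈ ys) → (∀ {x} → x ∈ ys → c x ≡ s) →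
                   ℕ∑ (λ x → [ c x ≡? s ]) ≡ length ys
count-enumerated c s ys uniq to from = trans (ℕΣ.sum-cong-≗ λ x → ≡?-if (c x) s)
  (trans (ℕFibre.sum-enumerated (λ x → c x ≟ s) (λ _ → 1) ys uniq to from) (listSum-one ys))

count-fibres : ∀ {n m} (c : Fin n → Fin m) (fibre : Fin m → List (Fin n)) → (∀ s → Unique (fibre s)) →
               (∀ {x s} → c x ≡ s → x ∈ fibre s) → (∀ {x s} → x ∈ fibre s → c x ≡ s) →
               ∀ k → (∀ s → length (fibre s) ≡ k) → n ≡ m ℕ.* k
count-fibres {n} {m} c fibre uniq to from k len = begin
  n
    ≡⟨ ℕ.*-identityʳ n ⟨
  n ℕ.* 1
    ≡⟨ ℕ∑-const n 1 ⟨
  ℕ∑ {n} (λ _ → 1)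
    ≡⟨ ℕFibre.sum-fibres c fibre uniq to from (λ _ → 1) ⟩
  ℕ∑ (λ s → ℕFibre.listSum (λ _ → 1) (fibre s))
    ≡⟨ ℕΣ.sum-cong-≗ (λ s → trans (listSum-one (fibre s)) (len s)) ⟩
  ℕ∑ {m} (λ _ → k)
    ≡⟨ ℕ∑-const m k ⟩
  m ℕ.* k ∎

-- The two ends of an edge are the vertices of the two elements of its fibre, so the degree counts
-- edge-ends, a loop with both of its ends. This makes 4-regularity a statement about the sizes of
-- the fibres of `vertexOf`.
degree-count : ∀ {n} {f z a : Fin n → Fin n} {T} (medial : IsMedial f z a T) →
               ∀ w → degree (underlying T) w ≡ ℕ∑ λ x → [ IsMedial.vertexOf medial x ≡? w ]
degree-count {a = a} {T} medial w = begin
  degree (underlying T) w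
    ≡⟨ vec-sum {size (edges T)} _ ⟩
  ℕ∑ (λ e → if lookup ⊤ e then [ proj₁ (ends (underlying T) e) ≡? w ] ℕ.+ [ proj₂ (ends (underlying T) e) ≡? w ] else 0)
    ≡⟨ ℕΣ.sum-cong-≗ (λ e → trans
         (cong (λ b → if b then [ proj₁ (ends (underlying T) e) ≡? w ] ℕ.+ [ proj₂ (ends (underlying T) e) ≡? w ] else 0) (lookup-⊤ e))
         (cong₂ ℕ._+_ (cong (λ p → [ proj₁ p ≡? w ]) (ends-rep e))
           (trans (cong (λ p → [ proj₂ p ≡? w ]) (ends-rep e)) (sym (ℕ.+-identityʳ _))))) ⟩
  ℕ∑ (λ e → ℕFibre.listSum (λ x → [ vertexOf x ≡? w ]) (edgeFibre e))
    ≡⟨ ℕFibre.sum-fibres edgeOf edgeFibre edgeFibre-unique ∈-edgeFibre edgeFibre-class (λ x → [ vertexOf x ≡? w ]) ⟨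
  ℕ∑ (λ x → [ vertexOf x ≡? w ]) ∎
  where open IsMedial medial

module Counts (M : Map) (T : TMap) (medial : IsMedial (f M) (z M) (a M) T) where

  open Medial M T medial

  four-regular : ∀ w → degree (underlying T) w ≡ 4
  four-regular w = trans (degree-count medial w)
    (count-enumerated vertexOf w (Squares.orbitList M x) (Squares.orbitList-unique M x)
      (λ {y} p → Squares.orbitList-complete M (complete (SQ M) (sym (begin
        class (SQ M) y                ≡⟨ cong (class (SQ M)) (π-ι y false) ⟨
        squareOf (ι y false)          ≡⟨ squareOf-resp (trans p (sym (class-rep (vertices T) w))) ⟩
        squareOf (rep (vertices T) w) ∎))))
      (λ y∈ → trans (at y∈) (trans (vertexOf-π (rep (vertices T) w)) (class-rep (vertices T) w))))
    where
    x : Fin (#C M)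
    x = π (rep (vertices T) w)

    at : ∀ {y} → y ∈ Squares.orbitList M x → vertexOf y ≡ vertexOf x
    at (here refl) = refl
    at (there (here refl)) = vertexOf-v x
    at (there (there (here refl))) = vertexOf-f x
    at (there (there (there (here refl)))) = vertexOf-z x

  -- The vertices of C_M are counted twice: in pairs along a-edges and in fours along squares.
  #edges : size (edges T) ≡ 2 ℕ.* size (SQ M)
  #edges = ℕ.*-cancelʳ-≡ (size (edges T)) (2 ℕ.* size (SQ M)) 2 (begin
    size (edges T) ℕ.* 2        ≡⟨ count-fibres edgeOf edgeFibre edgeFibre-unique ∈-edgeFibre edgeFibre-class 2 (λ _ → refl) ⟨
    #C M                        ≡⟨ count-fibres (class (SQ M)) (λ s → Squares.orbitList M (rep (SQ M) s))
                                     (λ s → Squares.orbitList-unique M _) (Squares.∈-orbitList M) (Squares.orbitList-class M)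
                                     4 (λ _ → refl) ⟩
    size (SQ M) ℕ.* 4           ≡⟨ ℕ.*-assoc (size (SQ M)) 2 2 ⟨
    (size (SQ M) ℕ.* 2) ℕ.* 2   ≡⟨ cong (ℕ._* 2) (ℕ.*-comm (size (SQ M)) 2) ⟩
    (2 ℕ.* size (SQ M)) ℕ.* 2   ∎)

  faceOf : Bool → Fin (#C M) → Fin (size (faces T))
  faceOf b x = class (faces T) (ι x b)

  faceOf-a : ∀ b → Inv (a M) (faceOf b)
  faceOf-a = via-θ₀ (class-step (faces T) (here refl))

  faceOf-turn : ∀ b → Inv (turn b) (faceOf b)
  faceOf-turn = via-θ₁ (class-step (faces T) (there (here refl)))

  gonOf : Bool → Fin (#C M) → Fin (size (v-gons (dual M))) ⊎ Fin (size (v-gons (phial M)))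
  gonOf false x = inj₁ (class (v-gons (dual M)) x)
  gonOf true  x = inj₂ (class (v-gons (phial M)) x)

  gonOf-a : ∀ b → Inv (a M) (gonOf b)
  gonOf-a false x = cong inj₁ (class-step (v-gons (dual M)) (there (here refl)) x)
  gonOf-a true  x = cong inj₂ (class-step (v-gons (phial M)) (there (here refl)) x)

  gonOf-turn : ∀ b → Inv (turn b) (gonOf b)
  gonOf-turn false x = cong inj₁ (class-step (v-gons (dual M)) (here refl) x)
  gonOf-turn true  x = cong inj₂ (class-step (v-gons (phial M)) (here refl) x)

  gonAt : Fin (#flags T) → Fin (size (v-gons (dual M))) ⊎ Fin (size (v-gons (phial M)))
  gonAt y = gonOf (side y) (π y)

  gonAt-resp : ∀ {y y′} → class (faces T) y ≡ class (faces T) y′ → gonAt y ≡ gonAt y′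
  gonAt-resp p = orbit-invariant₂ gonAt
    (λ y → trans (cong₂ gonOf (side-θ₀ y) (π-θ₀ y)) (gonOf-a (side y) (π y)))
    (λ y → trans (cong₂ gonOf (side-θ₁ y) (π-θ₁ y)) (gonOf-turn (side y) (π y)))
    (complete (faces T) p)

  faces↔gons : Fin (size (faces T)) ↔ (Fin (size (v-gons (dual M))) ⊎ Fin (size (v-gons (phial M))))
  faces↔gons = mk↔ₛ′ (λ φ → gonAt (rep (faces T) φ)) face
    (λ { (inj₁ c) → trans (gonAt-resp (class-rep (faces T) _)) (trans (cong₂ gonOf (side-ι _ false) (π-ι _ false))
           (cong inj₁ (class-rep (v-gons (dual M)) c)))
       ; (inj₂ c) → trans (gonAt-resp (class-rep (faces T) _)) (trans (cong₂ gonOf (side-ι _ true) (π-ι _ true))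
           (cong inj₂ (class-rep (v-gons (phial M)) c))) })
    (λ φ → trans (face-gonOf (side _) (π _)) (trans (cong (class (faces T)) (ι-π _)) (class-rep (faces T) φ)))
    where
    face : Fin (size (v-gons (dual M))) ⊎ Fin (size (v-gons (phial M))) → Fin (size (faces T))
    face (inj₁ c) = faceOf false (rep (v-gons (dual M)) c)
    face (inj₂ c) = faceOf true (rep (v-gons (phial M)) c)

    face-gonOf : ∀ b x → face (gonOf b x) ≡ faceOf b x
    face-gonOf false x = orbit-invariant₂ (faceOf false) (faceOf-turn false) (faceOf-a false) (rep∼ (v-gons (dual M)) x)
    face-gonOf true  x = orbit-invariant₂ (faceOf true) (faceOf-turn true) (faceOf-a true) (rep∼ (v-gons (phial M)) x)

  #faces : size (faces T) ≡ #V (𝔾 (dual M)) ℕ.+ #V (𝔾 (phial M))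
  #faces = ↔⇒≡ (↔-trans faces↔gons (↔-sym +↔⊎))

  face-colourable : FaceTwoColourable T
  face-colourable = (λ φ → side (rep (faces T) φ)) , λ x p → not-self (side x) (begin
    side x                                     ≡⟨ side-resp (class-rep (faces T) _) ⟨
    side (rep (faces T) (class (faces T) x))   ≡⟨ p ⟩
    side (rep (faces T) (class (faces T) (θ₂ T x))) ≡⟨ side-resp (class-rep (faces T) _) ⟩
    side (θ₂ T x)                              ≡⟨ side-θ₂ x ⟩
    not (side x)                               ∎)
    where
    side-resp : ∀ {y y′} → class (faces T) y ≡ class (faces T) y′ → side y ≡ side y′
    side-resp p = orbit-invariant₂ side side-θ₀ side-θ₁ (complete (faces T) p)

    not-self : ∀ b → b ≢ not b
    not-self false ()
    not-self true  ()

  isSpEmbedding : ∀ {G} → 𝔾 M ≅ G → IsSpEmbedding T G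
  isSpEmbedding iso = record
    { four-regular = four-regular ; face-colourable = face-colourable ; graph = ≅-trans (≅-sym iso) graph-iso }

  -- With m squares there are m vertices and 2m edges, so χ is the number of faces minus m. The
  -- left-hand equation arises from the right-hand one by adding m + k on both sides, which removes
  -- the subtractions.
  χ-formula : ∀ k γ → #V (𝔾 (dual M)) ℕ.+ #V (𝔾 (phial M)) ℕ.+ k ≡ size (SQ M) ℕ.+ (3 ℕ.+ γ) ⇔ χ T ≡ + 3 - + k + + γ
  χ-formula k γ = mk⇔
    (λ p → trans χ≡ (+-cancelʳ (+ m + + k) _ _ (trans lhs (trans (cong +_ p) (sym rhs)))))
    (λ p → ℤ.+-injective (trans (sym lhs) (trans (cong (_+ (+ m + + k)) (trans (sym χ≡) p)) rhs)))
    where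
    m = size (SQ M)
    F = #V (𝔾 (dual M)) ℕ.+ #V (𝔾 (phial M))

    open +-*-Solver
    open Algebra.Properties.Group (AbelianGroup.group ℤ.+-0-abelianGroup) using () renaming (∙-cancelʳ to +-cancelʳ)

    χ≡ : χ T ≡ + m - + (2 ℕ.* m) + + F
    χ≡ = cong₂ _+_ (cong₂ (λ i j → + i - + j) (sym (↔⇒≡ squares↔vertices)) #edges) (cong +_ #faces)

    lhs : + m - + (2 ℕ.* m) + + F + (+ m + + k) ≡ + (F ℕ.+ k)
    lhs = trans (cong (λ i → + m - i + + F + (+ m + + k)) (trans (cong +_ (cong (m ℕ.+_) (ℕ.+-identityʳ m))) (ℤ.pos-+ m m)))
      (trans (solve 3 (λ m F k → m :- (m :+ m) :+ F :+ (m :+ k) := F :+ k) refl (+ m) (+ F) (+ k)) (sym (ℤ.pos-+ F k)))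

    rhs : + 3 - + k + + γ + (+ m + + k) ≡ + (m ℕ.+ (3 ℕ.+ γ))
    rhs = trans (solve 4 (λ t k γ m → t :- k :+ γ :+ (m :+ k) := m :+ (t :+ γ)) refl (+ 3) (+ k) (+ γ) (+ m))
      (sym (trans (ℤ.pos-+ m (3 ℕ.+ γ)) (cong (λ i → + m + i) (ℤ.pos-+ 3 γ))))

bit-sum : ∀ {n} (i j k : Fin n) → (([ i ≡? k ] ℕ.+ [ j ≡? k ]) ℕ.≡ᵇ 1) ≡ odd [ i ≡? k ] xor odd [ j ≡? k ]
bit-sum i j k with i ≟ k | j ≟ k
... | yes _ | yes _ = refl
... | yes _ | no  _ = refl
... | no  _ | yes _ = refl
... | no  _ | no  _ = refl

bit : ∀ {n} (i k : Fin n) → ([ i ≡? k ] ℕ.≡ᵇ 1) ≡ odd [ i ≡? k ]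
bit i k with i ≟ k
... | yes _ = refl
... | no  _ = refl

-- The cycle space of the medial graph and its generators

module Cycles (M : Map) (T : TMap) (medial : IsMedial (f M) (z M) (a M) T) where

  open Medial M T medial
  open Counts M T medial using (faceOf; faceOf-a)

  H : Graph
  H = underlying T

  onFlags : Subset (size (edges T)) → Fin (#C M) → Bool
  onFlags A x = lookup A (edgeOf x)

  fromFlags : (Fin (#C M) → Bool) → Subset (size (edges T))
  fromFlags k = tabulate (k ∘ edgeRep)

  at-rep : ∀ {k : Fin (#C M) → Bool} → Inv (a M) k → ∀ x → k (edgeRep (edgeOf x)) ≡ k x
  at-rep {k} k-a x = at (∈-edgeFibre {x} refl)
    where
    at : x ∈ edgeFibre (edgeOf x) → k (edgeRep (edgeOf x)) ≡ k x
    at (here p)         = cong k (sym p)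
    at (there (here p)) = trans (sym (k-a _)) (cong k (sym p))

  onFlags-fromFlags : ∀ {k} → Inv (a M) k → ∀ x → onFlags (fromFlags k) x ≡ k x
  onFlags-fromFlags {k} k-a x = trans (lookup∘tabulate _ (edgeOf x)) (at-rep k-a x)

  fromFlags-onFlags : ∀ A → fromFlags (onFlags A) ≡ A
  fromFlags-onFlags A = trans (tabulate-cong λ e → cong (lookup A) (edgeOf-rep e)) (tabulate∘lookup A)

  -- The four corners of a square are the edge-ends at one vertex of `H`; for a-invariant `k` this
  -- is the parity of the degree there in the edge set described by `k`.
  defect : (Fin (#C M) → Bool) → Fin (#C M) → Bool
  defect k x = (k x xor k (v M x)) xor (k (f M x) xor k (z M x))

  defect-v : ∀ k → Inv (v M) (defect k)
  defect-v k x = trans (cong₂ (λ y w → (k (v M x) xor k y) xor (w xor k (v M (f M (v M x)))))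
      (involutive (v-matching M) x) (cong k (sym (square M x))))
    (trans (cong (λ y → (k (v M x) xor k x) xor (k (z M x) xor k y)) (zf M x))
      (cong₂ _xor_ (xor-comm _ (k x)) (xor-comm _ (k (f M x)))))

  defect-f : ∀ k → Inv (f M) (defect k)
  defect-f k x = trans (cong₂ (λ y w → (k (f M x) xor k (z M x)) xor (k y xor k (v M w)))
      (involutive (f-matching M) x) (involutive (f-matching M) x))
    (xor-comm (k (f M x) xor k (z M x)) (k x xor k (v M x)))

  -- A sum over edge-ends is grouped by edges on one side and by vertices on the other.
  dot-coboundary : ∀ A W → dot A (coboundary H W) ≡
    ∑ λ s → defect (onFlags A) (rep (SQ M) s) ∧ lookup W (vertexOf (rep (SQ M) s))
  dot-coboundary A W = begin
    dot A (coboundary H W)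
      ≡⟨ dot-tabulateʳ A (λ e → lookup W (proj₁ (ends H e)) xor lookup W (proj₂ (ends H e))) ⟩
    ∑ (λ e → lookup A e ∧ (lookup W (proj₁ (ends H e)) xor lookup W (proj₂ (ends H e))))
      ≡⟨ ∑-cong (λ e → trans
           (cong₂ (λ b p → b ∧ (lookup W (proj₁ p) xor lookup W (proj₂ p))) (cong (lookup A) (sym (edgeOf-rep e))) (ends-rep e))
           (trans (∧-distribˡ-xor (k (edgeRep e)) (w (edgeRep e)) (w (a M (edgeRep e))))
             (cong₂ _xor_ {x = k (edgeRep e) ∧ w (edgeRep e)} refl (trans (cong (_∧ w (a M (edgeRep e))) (sym (cong (lookup A) (edgeOf-a (edgeRep e)))))
               (sym (xor-identityʳ _)))))) ⟩
    ∑ (λ e → foldr (λ x b → (k x ∧ w x) xor b) false (edgeFibre e))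
      ≡⟨ ∑-fibres edgeOf edgeFibre edgeFibre-unique ∈-edgeFibre edgeFibre-class (λ x → k x ∧ w x) ⟨
    ∑ (λ x → k x ∧ w x)
      ≡⟨ Squares.∑-orbits M (λ x → k x ∧ w x) ⟩
    ∑ (λ s → let r = rep (SQ M) s in
         ((k r ∧ w r) xor (k (v M r) ∧ w (v M r))) xor ((k (f M r) ∧ w (f M r)) xor (k (z M r) ∧ w (z M r))))
      ≡⟨ ∑-cong (λ s → let r = rep (SQ M) s in trans
           (cong₂ _xor_ (cong₂ (λ y y′ → (k r ∧ y) xor (k (v M r) ∧ y′)) refl (cong (lookup W) (vertexOf-v r)))
             (cong₂ (λ y y′ → (k (f M r) ∧ y) xor (k (z M r) ∧ y′)) (cong (lookup W) (vertexOf-f r)) (cong (lookup W) (vertexOf-z r))))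
           (factor (k r) (k (v M r)) (k (f M r)) (k (z M r)) (w r))) ⟩
    ∑ (λ s → defect k (rep (SQ M) s) ∧ w (rep (SQ M) s)) ∎
    where
    open xor-∧-Solver

    k w : Fin (#C M) → Bool
    k = onFlags A
    w x = lookup W (vertexOf x)

    factor : ∀ a b c d w → ((a ∧ w) xor (b ∧ w)) xor ((c ∧ w) xor (d ∧ w)) ≡ ((a xor b) xor (c xor d)) ∧ w
    factor = solve 5 (λ a b c d w → ((a :* w) :+ (b :* w)) :+ ((c :* w) :+ (d :* w)) := ((a :+ b) :+ (c :+ d)) :* w) refl

  cycle⇒defect : ∀ A → CycleSpace H A → ∀ x → defect (onFlags A) x ≡ false
  cycle⇒defect A cyc x = begin
    defect k x                                         ≡⟨ lookup-squareSet M (defect-v k) (defect-f k) x ⟨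
    lookup (squareSet M (defect k)) (class (SQ M) x)   ≡⟨ cong (λ X → lookup X (class (SQ M) x)) (nondegenerate _ zero-dot) ⟩
    lookup ⊥ (class (SQ M) x)                          ≡⟨ lookup-⊥ (class (SQ M) x) ⟩
    false                                              ∎
    where
    k : Fin (#C M) → Bool
    k = onFlags A

    -- Every set of squares is a set of vertices of `H`, so its cut tests the defect against an
    -- arbitrary `B`.
    zero-dot : ∀ B → dot (squareSet M (defect k)) B ≡ false
    zero-dot B = begin
      dot (squareSet M (defect k)) B
        ≡⟨ dot-def (squareSet M (defect k)) B ⟩
      ∑ (λ s → lookup (squareSet M (defect k)) s ∧ lookup B s)
        ≡⟨ ∑-cong (λ s → cong₂ _∧_ (lookup∘tabulate _ s) (trans (cong (lookup B) (sym (Inverse.strictlyInverseʳ squares↔vertices s)))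
             (sym (lookup∘tabulate _ (vertexOf (rep (SQ M) s)))))) ⟩
      ∑ (λ s → defect k (rep (SQ M) s) ∧ lookup (permuted (Inverse.from squares↔vertices) B) (vertexOf (rep (SQ M) s)))
        ≡⟨ dot-coboundary A (permuted (Inverse.from squares↔vertices) B) ⟨
      dot A (coboundary H (permuted (Inverse.from squares↔vertices) B))
        ≡⟨ ⟨⟩≡0⇒dot A _ (cycle⇒ᗮ H A cyc _ (permuted (Inverse.from squares↔vertices) B , refl)) ⟩
      false ∎

  defect⇒cycle : ∀ A → (∀ x → defect (onFlags A) x ≡ false) → CycleSpace H A
  defect⇒cycle A p = ᗮ⇒cycle H A λ { B (W , refl) → dot⇒⟨⟩≡0 A (coboundary H W) (trans (dot-coboundary A W)
    (∑-false λ s → cong (_∧ lookup W (vertexOf (rep (SQ M) s))) (p (rep (SQ M) s)))) }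

  generators : Vec (Subset (size (edges T))) (size (faces T) ℕ.+ size (smoothPaths T))
  generators = tabulate (boundary T) ++ tabulate (smoothPathEdges T)

  module _ (c : Subset (size (faces T))) (d : Subset (size (smoothPaths T))) where

    private
      value : Fin (#C M) → Bool
      value x = lookup d (pathOf x) xor (lookup c (faceOf false x) xor lookup c (faceOf true x))

      faces-part : ∀ e → lookup (combination c (tabulate (boundary T))) e ≡
                   lookup c (faceOf false (edgeRep e)) xor lookup c (faceOf true (edgeRep e))
      faces-part e = begin
        lookup (combination c (tabulate (boundary T))) e
          ≡⟨ lookup-combination-tabulate c (boundary T) e ⟩
        ∑ (λ φ → lookup c φ ∧ lookup (boundary T φ) e)
          ≡⟨ ∑-cong (λ φ → trans (cong (lookup c φ ∧_) (trans (lookup∘tabulate _ e) (bit-sum (class (faces T) y) (class (faces T) (θ₂ T y)) φ)))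
               (∧-distribˡ-xor (lookup c φ) (odd [ class (faces T) y ≡? φ ]) (odd [ class (faces T) (θ₂ T y) ≡? φ ]))) ⟩
        ∑ (λ φ → (lookup c φ ∧ odd [ class (faces T) y ≡? φ ]) xor (lookup c φ ∧ odd [ class (faces T) (θ₂ T y) ≡? φ ]))
          ≡⟨ ∑-xor _ _ ⟩
        ∑ (λ φ → lookup c φ ∧ odd [ class (faces T) y ≡? φ ]) xor ∑ (λ φ → lookup c φ ∧ odd [ class (faces T) (θ₂ T y) ≡? φ ])
          ≡⟨ cong₂ _xor_ (∑-point (lookup c) _) (∑-point (lookup c) _) ⟩
        lookup c (class (faces T) y) xor lookup c (class (faces T) (θ₂ T y))
          ≡⟨ cong (λ y → lookup c (class (faces T) y) xor lookup c (class (faces T) (θ₂ T y))) (ι-π y) ⟨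
        lookup c (faceOf (side y) (π y)) xor lookup c (class (faces T) (θ₂ T (ι (π y) (side y))))
          ≡⟨ cong (λ w → lookup c (faceOf (side y) (π y)) xor lookup c (class (faces T) w)) (θ₂-ι (π y) (side y)) ⟩
        lookup c (faceOf (side y) (π y)) xor lookup c (faceOf (not (side y)) (π y))
          ≡⟨ both (side y) ⟩
        lookup c (faceOf false (π y)) xor lookup c (faceOf true (π y)) ∎
        where
        y = rep (edges T) e

        both : ∀ b → lookup c (faceOf b (π y)) xor lookup c (faceOf (not b) (π y)) ≡
                     lookup c (faceOf false (π y)) xor lookup c (faceOf true (π y))
        both false = refl
        both true  = xor-comm (lookup c (faceOf true (π y))) _

      paths-part : ∀ e → lookup (combination d (tabulate (smoothPathEdges T))) e ≡ lookup d (pathOf (edgeRep e))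
      paths-part e = begin
        lookup (combination d (tabulate (smoothPathEdges T))) e
          ≡⟨ lookup-combination-tabulate d (smoothPathEdges T) e ⟩
        ∑ (λ p → lookup d p ∧ lookup (smoothPathEdges T p) e)
          ≡⟨ ∑-cong (λ p → cong (lookup d p ∧_) (trans (lookup∘tabulate _ e) (bit (class (smoothPaths T) (rep (edges T) e)) p))) ⟩
        ∑ (λ p → lookup d p ∧ odd [ class (smoothPaths T) (rep (edges T) e) ≡? p ])
          ≡⟨ ∑-point (lookup d) _ ⟩
        lookup d (class (smoothPaths T) (rep (edges T) e))
          ≡⟨ cong (lookup d) (pathOf-π (rep (edges T) e)) ⟨
        lookup d (pathOf (edgeRep e)) ∎

    value-a : Inv (a M) value
    value-a x = cong₂ _xor_ (cong (lookup d) (pathOf-a x))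
      (cong₂ _xor_ (cong (lookup c) (faceOf-a false x)) (cong (lookup c) (faceOf-a true x)))

    -- An edge lies on one smooth path and on one face of each colour. Coefficients for the
    -- generators thus are three functions, constant on v-gons, f-gons and (z,a)-gons, and the
    -- combination is their sum: exactly the shape of `Splits`.
    combination-onFlags : ∀ x → onFlags (combination (c ++ d) generators) x ≡ value x
    combination-onFlags x = begin
      lookup (combination (c ++ d) generators) e
        ≡⟨ cong (λ X → lookup X e) (combination-++ c d (tabulate (boundary T)) (tabulate (smoothPathEdges T))) ⟩
      lookup (combination c (tabulate (boundary T)) ⊕ combination d (tabulate (smoothPathEdges T))) e
        ≡⟨ lookup-⊕ (combination c (tabulate (boundary T))) (combination d (tabulate (smoothPathEdges T))) e ⟩
      lookup (combination c (tabulate (boundary T))) e xor lookup (combination d (tabulate (smoothPathEdges T))) e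
        ≡⟨ cong₂ _xor_ (faces-part e) (paths-part e) ⟩
      (lookup c (faceOf false (edgeRep e)) xor lookup c (faceOf true (edgeRep e))) xor lookup d (pathOf (edgeRep e))
        ≡⟨ xor-comm _ (lookup d (pathOf (edgeRep e))) ⟩
      value (edgeRep e)
        ≡⟨ at-rep value-a x ⟩
      value x ∎
      where e = edgeOf x

  span⇒splits : ∀ A → Span generators A → Splits M (onFlags A)
  span⇒splits A (cs , p) =
    lookup d ∘ pathOf , lookup c ∘ faceOf false , lookup c ∘ faceOf true ,
    ((λ x → cong (lookup d) (pathOf-v x)) , (λ x → cong (lookup d) (pathOf-a x))) ,
    ((λ x → cong (lookup c) (Counts.faceOf-turn M T medial false x)) , (λ x → cong (lookup c) (faceOf-a false x))) ,
    ((λ x → cong (lookup c) (Counts.faceOf-turn M T medial true x)) , (λ x → cong (lookup c) (faceOf-a true x))) ,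
    λ x → trans (cong (λ X → onFlags X x) (sym (trans (cong (λ es → combination es generators) (Vec.take++drop≡id (size (faces T)) cs)) p)))
                (combination-onFlags c d x)
    where
    c = Vec.take (size (faces T)) cs
    d = Vec.drop (size (faces T)) cs

  splits⇒span : ∀ A → Splits M (onFlags A) → Span generators A
  splits⇒span A (u , g , h , (u-v , u-a) , (g-f , g-a) , (h-z , h-a) , k≡) = c ++ d , (begin
    combination (c ++ d) generators
      ≡⟨ fromFlags-onFlags (combination (c ++ d) generators) ⟨
    fromFlags (onFlags (combination (c ++ d) generators))
      ≡⟨ tabulate-cong (λ e → trans (combination-onFlags c d (edgeRep e)) (trans
           (cong₂ _xor_ (d-path (edgeRep e)) (cong₂ _xor_ (c-face false (edgeRep e)) (c-face true (edgeRep e))))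
           (sym (k≡ (edgeRep e))))) ⟩
    fromFlags (onFlags A)
      ≡⟨ fromFlags-onFlags A ⟩
    A ∎)
    where
    gh : Bool → Fin (#C M) → Bool
    gh b = if b then h else g

    at-face : Fin (#flags T) → Bool
    at-face y = gh (side y) (π y)

    gh-a : ∀ b → Inv (a M) (gh b)
    gh-a false = g-a
    gh-a true  = h-a

    gh-turn : ∀ b → Inv (turn b) (gh b)
    gh-turn false = g-f
    gh-turn true  = h-z

    c : Subset (size (faces T))
    c = tabulate (at-face ∘ rep (faces T))

    d : Subset (size (smoothPaths T))
    d = tabulate (u ∘ π ∘ rep (smoothPaths T))

    c-face : ∀ b x → lookup c (faceOf b x) ≡ gh b x
    c-face b x = trans (lookup∘tabulate _ (faceOf b x)) (trans
      (orbit-invariant₂ at-face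
        (λ y → trans (cong₂ gh (side-θ₀ y) (π-θ₀ y)) (gh-a (side y) (π y)))
        (λ y → trans (cong₂ gh (side-θ₁ y) (π-θ₁ y)) (gh-turn (side y) (π y)))
        (rep∼ (faces T) (ι x b)))
      (cong₂ gh (side-ι x b) (π-ι x b)))

    d-path : ∀ x → lookup d (pathOf x) ≡ u x
    d-path x = trans (lookup∘tabulate _ (pathOf x)) (trans
      (orbit-invariant (u ∘ π)
        (λ { (here refl) y → trans (cong u (π-θ₀ y)) (u-a (π y))
           ; (there (here refl)) y → cong u (π-θ₂ y)
           ; (there (there (here refl))) y → trans (cong u (π-opposite y)) (u-v (π y)) })
        (rep∼ (smoothPaths T) (ι x false)))
      (cong u (π-ι x false)))

  -- In the sum over the corners of a square, `u` cancels along v, `g` along f and `h` along z.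
  splits⇒defect : ∀ k → Splits M k → ∀ x → defect k x ≡ false
  splits⇒defect k (u , g , h , (u-v , _) , (g-f , _) , (h-z , _) , k≡) x = trans
    (cong₂ _xor_ (cong₂ _xor_ (k≡ x) (k≡ (v M x))) (cong₂ _xor_ (k≡ (f M x)) (k≡ (z M x))))
    (trans
      (cong₂ _xor_
        (cong (λ b → (u x xor (g x xor h x)) xor (b xor (g (v M x) xor h (v M x)))) (u-v x))
        (cong₂ _xor_
          (cong₂ (λ b c → u (f M x) xor (b xor c)) (g-f x) (sym (phial-v M h-z x)))
          (cong₂ _xor_ (u-v (f M x)) (cong₂ _xor_ (trans (cong g (square M x)) (g-f (v M x))) (h-z x)))))
      (cancel (u x) (u (f M x)) (g x) (g (v M x)) (h x) (h (v M x))))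
    where
    open xor-∧-Solver

    cancel : ∀ u u′ g g′ h h′ → ((u xor (g xor h)) xor (u xor (g′ xor h′))) xor
                                ((u′ xor (g xor h′)) xor (u′ xor (g′ xor h))) ≡ false
    cancel = solve 6 (λ u u′ g g′ h h′ → ((u :+ (g :+ h)) :+ (u :+ (g′ :+ h′))) :+
                                ((u′ :+ (g :+ h′)) :+ (u′ :+ (g′ :+ h))) := con false) refl

  split⇒generated : AllCyclesSplit M → CycleSpace H ≐ Span generators
  split⇒generated split =
    (λ {A} cyc → splits⇒span A (split (onFlags A) ((λ x → cong (lookup A) (edgeOf-a x)) , cycle⇒defect A cyc))) ,
    (λ {A} A∈ → defect⇒cycle A (splits⇒defect (onFlags A) (span⇒splits A A∈)))

  generated⇒split : CycleSpace H ≐ Span generators → AllCyclesSplit M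
  generated⇒split (⊆ , _) k (k-a , cyc) =
    transfer (span⇒splits (fromFlags k) (⊆ (defect⇒cycle (fromFlags k) λ x → trans
      (cong₂ _xor_ (cong₂ _xor_ (on x) (on (v M x))) (cong₂ _xor_ (on (f M x)) (on (z M x)))) (cyc x))))
    where
    on : ∀ x → onFlags (fromFlags k) x ≡ k x
    on = onFlags-fromFlags k-a

    transfer : Splits M (onFlags (fromFlags k)) → Splits M k
    transfer (u , g , h , u-inv , g-inv , h-inv , k≡) = u , g , h , u-inv , g-inv , h-inv , λ x → trans (sym (on x)) (k≡ x)

-- Dimension counts

-- The kernel consists of the constants. The vertex `w` makes `⊤` different from `⊥` and serves to
-- read off the constant.
connected-kernel : ∀ G → Connected G → Fin (#V G) → HasDim (Kernel (coboundary G)) 1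
connected-kernel G conn w =
  (⊤ ∷ []) ,
  (λ { (c ∷ []) p → cong (_∷ []) (trans (sym (scalar c w)) (trans (cong (λ X → lookup X w) p) (lookup-⊥ w))) }) ,
  (λ {U} U∈ → (lookup U w ∷ []) , lookup-ext λ i → trans (scalar (lookup U w) i) (constant U U∈ w i)) ,
  (λ { {U} (c ∷ [] , refl) → lookup-ext λ e → trans (lookup∘tabulate _ e) (trans
     (cong₂ _xor_ (scalar c (proj₁ (ends G e))) (scalar c (proj₂ (ends G e)))) (trans (xor-same c) (sym (lookup-⊥ e)))) })
  where
  scalar : ∀ c (i : Fin (#V G)) → lookup (combination (c ∷ []) (⊤ ∷ [])) i ≡ c
  scalar false i = trans (cong (λ X → lookup X i) (⊕-identityˡ ⊥)) (lookup-⊥ i)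
  scalar true  i = trans (cong (λ X → lookup X i) (⊕-identityʳ ⊤)) (lookup-⊤ i)

  constant : ∀ U → coboundary G U ≡ ⊥ → ∀ i j → lookup U i ≡ lookup U j
  constant U p i j = EqC.gfold ≡.isEquivalence (lookup U)
    (λ { (e , refl) → xor-cancel (trans (sym (lookup∘tabulate _ e)) (trans (cong (λ X → lookup X e) p) (lookup-⊥ e))) })
    (conn i j)

connected-dim : ∀ G → Connected G → Fin (#V G) → ∃[ r ] HasDim (CoboundarySpace G) r × r ℕ.+ 1 ≡ #V G
connected-dim G conn w = corrected (coboundary-dim G)
  where
  corrected : ∃[ r ] ∃[ d ] HasDim (CoboundarySpace G) r × HasDim (Kernel (coboundary G)) d × r ℕ.+ d ≡ #V G →
              ∃[ r ] HasDim (CoboundarySpace G) r × r ℕ.+ 1 ≡ #V G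
  corrected (r , d , dimI , dimK , e) =
    r , dimI , trans (cong (r ℕ.+_) (dim-unique (connected-kernel G conn w) dimK)) e

-- Connectedness of C_M rather than of G_M: as v is a product of z and f, this form passes to the
-- dual and the phial, and from there back to their graphs.
ConnectedMap : Map → Set
ConnectedMap M = ∀ x y → SameOrbit (v M ∷ f M ∷ a M ∷ []) x y

connectedMap : ∀ M → Connected (𝔾 M) → ConnectedMap M
connectedMap M conn x y = EqC.transitive _ (EqC.symmetric _ (within (rep∼ (v-gons M) x)))
  (EqC.transitive _ (across (conn (class (v-gons M) x) (class (v-gons M) y))) (within (rep∼ (v-gons M) y)))
  where
  within : ∀ {x y} → SameOrbit (v M ∷ a M ∷ []) x y → SameOrbit (v M ∷ f M ∷ a M ∷ []) x y
  within = EqC.map λ { (g , here p , q) → g , here p , q ; (g , there (here p) , q) → g , there (there (here p)) , q }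

  across : ∀ {u w} → EqClosure (Adjacent (𝔾 M)) u w →
           SameOrbit (v M ∷ f M ∷ a M ∷ []) (rep (v-gons M) u) (rep (v-gons M) w)
  across = EqC.gfold (EqC.isEquivalence _) (rep (v-gons M)) λ { (s , refl) →
    EqC.transitive _ (within (rep∼ (v-gons M) (rep (SQ M) s)))
      (EqC.transitive _ (EqC.return (f M , there (here refl) , refl))
        (EqC.symmetric _ (within (rep∼ (v-gons M) (f M (rep (SQ M) s)))))) }

connected-𝔾 : ∀ M → ConnectedMap M → Connected (𝔾 M)
connected-𝔾 M conn u w = ≡.subst₂ (EqClosure (Adjacent (𝔾 M))) (class-rep (v-gons M) u) (class-rep (v-gons M) w)
  (EqC.gfold (EqC.isEquivalence (Adjacent (𝔾 M))) (class (v-gons M))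
    (λ { {x} (_ , here refl , refl) → same (sym (class-step (v-gons M) (here refl) x))
       ; {x} (_ , there (here refl) , refl) → across x
       ; {x} (_ , there (there (here refl)) , refl) → same (sym (class-step (v-gons M) (there (here refl)) x)) })
    (conn (rep (v-gons M) u) (rep (v-gons M) w)))
  where
  same : ∀ {u w} → u ≡ w → EqClosure (Adjacent (𝔾 M)) u w
  same refl = EqC.reflexive _

  across : ∀ x → EqClosure (Adjacent (𝔾 M)) (class (v-gons M) x) (class (v-gons M) (f M x))
  across x = at (Squares.∈-orbitList M {x} refl)
    where
    r : Fin (#C M)
    r = rep (SQ M) (class (SQ M) x)

    v-step : Inv (v M) (class (v-gons M))
    v-step = class-step (v-gons M) (here refl)

    edge : EqClosure (Adjacent (𝔾 M)) (class (v-gons M) r) (class (v-gons M) (f M r))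
    edge = EqC.return (class (SQ M) x , refl)

    at : ∀ {y} → y ∈ Squares.orbitList M r → EqClosure (Adjacent (𝔾 M)) (class (v-gons M) y) (class (v-gons M) (f M y))
    at (here refl) = edge
    at (there (here refl)) = EqC.transitive _ (same (v-step r))
      (EqC.transitive _ edge (same (sym (trans (cong (class (v-gons M)) (sym (square M r))) (v-step (f M r))))))
    at (there (there (here refl))) = EqC.transitive _ (EqC.symmetric _ edge)
      (same (cong (class (v-gons M)) (sym (involutive (f-matching M) r))))
    at (there (there (there (here refl)))) = EqC.transitive _ (same (v-step (f M r)))
      (EqC.transitive _ (EqC.symmetric _ edge)
        (same (sym (trans (cong (class (v-gons M)) (trans (sym (square M (f M r))) (cong (v M) (involutive (f-matching M) r)))) (v-step r)))))

connected-dual : ∀ M → ConnectedMap M → ConnectedMap (dual M)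
connected-dual M conn x y = EqC.map
  (λ { (g , here p , q) → g , there (here p) , q
     ; (g , there (here p) , q) → g , here p , q
     ; (g , there (there p) , q) → g , there (there p) , q }) (conn x y)

connected-phial : ∀ M → ConnectedMap M → ConnectedMap (phial M)
connected-phial M conn x y = (via EqC.⋆) (conn x y)
  where
  via : ∀ {x y} → Moves (v M ∷ f M ∷ a M ∷ []) x y → SameOrbit (z M ∷ f M ∷ a M ∷ []) x y
  via {x} (_ , here refl , refl) = EqC.transitive _ (EqC.return (f M , there (here refl) , refl))
    (EqC.return (z M , here refl , zv M x))
  via (_ , there p , q) = EqC.return (_ , there p , q)

module Dimensions (M : Map) (conn : ConnectedMap M) (x₀ : Fin (#C M)) where

  dimV : ∃[ r ] HasDim (VSpace M) r × r ℕ.+ 1 ≡ #V (𝔾 M)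
  dimV = connected-dim (𝔾 M) (connected-𝔾 M conn) (class (v-gons M) x₀)

  dimF : ∃[ r ] HasDim (FSpace M) r × r ℕ.+ 1 ≡ #V (𝔾 (dual M))
  dimF = connected-dim (𝔾 (dual M)) (connected-𝔾 (dual M) (connected-dual M conn)) (class (v-gons (dual M)) x₀)

  dimZ : ∃[ r ] HasDim (ZSpace M) r × r ℕ.+ 1 ≡ #V (𝔾 (phial M))
  dimZ = connected-dim (𝔾 (phial M)) (connected-𝔾 (phial M) (connected-phial M conn)) (class (v-gons (phial M)) x₀)

  dimVᗮ : ∃[ d ] HasDim (VSpace M ᗮ) d × proj₁ dimV ℕ.+ d ≡ size (SQ M)
  dimVᗮ = hasDim-ᗮ (proj₁ (proj₂ dimV))

  dimF+Z : ∃[ s ] ∃[ t ] HasDim (FSpace M +ₛ ZSpace M) s × HasDim (FSpace M ∩ₚ ZSpace M) t ×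
           s ℕ.+ t ≡ proj₁ dimF ℕ.+ proj₁ dimZ
  dimF+Z = hasDim-+ₛ-∩ (proj₁ (proj₂ dimF)) (proj₁ (proj₂ dimZ))

  -- The condition on the Euler characteristic without subtraction. The 3 arises because each of the
  -- three connected graphs has one more vertex than the dimension of its coboundary space.
  Count : ℕ → Set
  Count γ = #V (𝔾 (dual M)) ℕ.+ #V (𝔾 (phial M)) ℕ.+ #V (𝔾 M) ≡ size (SQ M) ℕ.+ (3 ℕ.+ γ)

  private
    d s t : ℕ
    d = proj₁ dimVᗮ
    s = proj₁ dimF+Z
    t = proj₁ (proj₂ dimF+Z)

    hasVᗮ : HasDim (VSpace M ᗮ) d
    hasVᗮ = proj₁ (proj₂ dimVᗮ)

    hasF+Z : HasDim (FSpace M +ₛ ZSpace M) s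
    hasF+Z = proj₁ (proj₂ (proj₂ dimF+Z))

    hasF∩Z : HasDim (FSpace M ∩ₚ ZSpace M) t
    hasF∩Z = proj₁ (proj₂ (proj₂ (proj₂ dimF+Z)))

    balance : ∀ {V F Z nv nf nz m d s t : ℕ} → V ℕ.+ 1 ≡ nv → F ℕ.+ 1 ≡ nf → Z ℕ.+ 1 ≡ nz →
              V ℕ.+ d ≡ m → s ℕ.+ t ≡ F ℕ.+ Z →
              ∀ γ → s ℕ.+ t ≡ d ℕ.+ γ ⇔ nf ℕ.+ nz ℕ.+ nv ≡ m ℕ.+ (3 ℕ.+ γ)
    balance {V} {F} {Z} {d = d} {s} {t} refl refl refl refl st γ = mk⇔
      (λ e → trans lhs (trans (cong (ℕ._+ (V ℕ.+ 3)) (trans (sym st) e)) rhs))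
      (λ e → trans st (ℕ.+-cancelʳ-≡ (V ℕ.+ 3) (F ℕ.+ Z) (d ℕ.+ γ) (trans (sym lhs) (trans e (sym rhs)))))
      where
      open Data.Nat.Solver.+-*-Solver

      lhs : F ℕ.+ 1 ℕ.+ (Z ℕ.+ 1) ℕ.+ (V ℕ.+ 1) ≡ F ℕ.+ Z ℕ.+ (V ℕ.+ 3)
      lhs = solve 3 (λ V F Z → F :+ con 1 :+ (Z :+ con 1) :+ (V :+ con 1) := F :+ Z :+ (V :+ con 3)) refl V F Z

      rhs : d ℕ.+ γ ℕ.+ (V ℕ.+ 3) ≡ V ℕ.+ d ℕ.+ (3 ℕ.+ γ)
      rhs = solve 3 (λ V d γ → d :+ γ :+ (V :+ con 3) := V :+ d :+ (con 3 :+ γ)) refl V d γ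

    -- After dim V + dim V^⊥ = |SQ(M)| and the dimension formula for F + Z are inserted, the count
    -- of gons compares dim (F + Z) + dim (F ∩ Z) with dim V^⊥ + γ.
    count⇔ : ∀ γ → s ℕ.+ t ≡ d ℕ.+ γ ⇔ Count γ
    count⇔ = balance {s = s} {t} (proj₂ (proj₂ dimV)) (proj₂ (proj₂ dimF)) (proj₂ (proj₂ dimZ))
      (proj₂ (proj₂ dimVᗮ)) (proj₂ (proj₂ (proj₂ (proj₂ dimF+Z))))

  rich⇒count : Rich M → ∃[ γ ] HasDim (BicycleSpace (𝔾 M)) γ × Count γ
  rich⇒count rich = t ,
    hasDim-≐ {U = FSpace M ∩ₚ ZSpace M} {BicycleSpace (𝔾 M)} (f∩z⊆bicycle M) (bicycle⊆f∩z M rich) hasF∩Z ,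
    Equivalence.to (count⇔ t) (cong (ℕ._+ t) (sym (same rich)))
    where
    same : Rich M → d ≡ s
    same (d′ , s′ , hasVᗮ′ , hasF+Z′ , e) = trans (dim-unique {W = VSpace M ᗮ} hasVᗮ hasVᗮ′)
      (trans e (trans (ℕ.+-identityʳ s′) (dim-unique {W = FSpace M +ₛ ZSpace M} hasF+Z′ hasF+Z)))

  -- For every map F + Z lies in V^⊥ and F ∩ Z in the bicycle space. Two inequalities whose sums
  -- agree are equalities, and the first of them is richness.
  count⇒rich : ∀ γ → HasDim (BicycleSpace (𝔾 M)) γ → Count γ → Rich M
  count⇒rich γ hasB count = d , s , hasVᗮ , hasF+Z , trans (squeeze s≤d t≤γ (Equivalence.from (count⇔ γ) count)) (sym (ℕ.+-identityʳ s))
    where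
    s≤d : s ≤ d
    s≤d = dim-≤ {U = FSpace M +ₛ ZSpace M} {VSpace M ᗮ} (f+z⊆vᗮ M) hasF+Z hasVᗮ

    t≤γ : t ≤ γ
    t≤γ = dim-≤ {U = FSpace M ∩ₚ ZSpace M} {BicycleSpace (𝔾 M)} (f∩z⊆bicycle M) hasF∩Z hasB

    squeeze : ∀ {s d t γ : ℕ} → s ≤ d → t ≤ γ → s ℕ.+ t ≡ d ℕ.+ γ → d ≡ s
    squeeze {s} {d} {t} {γ} s≤d t≤γ e = ℕ.≤-antisym
      (ℕ.+-cancelʳ-≤ γ d s (ℕ.≤-trans (ℕ.≤-reflexive (sym e)) (ℕ.+-monoʳ-≤ s t≤γ))) s≤d

-- The correspondence between maps and sp-embeddings

-- The flags are the vertices of C_M doubled, one copy for either side of the a-edge. Copy `false`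
-- turns by f and bounds the f-gons; copy `true` turns by z.
module MedialMap (M : Map) (conn : ConnectedMap M) where

  pairs : (Fin (#C M) × Bool) ↔ Fin (#C M ℕ.* 2)
  pairs = ↔-trans (↔-refl ×-↔ ↔-sym 2↔Bool) (↔-sym *↔×)

  private
    module E = Inverse pairs

    n₂ : ℕ
    n₂ = #C M ℕ.* 2

    turned : Bool → Fin (#C M) → Fin (#C M)
    turned b = if b then z M else f M

    turned-matching : ∀ b → IsMatching (turned b)
    turned-matching false = f-matching M
    turned-matching true  = z-matching M

    onPairs : (Fin (#C M) × Bool → Fin (#C M) × Bool) → Fin n₂ → Fin n₂
    onPairs g = E.to ∘ g ∘ E.from

    onPairs-to : ∀ g p → onPairs g (E.to p) ≡ E.to (g p)
    onPairs-to g p = cong (E.to ∘ g) (E.strictlyInverseʳ p)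

    to-injective : ∀ {p q} → E.to p ≡ E.to q → p ≡ q
    to-injective {p} {q} e = trans (sym (E.strictlyInverseʳ p)) (trans (cong E.from e) (E.strictlyInverseʳ q))

    matching : ∀ g → (∀ p → g (g p) ≡ p) → (∀ p → g p ≢ p) → IsMatching (onPairs g)
    matching g inv fix = record
      { involutive = λ y → trans (onPairs-to g (g (E.from y))) (trans (cong E.to (inv (E.from y))) (E.strictlyInverseˡ y))
      ; no-fixed   = λ y e → fix (E.from y) (to-injective (trans e (sym (E.strictlyInverseˡ y)))) }

    g₀ g₁ g₂ : Fin (#C M) × Bool → Fin (#C M) × Bool
    g₀ (x , b) = a M x , b
    g₁ (x , b) = turned b x , b
    g₂ (x , b) = x , not b

    not≢ : ∀ b → not b ≢ b
    not≢ false ()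
    not≢ true  ()

    θs : List (Fin n₂ → Fin n₂)
    θs = onPairs g₀ ∷ onPairs g₁ ∷ onPairs g₂ ∷ []

    -- Connectedness of the surface: an f-step stays on side `false`, a z-step crosses to side
    -- `true` and returns, and a v-step is composed of these two.
    component : Fin (#C M) → Fin (size (orbits θs))
    component x = class (orbits θs) (E.to (x , false))

    step : ∀ {g} → onPairs g ∈ θs → ∀ p → class (orbits θs) (E.to (g p)) ≡ class (orbits θs) (E.to p)
    step {g} g∈ p = trans (cong (class (orbits θs)) (sym (onPairs-to g p))) (class-step (orbits θs) g∈ (E.to p))

    component-f : Inv (f M) component
    component-f x = step {g₁} (there (here refl)) (x , false)

    component-z : Inv (z M) component
    component-z x = trans (sym (step {g₂} (there (there (here refl))) (z M x , false)))
      (trans (step {g₁} (there (here refl)) (x , true)) (step {g₂} (there (there (here refl))) (x , false)))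

    component-v : Inv (v M) component
    component-v x = trans (cong component (sym (zv M x))) (trans (component-z (f M x)) (component-f x))

    component-const : ∀ x y → component x ≡ component y
    component-const x y = orbit-invariant component
      (λ { (here refl) → component-v
         ; (there (here refl)) → component-f
         ; (there (there (here refl))) x → step {g₀} (here refl) (x , false) })
      (conn x y)

    component-of : ∀ p → class (orbits θs) (E.to p) ≡ component (proj₁ p)
    component-of (x , false) = refl
    component-of (x , true)  = step {g₂} (there (there (here refl))) (x , false)

  tmap : TMap
  tmap = record
    { #flags = n₂
    ; θ₀ = onPairs g₀
    ; θ₁ = onPairs g₁
    ; θ₂ = onPairs g₂
    ; θ₀-matching = matching g₀ (λ p → cong (_, proj₂ p) (involutive (a-matching M) (proj₁ p)))
                                (λ p e → no-fixed (a-matching M) (proj₁ p) (cong proj₁ e))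
    ; θ₁-matching = matching g₁ (λ { (x , b) → cong (_, b) (involutive (turned-matching b) x) })
                                (λ { (x , b) e → no-fixed (turned-matching b) x (cong proj₁ e) })
    ; θ₂-matching = matching g₂ (λ p → cong (proj₁ p ,_) (not-involutive (proj₂ p)))
                                (λ p e → not≢ (proj₂ p) (cong proj₂ e))
    ; θ₀≢θ₂ = λ y e → not≢ _ (sym (cong proj₂ (to-injective e)))
    ; θ₀θ₂-comm = λ y → trans (onPairs-to g₀ (g₂ (E.from y))) (sym (onPairs-to g₂ (g₀ (E.from y))))
    ; connected = λ y y′ → complete (orbits θs) (trans (cong (class (orbits θs)) (sym (E.strictlyInverseˡ y)))
        (trans (component-of (E.from y)) (trans (component-const _ _) (trans (sym (component-of (E.from y′)))
          (cong (class (orbits θs)) (E.strictlyInverseˡ y′))))))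
    }

  isMedial : IsMedial (f M) (z M) (a M) tmap
  isMedial = record
    { ι = λ x b → E.to (x , b)
    ; π = proj₁ ∘ E.from
    ; side = proj₂ ∘ E.from
    ; ι-π = E.strictlyInverseˡ
    ; π-ι = λ x b → cong proj₁ (E.strictlyInverseʳ (x , b))
    ; side-ι = λ x b → cong proj₂ (E.strictlyInverseʳ (x , b))
    ; θ₀-ι = λ x b → onPairs-to g₀ (x , b)
    ; θ₁-ι = λ x b → onPairs-to g₁ (x , b)
    ; θ₂-ι = λ x b → onPairs-to g₂ (x , b)
    }

count-≥ : ∀ {n m} (c : Fin n → Fin m) s ys → Unique ys → (∀ {x} → x ∈ ys → c x ≡ s) →
          length ys ≤ ℕ∑ (λ x → [ c x ≡? s ])
count-≥ {n} c s ys uniq ys⊆ = ℕ.≤-trans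
  (ℕ.≤-reflexive (trans (sym (listSum-one ys)) (sym (ℕFibre.sum-enumerated (_∈? ys) (λ _ → 1) ys uniq (λ p → p) (λ p → p)))))
  (mono {n} λ x → bound x (x ∈? ys))
  where
  mono : ∀ {n} {g h : Fin n → ℕ} → (∀ x → g x ≤ h x) → ℕ∑ g ≤ ℕ∑ h
  mono {zero}  p = ℕ.z≤n
  mono {suc n} p = ℕ.+-mono-≤ (p zero) (mono (p ∘ suc))

  bound : ∀ x (d : Dec (x ∈ ys)) → (if does d then 1 else 0) ≤ [ c x ≡? s ]
  bound x (yes x∈) = ℕ.≤-reflexive (sym (trans (cong [_≡? s ] (ys⊆ x∈)) (≡?-refl s)))
  bound x (no _)   = ℕ.z≤n

module FromMedial {n : ℕ} {f z a : Fin n → Fin n} {T : TMap} (medial : IsMedial f z a T)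
                  (regular : ∀ w → degree (underlying T) w ≡ 4) where

  open IsMedial medial

  private
    Q : Classes (Moves (f ∷ z ∷ []))
    Q = orbits (f ∷ z ∷ [])

    ff : ∀ x → f (f x) ≡ x
    ff = involutive f-isMatching

    zz : ∀ x → z (z x) ≡ x
    zz = involutive z-isMatching

    four : ∀ x → ℕ∑ (λ y → [ vertexOf y ≡? vertexOf x ]) ≡ 4
    four x = trans (sym (degree-count medial (vertexOf x))) (regular (vertexOf x))

    Q-turn : ∀ b → Inv (turn b) (class Q)
    Q-turn false = class-step Q (here refl)
    Q-turn true  = class-step Q (there (here refl))

    same-vertex : ∀ {x y} → vertexOf x ≡ vertexOf y → SameOrbit (f ∷ z ∷ []) x y
    same-vertex {x} {y} p = complete Q (trans (cong (class Q) (sym (π-ι x false))) (trans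
      (orbit-invariant₂ (class Q ∘ π)
        (λ y → trans (cong (class Q) (π-θ₁ y)) (Q-turn (side y) (π y)))
        (λ y → cong (class Q) (π-θ₂ y))
        (complete (vertices T) p))
      (cong (class Q) (π-ι y false))))

  -- Otherwise {x, f x} would be closed under both turns and the vertex would have degree 2.
  f≢z : ∀ x → f x ≢ z x
  f≢z x p = contradiction (trans (sym (count-enumerated vertexOf (vertexOf x) (x ∷ f x ∷ [])
      (((no-fixed f-isMatching x ∘ sym) ∷ []) ∷ [] ∷ [])
      (λ q → orbit-closed (_∈ (x ∷ f x ∷ [])) (λ { (here refl) → ff ; (there (here refl)) → zz })
        (λ { (here refl) (here refl) → there (here refl)
           ; (here refl) (there (here refl)) → here (ff x)
           ; (there (here refl)) (here refl) → there (here (sym p))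
           ; (there (here refl)) (there (here refl)) → here (trans (cong z p) (zz x)) })
        (same-vertex (sym q)) (here refl))
      (λ { (here refl) → refl ; (there (here refl)) → vertexOf-f x })))
    (four x)) λ ()

  -- Otherwise x, f x, z x, f z x and z f x would be five different edge-ends at a vertex of degree
  -- 4.
  fz-comm : ∀ x → f (z x) ≡ z (f x)
  fz-comm x = decide (f (z x) ≟ z (f x))
    where
    decide : Dec (f (z x) ≡ z (f x)) → f (z x) ≡ z (f x)
    decide (yes p) = p
    decide (no ¬p) = contradiction (ℕ.≤-trans
      (count-≥ vertexOf (vertexOf x) (f (z x) ∷ x ∷ f x ∷ z x ∷ z (f x) ∷ [])
        (((λ e → f≢z x (trans (cong f (sym e)) (ff (z x)))) ∷
            (λ e → no-fixed z-isMatching x (matching-injective f-isMatching e)) ∷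
            no-fixed f-isMatching (z x) ∷ ¬p ∷ []) ∷
         ((no-fixed f-isMatching x ∘ sym) ∷ (no-fixed z-isMatching x ∘ sym) ∷
            (λ e → f≢z x (trans (sym (zz (f x))) (cong z (sym e)))) ∷ []) ∷
         (f≢z x ∷ (no-fixed z-isMatching (f x) ∘ sym) ∷ []) ∷
         ((λ e → no-fixed f-isMatching x (sym (matching-injective z-isMatching e))) ∷ []) ∷ [] ∷ [])
        (λ { (here refl) → trans (vertexOf-f (z x)) (vertexOf-z x)
           ; (there (here refl)) → refl
           ; (there (there (here refl))) → vertexOf-f x
           ; (there (there (there (here refl)))) → vertexOf-z x
           ; (there (there (there (there (here refl))))) → trans (vertexOf-z (f x)) (vertexOf-f x) }))
      (ℕ.≤-reflexive (four x))) (ℕ.<⇒≱ ℕ.≤-refl)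

  map : Map
  map = record
    { #C = n
    ; v = z ∘ f
    ; f = f
    ; a = a
    ; v-matching = record
      { involutive = λ x → trans (cong z (fz-comm (f x))) (trans (zz (f (f x))) (ff x))
      ; no-fixed   = λ x e → f≢z x (trans (sym (zz (f x))) (cong z e)) }
    ; f-matching = f-isMatching
    ; a-matching = a-isMatching
    ; v≢f = λ x → no-fixed z-isMatching (f x)
    ; square = λ x → sym (fz-comm (f x))
    ; SQ = orbits (z ∘ f ∷ f ∷ [])
    }

  -- In `map` the matching v is defined as z∘f, so its z unfolds to z∘f∘f; this agrees with the
  -- given `z` pointwise only, and the flags on side `true` have to be adjusted.
  map-medial : IsMedial f (λ x → z (f (f x))) a T
  map-medial = record
    { ι = ι ; π = π ; side = side ; ι-π = ι-π ; π-ι = π-ι ; side-ι = side-ι ; θ₀-ι = θ₀-ι ; θ₂-ι = θ₂-ι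
    ; θ₁-ι = λ { x false → θ₁-ι x false ; x true → trans (θ₁-ι x true) (cong (λ y → ι (z y) true) (sym (ff x))) }
    }

-- The vertices of the future C_M are the pairs of flags related by θ₂. Such a pair has one flag on
-- a face of each colour, so the colouring names the two flags consistently, and θ₀ and θ₁ preserve
-- the names.
module Coloured (T : TMap) (colouring : FaceTwoColourable T) where

  private
    P : Classes (Moves (θ₂ T ∷ []))
    P = orbits (θ₂ T ∷ [])

    side : Fin (#flags T) → Bool
    side y = proj₁ colouring (class (faces T) y)

    side-θ₀ : Inv (θ₀ T) side
    side-θ₀ y = cong (proj₁ colouring) (class-step (faces T) (here refl) y)

    side-θ₁ : Inv (θ₁ T) side
    side-θ₁ y = cong (proj₁ colouring) (class-step (faces T) (there (here refl)) y)

    side-θ₂ : ∀ y → side (θ₂ T y) ≡ not (side y)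
    side-θ₂ y = ≢⇒not (λ e → proj₂ colouring y (sym e))

    choose : Bool → Fin (#flags T) → Fin (#flags T)
    choose b y = if b then θ₂ T y else y

    π : Fin (#flags T) → Fin (size P)
    π = class P

    -- Of the representative and its θ₂-partner, the flag with colour `b` is taken.
    ι : Fin (size P) → Bool → Fin (#flags T)
    ι x b = choose (side (rep P x) xor b) (rep P x)

    π-choose : ∀ b y → π (choose b y) ≡ π y
    π-choose false y = refl
    π-choose true  y = class-step P (here refl) y

    π-ι : ∀ x b → π (ι x b) ≡ x
    π-ι x b = trans (π-choose (side (rep P x) xor b) (rep P x)) (class-rep P x)

    side-choose : ∀ b y → side (choose b y) ≡ b xor side y
    side-choose false y = refl
    side-choose true  y = side-θ₂ y

    side-ι : ∀ x b → side (ι x b) ≡ b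
    side-ι x b = trans (side-choose (side (rep P x) xor b) (rep P x)) (restore (side (rep P x)) b)
      where
      restore : ∀ s b → (s xor b) xor s ≡ b
      restore false b = xor-identityʳ b
      restore true  b = trans (xor-comm (not b) true) (not-involutive b)

    ι-π : ∀ y → ι (π y) (side y) ≡ y
    ι-π y = at (orbit-closed (_∈ (rep P (π y) ∷ θ₂ T (rep P (π y)) ∷ [])) (λ { (here refl) → involutive (θ₂-matching T) })
      (λ { (here refl) (here refl) → there (here refl)
         ; (here refl) (there (here refl)) → here (involutive (θ₂-matching T) _) })
      (rep∼ P y) (here refl))
      where
      at : y ∈ (rep P (π y) ∷ θ₂ T (rep P (π y)) ∷ []) → ι (π y) (side y) ≡ y
      at (here p) = trans (cong (λ b → choose b (rep P (π y))) (trans (cong (λ w → side (rep P (π y)) xor side w) p)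
        (xor-same (side (rep P (π y)))))) (sym p)
      at (there (here p)) = trans (cong (λ b → choose b (rep P (π y))) (trans (cong (λ w → side (rep P (π y)) xor side w) p)
        (trans (cong (side (rep P (π y)) xor_) (side-θ₂ (rep P (π y)))) (xor-not (side (rep P (π y))))))) (sym p)

    ι-of : ∀ {y x b} → π y ≡ x → side y ≡ b → ι x b ≡ y
    ι-of refl refl = ι-π _

    θ₂-ι : ∀ x b → θ₂ T (ι x b) ≡ ι x (not b)
    θ₂-ι x b = sym (ι-of (trans (class-step P (here refl) (ι x b)) (π-ι x b))
      (trans (side-θ₂ (ι x b)) (cong not (side-ι x b))))

  f′ z′ a′ : Fin (size P) → Fin (size P)
  f′ x = π (θ₁ T (ι x false))
  z′ x = π (θ₁ T (ι x true))
  a′ x = π (θ₀ T (ι x false))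

  medial : IsMedial f′ z′ a′ T
  medial = record
    { ι = ι ; π = π ; side = side ; ι-π = ι-π ; π-ι = π-ι ; side-ι = side-ι
    ; θ₀-ι = θ₀-ι
    ; θ₁-ι = λ { x false → sym (ι-of refl (trans (side-θ₁ _) (side-ι x false)))
               ; x true  → sym (ι-of refl (trans (side-θ₁ _) (side-ι x true))) }
    ; θ₂-ι = θ₂-ι
    }
    where
    θ₀-ι : ∀ x b → θ₀ T (ι x b) ≡ ι (a′ x) b
    θ₀-ι x false = sym (ι-of refl (trans (side-θ₀ _) (side-ι x false)))
    -- The matching `a′` is defined through side `false`; commutation of θ₀ and θ₂ carries it over
    -- to the other side.
    θ₀-ι x true  = trans (cong (θ₀ T) (sym (θ₂-ι x false))) (trans (θ₀θ₂-comm T (ι x false))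
      (trans (cong (θ₂ T) (θ₀-ι x false)) (θ₂-ι (a′ x) false)))

-- Invariance of connectedness and of the bicycle space under isomorphism

module _ {G H : Graph} (i : G ≅ H) where

  open _≅_ i

  coboundary-≅ : ∀ U → permuted (Inverse.from E↔) (coboundary G U) ≡ coboundary H (permuted (Inverse.from V↔) U)
  coboundary-≅ U = lookup-ext λ e → begin
    lookup (permuted (Inverse.from E↔) (coboundary G U)) e
      ≡⟨ trans (lookup∘tabulate _ e) (lookup∘tabulate _ (Inverse.from E↔ e)) ⟩
    total U (ends G (Inverse.from E↔ e))
      ≡⟨ either (_≅_.ends-≅ (≅-sym i) e) ⟩
    lookup U (Inverse.from V↔ (proj₁ (ends H e))) xor lookup U (Inverse.from V↔ (proj₂ (ends H e)))
      ≡⟨ cong₂ _xor_ (lookup∘tabulate _ (proj₁ (ends H e))) (lookup∘tabulate _ (proj₂ (ends H e))) ⟨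
    total (permuted (Inverse.from V↔) U) (ends H e)
      ≡⟨ lookup∘tabulate _ e ⟨
    lookup (coboundary H (permuted (Inverse.from V↔) U)) e ∎
    where
    total : ∀ {n} → Subset n → Fin n × Fin n → Bool
    total U (x , y) = lookup U x xor lookup U y

    either : ∀ {p q} → p ≡ q ⊎ p ≡ swap q → total U p ≡ total U q
    either         (inj₁ refl) = refl
    either {q = q} (inj₂ refl) = xor-comm (lookup U (proj₂ q)) _

  connected-≅ : Connected G → Connected H
  connected-≅ conn u w = ≡.subst₂ (EqClosure (Adjacent H)) (Inverse.strictlyInverseˡ V↔ u) (Inverse.strictlyInverseˡ V↔ w)
    (EqC.gfold (EqC.isEquivalence (Adjacent H)) (Inverse.to V↔) (λ { (e , refl) → edge e (ends-≅ e) })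
      (conn (Inverse.from V↔ u) (Inverse.from V↔ w)))
    where
    edge : ∀ e → ends H (Inverse.to E↔ e) ≡ mapEnds (ends G e) ⊎ ends H (Inverse.to E↔ e) ≡ swap (mapEnds (ends G e)) →
           EqClosure (Adjacent H) (proj₁ (mapEnds (ends G e))) (proj₂ (mapEnds (ends G e)))
    edge e (inj₁ p) = EqC.return (Inverse.to E↔ e , p)
    edge e (inj₂ p) = EqC.symmetric (Adjacent H) (EqC.return (Inverse.to E↔ e , p))

module _ {G H : Graph} (i : G ≅ H) where

  open _≅_ i

  bicycle-⊆ : ∀ {A} → BicycleSpace G A → BicycleSpace H (permuted (Inverse.from E↔) A)
  bicycle-⊆ {A} (cyc , U , p) =
    ᗮ⇒cycle H (permuted (Inverse.from E↔) A) (λ { B (W , refl) → dot⇒⟨⟩≡0 (permuted (Inverse.from E↔) A) (coboundary H W) (begin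
      dot (permuted (Inverse.from E↔) A) (coboundary H W)
        ≡⟨ dot-permuted E↔ (permuted (Inverse.from E↔) A) (coboundary H W) ⟨
      dot (permuted (Inverse.to E↔) (permuted (Inverse.from E↔) A)) (permuted (Inverse.to E↔) (coboundary H W))
        ≡⟨ cong₂ dot (trans (permuted-permuted (Inverse.to E↔) (Inverse.from E↔) A) (permuted-id (Inverse.strictlyInverseʳ E↔) A))
                     (coboundary-≅ (≅-sym i) W) ⟩
      dot A (coboundary G (permuted (Inverse.to V↔) W))
        ≡⟨ ⟨⟩≡0⇒dot A _ (cycle⇒ᗮ G A cyc _ (permuted (Inverse.to V↔) W , refl)) ⟩
      false ∎) }) ,
    permuted (Inverse.from V↔) U , trans (sym (coboundary-≅ i U)) (cong (permuted (Inverse.from E↔)) p)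

module _ {G H : Graph} (i : G ≅ H) where

  open _≅_ i

  bicycle-dim : ∀ {γ} → HasDim (BicycleSpace G) γ → HasDim (BicycleSpace H) γ
  bicycle-dim dim = hasDim-≐ {U = Image φ (BicycleSpace G)} {BicycleSpace H} to-H from-H
    (hasDim-image {φ = φ} (permuted-⊕ (Inverse.from E↔)) (λ {A} _ p → injective A p) dim)
    where
    φ : Subset (#E G) → Subset (#E H)
    φ = permuted (Inverse.from E↔)

    ψφ : ∀ A → permuted (Inverse.to E↔) (φ A) ≡ A
    ψφ A = trans (permuted-permuted (Inverse.to E↔) (Inverse.from E↔) A) (permuted-id (Inverse.strictlyInverseʳ E↔) A)

    injective : ∀ A → φ A ≡ ⊥ → A ≡ ⊥
    injective A p = trans (sym (ψφ A)) (trans (cong (permuted (Inverse.to E↔)) p) (additive-⊥ (permuted-⊕ (Inverse.to E↔))))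

    to-H : Image φ (BicycleSpace G) ⊆ₚ BicycleSpace H
    to-H (A , A∈ , refl) = bicycle-⊆ i A∈

    from-H : BicycleSpace H ⊆ₚ Image φ (BicycleSpace G)
    from-H {B} B∈ = permuted (Inverse.to E↔) B , bicycle-⊆ (≅-sym i) B∈ ,
      trans (permuted-permuted (Inverse.from E↔) (Inverse.to E↔) B) (permuted-id (Inverse.strictlyInverseˡ E↔) B)

-- The equivalences for a connected graph with an edge

EulerEmbeddable GenerativelyEmbeddable : Graph → Set
EulerEmbeddable G = ∃[ γ ] HasDim (BicycleSpace G) γ × (∃[ T ] IsSpEmbedding T G × χ T ≡ + 3 - + #V G + + γ)
GenerativelyEmbeddable G = ∃[ T ] IsSpEmbedding T G ×
  CycleSpace (underlying T) ≐ Span (tabulate (boundary T) ++ tabulate (smoothPathEdges T))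

module _ (G : Graph) (conn : Connected G) (nonempty : 1 ≤ #E G) where

  module From (M : Map) (iso : 𝔾 M ≅ G) where

    mapConnected : ConnectedMap M
    mapConnected = connectedMap M (connected-≅ (≅-sym iso) conn)

    flag : Fin (#C M)
    -- An edge of `G` is a square of the map and so yields a vertex of C_M; hence none of the three
    -- graphs is empty and each coboundary space falls short of the number of vertices by exactly
    -- one.
    flag = rep (SQ M) (Inverse.from (_≅_.E↔ iso) (fromℕ< nonempty))

    open Dimensions M mapConnected flag public

    #V≡ : #V (𝔾 M) ≡ #V G
    #V≡ = ↔⇒≡ (_≅_.V↔ iso)

    count⇔χ : ∀ T → IsMedial (f M) (z M) (a M) T → ∀ γ → Count γ ⇔ χ T ≡ + 3 - + #V G + + γ
    count⇔χ T medial γ = subst (λ k → Count γ ⇔ χ T ≡ + 3 - + k + + γ) #V≡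
      (Counts.χ-formula M T medial (#V (𝔾 M)) γ)

  module Embedded (T : TMap) (sp : IsSpEmbedding T G) where

    open FromMedial (Coloured.medial T (IsSpEmbedding.face-colourable sp)) (IsSpEmbedding.four-regular sp) public
      using (map; map-medial)

    iso : 𝔾 map ≅ G
    iso = ≅-trans (Medial.graph-iso map T map-medial) (≅-sym (IsSpEmbedding.graph sp))

  mapRich⇒euler : MapRich G → EulerEmbeddable G
  mapRich⇒euler (M , rich , iso) = embed (rich⇒count rich)
    where
    open From M iso
    open MedialMap M mapConnected

    embed : ∃[ γ ] HasDim (BicycleSpace (𝔾 M)) γ × Count γ → EulerEmbeddable G
    embed (γ , dim , count) = γ , bicycle-dim iso dim , tmap ,
      Counts.isSpEmbedding M tmap isMedial iso , Equivalence.to (count⇔χ tmap isMedial γ) count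

  euler⇒mapRich : EulerEmbeddable G → MapRich G
  euler⇒mapRich (γ , dim , T , sp , χ≡) =
    map , count⇒rich γ (bicycle-dim (≅-sym iso) dim) (Equivalence.from (count⇔χ T map-medial γ) χ≡) , iso
    where
    open Embedded T sp
    open From map iso

  mapRich⇒generative : MapRich G → GenerativelyEmbeddable G
  mapRich⇒generative (M , rich , iso) = tmap , Counts.isSpEmbedding M tmap isMedial iso ,
    Cycles.split⇒generated M tmap isMedial (rich⇒split M rich)
    where
    open From M iso
    open MedialMap M mapConnected

  generative⇒mapRich : GenerativelyEmbeddable G → MapRich G
  generative⇒mapRich (T , sp , generated) =
    map , split⇒rich map (Cycles.generated⇒split map T map-medial generated) , iso
    where open Embedded T sp

theorem2p9 : ((G : Graph) → Connected G → 1 ≤ #E G →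
    (MapRich G ⇔
    (∃[ γ ] HasDim (BicycleSpace G) γ ×
    (∃[ T ] IsSpEmbedding T G × χ T ≡ + 3 - + #V G + + γ)))
    ×
    ((∃[ γ ] HasDim (BicycleSpace G) γ ×
    (∃[ T ] IsSpEmbedding T G × χ T ≡ + 3 - + #V G + + γ))
    ⇔
    (∃[ T ] IsSpEmbedding T G ×
    CycleSpace (underlying T) ≐ Span (tabulate (boundary T) ++ tabulate (smoothPathEdges T)))))
    ×
    ((M : Map) →
    (Orientable (phial M) → Eulerian (𝔾 M))
    ×
    (Rich M → Rich (phial M) → Eulerian (𝔾 M) → Orientable (phial M)))
theorem2p9 =
  (λ G conn nonempty →
    mk⇔ (mapRich⇒euler G conn nonempty) (euler⇒mapRich G conn nonempty) ,
    mk⇔ (mapRich⇒generative G conn nonempty ∘ euler⇒mapRich G conn nonempty)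
        (mapRich⇒euler G conn nonempty ∘ generative⇒mapRich G conn nonempty)) ,
  (λ M → orientable-phial⇒eulerian M , λ _ → rich-eulerian⇒orientable M)
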